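{- Let $n>1$ be a positive odd integer and let $m$ be either $n-1$ or $(n+1)/2$. Then \[ \sum_{k=0}^{m}[4k-1]\frac{(q^{ -1};q^2)_k^4}{(q^2;q^2)_k^4}\, q^{4k} \equiv 0 \pmod{[n]\Phi_n(q)^2}. \]
   Context: Here $q$ is an indeterminate. For $x$ and a base $p$ (a power of $q$), $(x;p)_k=\prod_{j=0}^{k-1}(1-xp^j)$ for integers $k\ge0$. The $q$-integer is $[j]=(1-q^j)/(1-q)$ (so $[j]=1+q+\cdots+q^{j-1}$ for $j\ge1$), and $\Phi_n(q)$ is the $n$-th cyclotomic polynomial. For rational functions $A(q),B(q)$ and a polynomial $P(q)$, $A\equiv B\pmod{P}$ means that the numerator of the reduced form of $A-B$ is divisible by $P$ in $\mathbb{Z}[q]$. -}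

module Defs where

open import Data.Nat as ℕ using (ℕ; zero; suc)
open import Data.Nat.Divisibility using (_∣?_)
open import Data.Integer as ℤ using (ℤ; +_; -[1+_])
open import Data.List using (List; []; _∷_; map; foldr; replicate; _++_; filter; upTo)
open import Data.List.Relation.Unary.All using (All)
open import Data.Product using (∃; ∃-syntax; _×_)
open import Data.Sum using (_⊎_)
open import Relation.Binary.PropositionalEquality using (_≡_)
open import Relation.Nullary using (¬_)

-- Polynomials in ℤ[q]: coefficient lists, lowest degree first.
-- Trailing zeros are allowed; equality is semantic (_≈P_).

Poly : Set
Poly = List ℤ

infixl 6 _+P_ _-P_
infixl 7 _*P_

_+P_ : Poly → Poly → Poly
[]       +P q        = q
(a ∷ p)  +P []       = a ∷ p
(a ∷ p)  +P (b ∷ q)  = (a ℤ.+ b) ∷ (p +P q)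

negP : Poly → Poly
negP = map (λ a → ℤ.- a)

_-P_ : Poly → Poly → Poly
p -P q = p +P negP q

_*P_ : Poly → Poly → Poly
[]      *P q = []
(a ∷ p) *P q = map (a ℤ.*_) q +P (ℤ.0ℤ ∷ (p *P q))

oneP : Poly
oneP = ℤ.1ℤ ∷ []

Xpow : ℕ → Poly
Xpow n = replicate n ℤ.0ℤ ++ (ℤ.1ℤ ∷ [])

prodP : List Poly → Poly
prodP = foldr _*P_ oneP

IsZeroP : Poly → Set
IsZeroP p = All (_≡ ℤ.0ℤ) p

_≈P_ : Poly → Poly → Set
p ≈P q = IsZeroP (p -P q)

_∣P_ : Poly → Poly → Set
c ∣P p = ∃[ r ] p ≈P (c *P r)

IsUnitP : Poly → Set
IsUnitP c = (c ≈P oneP) ⊎ (c ≈P negP oneP)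

CoprimeP : Poly → Poly → Set
CoprimeP N D = ∀ c → c ∣P N → c ∣P D → IsUnitP c

qintP : ℕ → Poly
qintP n = replicate n ℤ.1ℤ

-- Φ is the family of cyclotomic polynomials: q^n - 1 = ∏_{d ∣ n} Φ_d
-- for all n ≥ 1 (this determines Φ_n uniquely for n ≥ 1).
divisors : ℕ → List ℕ
divisors n = filter (_∣? n) (upTo (suc n))

IsCyclotomic : (ℕ → Poly) → Set
IsCyclotomic Φ = ∀ n → 1 ℕ.≤ n → (Xpow n -P oneP) ≈P prodP (map Φ (divisors n))

record Frac : Set where
  constructor _//_
  field
    num : Poly
    den : Poly
open Frac public

infixl 6 _+F_ _-F_
infixl 7 _*F_ _/F_

_+F_ : Frac → Frac → Frac
(a // b) +F (c // d) = ((a *P d) +P (c *P b)) // (b *P d)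

_*F_ : Frac → Frac → Frac
(a // b) *F (c // d) = (a *P c) // (b *P d)

negF : Frac → Frac
negF (a // b) = negP a // b

_-F_ : Frac → Frac → Frac
x -F y = x +F negF y

_/F_ : Frac → Frac → Frac
(a // b) /F (c // d) = (a *P d) // (b *P c)

oneF : Frac
oneF = oneP // oneP

zeroF : Frac
zeroF = [] // oneP

powF : Frac → ℕ → Frac
powF x zero    = oneF
powF x (suc k) = x *F powF x k

qpowF : ℤ → Frac
qpowF (+ n)      = Xpow n // oneP
qpowF -[1+ n ]   = oneP // Xpow (suc n)

qintF : ℤ → Frac
qintF j = (oneF -F qpowF j) /F (oneF -F qpowF (+ 1))

poch : Frac → Frac → ℕ → Frac
poch x p zero    = oneF
poch x p (suc k) = poch x p k *F (oneF -F (x *F powF p k))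

sumF : (ℕ → Frac) → ℕ → Frac
sumF f zero    = f zero
sumF f (suc m) = sumF f m +F f (suc m)

-- A ≡ B (mod P): the reduced form N/D of A - B has P ∣ N.
-- (N, D) is a reduced form of A - B: D ≠ 0, N/D = A - B, gcd(N,D) = unit.
-- We also require A, B to have nonzero denominators.
CongMod : Frac → Frac → Poly → Set
CongMod A B P =
  ¬ IsZeroP (den A) × ¬ IsZeroP (den B) ×
  ∃[ N ] ∃[ D ] ( ¬ IsZeroP D
                × (num (A -F B) *P D) ≈P (N *P den (A -F B))
                × CoprimeP N D
                × P ∣P N )

q : Frac
q = qpowF (+ 1)

summand : ℕ → Frac
summand k =
  qintF ((+ (4 ℕ.* k)) ℤ.- ℤ.1ℤ)
  *F powF (poch (qpowF -[1+ 0 ]) (powF q 2) k) 4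
  /F powF (poch (powF q 2) (powF q 2) k) 4
  *F qpowF (+ (4 ℕ.* k))

S : ℕ → Frac
S m = sumF summand m

-- Watson's transformation expresses the truncated sum Sₘ, up to a power of q, as
-- (a_m / b_m)² T_m with a_m = (q;q²)_m, b_m = (q²;q²)_m and T_m a terminating 4φ3 series;
-- since c_k = S_k − S_{k−1} is a q-Saalschütz sum, it follows by induction on m.
--
-- Modulo [n]: away from the factors 1 + qⁱ, which are prime to [n] for odd n, every
-- (a_m / b_m) t_{m,j}, t_{m,j} a term of T_m, is a product of Gaussian binomials and q-Catalan numbers, while [n]
-- divides the remaining a_m / b_m when m = n − 1 or m = (n + 1)/2.
--
-- Modulo Φ_n³: for m = (n + 1)/2 the denominators are prime to Φ_n, each of the two factors
-- a_m / b_m contains 1 − qⁿ, and T_m modulo Φ_n becomes a Gosper-summable series whose sum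
-- contains 1 − qⁿ again.  The terms with (n + 1)/2 < k < n vanish modulo Φ_n⁴.
--
-- The two are combined through [n] = Φ_n Ψ with Φ_n prime to Ψ.

module Submission where

open import Algebra.Bundles using (CommutativeRing)
import Algebra.Solver.Ring
open import Algebra.Solver.Ring.AlmostCommutativeRing
  using (fromCommutativeRing; _-Raw-AlmostCommutative⟶_)
open import Data.Empty using (⊥-elim)
open import Data.Integer as ℤ using (ℤ; +_; -[1+_]; 0ℤ; 1ℤ; ∣_∣)
open import Data.Integer.Divisibility.Signed as Div using (divides) renaming (_∣_ to _∣ℤ_; _∣?_ to _∣ℤ?_)
import Data.Integer.Properties as ℤₚ
open import Data.List using (List; []; _∷_; map; _++_; length; filter; upTo)
import Data.List.Properties as Listₚ
open import Data.List.Relation.Unary.All using (All; []; _∷_)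
open import Data.Maybe using (Maybe; just; nothing)
open import Data.Nat as ℕ using (ℕ; zero; suc)
open import Data.Nat.Coprimality using (Coprime; coprime-divisor)
open import Data.Nat.Divisibility as ∣ℕ using (_∣?_) renaming (_∣_ to _∣ℕ_)
open import Data.Nat.GCD using (gcd; gcd[m,n]∣m; gcd[m,n]∣n; module Bézout; gcd-GCD)
open import Data.Nat.ListAction using (product)
open import Data.Nat.Primality using (Prime; euclidsLemma; prime⇒nonTrivial; prime[2])
open import Data.Nat.Primality.Factorisation using (factorise; PrimeFactorisation)
import Data.Nat.Properties as ℕₚ
open import Data.Product using (_,_; _×_; ∃-syntax; proj₁; proj₂)
open import Data.Sum using (_⊎_; inj₁; inj₂; [_,_]′) renaming (map to ⊎-map)
import Data.Vec as Vec
open import Data.Vec.N-ary using (N-ary; Eq; _$ⁿ_; curryⁿ; curryⁿ-cong)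
open import Level using (0ℓ; _⊔_)
open import Relation.Binary.PropositionalEquality as ≡ using (_≡_)
open import Relation.Nullary using (¬_; Dec; yes; no)

-- The transformation is Watson's in base q² with a = b = c = d = q⁻¹, e = q²ᵐ⁺¹ and terminating
-- parameter q⁻²ᵐ: then (e; q²)ₖ and (q⁻²ᵐ; q²)ₖ cancel against their well-poised partners, and the
-- terminating series is the given sum cut off at m. The power of q in front is -q⁻¹qᵐ: the first
-- part is (1 - q⁻¹)/(1 - q), the second comes from reversing two products.
--
-- For composite n the obstacle is that [n] shares factors with many 1 - q²ᵏ, so denominators cannot
-- be inverted modulo [n]. The q-identities are therefore proved in a ring where every 1 - qᵏ with k
-- ≥ 1 is invertible, and divisibility means that the quotient lies in a subring L: the fractions
-- without poles at [n] in one use, at Φₙ in the other.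
--
-- The claim concerns reduced fractions over ℤ[q], which is not a principal ideal ring. Bézout
-- identities are available only up to a nonzero integer, and Gauss's lemma turns divisibility over
-- ℚ back into divisibility over ℤ; hence denominators and moduli are kept primitive.

-- Polynomial identities with integer coefficients in a commutative ring

module IntegerSolver {c ℓ} (R : CommutativeRing c ℓ) where
  open CommutativeRing R
  open import Algebra.Properties.Ring ring
  open import Algebra.Properties.Semiring.Mult.TCOptimised semiring renaming (_×_ to _·_)
  open import Relation.Binary.Reasoning.Setoid setoid

  ⟦_⟧ℤ : ℤ → Carrier
  ⟦ + n ⟧ℤ      = n · 1#
  ⟦ -[1+ n ] ⟧ℤ = - (suc n · 1#)

  private
    cancelˡ : ∀ x y z → (x + y) - (x + z) ≈ y - z
    cancelˡ x y z = begin
      (x + y) - (x + z)       ≈⟨ +-congˡ (sym (-‿+-comm x z)) ⟩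
      (x + y) + (- x + - z)   ≈⟨ +-congʳ (+-comm x y) ⟩
      (y + x) + (- x + - z)   ≈⟨ +-assoc y x _ ⟩
      y + (x + (- x + - z))   ≈⟨ +-congˡ (sym (+-assoc x _ _)) ⟩
      y + ((x + - x) + - z)   ≈⟨ +-congˡ (+-congʳ (-‿inverseʳ x)) ⟩
      y + (0# + - z)          ≈⟨ +-congˡ (+-identityˡ _) ⟩
      y - z                   ∎

    suc-× : ∀ n → suc n · 1# ≈ 1# + n · 1#
    suc-× n = ×-homo-+ 1# 1 n

    ⊖-homo : ∀ m n → ⟦ m ℤ.⊖ n ⟧ℤ ≈ m · 1# - n · 1#
    ⊖-homo zero    zero    = sym (-‿inverseʳ _)
    ⊖-homo zero    (suc n) = sym (+-identityˡ _)
    ⊖-homo (suc m) zero    = sym (trans (+-congˡ -0#≈0#) (+-identityʳ _))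
    ⊖-homo (suc m) (suc n) = begin
      ⟦ suc m ℤ.⊖ suc n ⟧ℤ              ≡⟨ ≡.cong ⟦_⟧ℤ (ℤₚ.[1+m]⊖[1+n]≡m⊖n m n) ⟩
      ⟦ m ℤ.⊖ n ⟧ℤ                      ≈⟨ ⊖-homo m n ⟩
      m · 1# - n · 1#                   ≈⟨ sym (cancelˡ 1# _ _) ⟩
      (1# + m · 1#) - (1# + n · 1#)     ≈⟨ +-cong (sym (suc-× m)) (-‿cong (sym (suc-× n))) ⟩
      suc m · 1# - suc n · 1#           ∎

    neg-homo : ∀ i → ⟦ ℤ.- i ⟧ℤ ≈ - ⟦ i ⟧ℤ
    neg-homo (+ zero)  = sym -0#≈0#
    neg-homo (+ suc n) = refl
    neg-homo -[1+ n ]  = sym (-‿involutive _)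

    +-homo : ∀ i j → ⟦ i ℤ.+ j ⟧ℤ ≈ ⟦ i ⟧ℤ + ⟦ j ⟧ℤ
    +-homo (+ m)    (+ n)    = ×-homo-+ 1# m n
    +-homo (+ m)    -[1+ n ] = ⊖-homo m (suc n)
    +-homo -[1+ m ] (+ n)    = trans (⊖-homo n (suc m)) (+-comm _ _)
    +-homo -[1+ m ] -[1+ n ] = begin
      - (suc (suc (m ℕ.+ n)) · 1#)        ≡⟨ ≡.cong (λ k → - (k · 1#)) (≡.cong suc (≡.sym (ℕₚ.+-suc m n))) ⟩
      - ((suc m ℕ.+ suc n) · 1#)          ≈⟨ -‿cong (×-homo-+ 1# (suc m) (suc n)) ⟩
      - (suc m · 1# + suc n · 1#)         ≈⟨ sym (-‿+-comm _ _) ⟩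
      - (suc m · 1#) + - (suc n · 1#)     ∎

    *-homo⁺ : ∀ m j → ⟦ + m ℤ.* j ⟧ℤ ≈ (m · 1#) * ⟦ j ⟧ℤ
    *-homo⁺ m (+ n) = begin
      ⟦ + m ℤ.* + n ⟧ℤ        ≡⟨ ≡.cong ⟦_⟧ℤ (≡.sym (ℤₚ.pos-* m n)) ⟩
      (m ℕ.* n) · 1#          ≈⟨ ×1-homo-* m n ⟩
      (m · 1#) * (n · 1#)     ∎
    *-homo⁺ m -[1+ n ] = begin
      ⟦ + m ℤ.* -[1+ n ] ⟧ℤ              ≡⟨ ≡.cong ⟦_⟧ℤ (≡.sym (ℤₚ.neg-distribʳ-* (+ m) (+ suc n))) ⟩
      ⟦ ℤ.- (+ m ℤ.* + suc n) ⟧ℤ         ≈⟨ neg-homo (+ m ℤ.* + suc n) ⟩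
      - ⟦ + m ℤ.* + suc n ⟧ℤ             ≈⟨ -‿cong (*-homo⁺ m (+ suc n)) ⟩
      - ((m · 1#) * (suc n · 1#))        ≈⟨ -‿distribʳ-* _ _ ⟩
      (m · 1#) * - (suc n · 1#)          ∎

    *-homo : ∀ i j → ⟦ i ℤ.* j ⟧ℤ ≈ ⟦ i ⟧ℤ * ⟦ j ⟧ℤ
    *-homo (+ m)    j = *-homo⁺ m j
    *-homo -[1+ m ] j = begin
      ⟦ -[1+ m ] ℤ.* j ⟧ℤ          ≡⟨ ≡.cong ⟦_⟧ℤ (≡.sym (ℤₚ.neg-distribˡ-* (+ suc m) j)) ⟩
      ⟦ ℤ.- (+ suc m ℤ.* j) ⟧ℤ     ≈⟨ neg-homo (+ suc m ℤ.* j) ⟩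
      - ⟦ + suc m ℤ.* j ⟧ℤ         ≈⟨ -‿cong (*-homo⁺ (suc m) j) ⟩
      - ((suc m · 1#) * ⟦ j ⟧ℤ)    ≈⟨ -‿distribˡ-* _ _ ⟩
      - (suc m · 1#) * ⟦ j ⟧ℤ      ∎

    morphism : CommutativeRing.rawRing ℤₚ.+-*-commutativeRing
                 -Raw-AlmostCommutative⟶ fromCommutativeRing R
    morphism = record
      { ⟦_⟧    = ⟦_⟧ℤ
      ; +-homo = +-homo
      ; *-homo = *-homo
      ; -‿homo = neg-homo
      ; 0-homo = refl
      ; 1-homo = refl
      }

    coeff≟ : ∀ i j → Maybe (⟦ i ⟧ℤ ≈ ⟦ j ⟧ℤ)
    coeff≟ i j with i ℤ.≟ j
    ... | yes ≡.refl = just refl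
    ... | no _       = nothing

  private
    module Solver = Algebra.Solver.Ring _ _ morphism coeff≟
  open Solver public using (_:=_; _:+_; _:*_; _:-_; :-_; con; Polynomial)

  :0 :1 : ∀ {n} → Polynomial n
  :0 = con (+ 0)
  :1 = con (+ 1)

  close : ∀ n → N-ary n (Polynomial n) (Polynomial n × Polynomial n) → Polynomial n × Polynomial n
  close n f = f $ⁿ Vec.map Solver.var (Vec.allFin n)

  -- Unlike the library's solve, this one compares the normal forms as syntax,
  -- so that checking an application never unfolds the operations of R.
  solve : ∀ n (f : N-ary n (Polynomial n) (Polynomial n × Polynomial n)) →
          Solver.normalise (proj₁ (close n f)) ≡ Solver.normalise (proj₂ (close n f)) →
          Eq n _≈_ (curryⁿ Solver.⟦ proj₁ (close n f) ⟧) (curryⁿ Solver.⟦ proj₂ (close n f) ⟧)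
  solve n f same = curryⁿ-cong _≈_ Solver.⟦ lhs ⟧ Solver.⟦ rhs ⟧
    (λ ρ → Solver.prove ρ lhs rhs (reflexive (≡.cong (λ e → Solver.⟦ e ⟧N ρ) same)))
    where
    lhs = proj₁ (close n f)
    rhs = proj₂ (close n f)

-- Localization of a commutative ring

module Fractions {c ℓ} (R : CommutativeRing c ℓ) where
  open CommutativeRing R

  module Localization {m} (M : Carrier → Set m) (M-1 : M 1#) (M-* : ∀ x y → M x → M y → M (x * y))
    (M-cancel : ∀ x → M x → ∀ y z → x * y ≈ x * z → y ≈ z) where

    open IntegerSolver R
    open import Relation.Binary.Reasoning.Setoid setoid

    infix 5 _/_[_]
    record Loc : Set (c ⊔ m) where
      constructor _/_[_]
      field
        top bot : Carrier
        bot∈M   : M bot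
    open Loc public

    infix 4 _≃_
    record _≃_ (x y : Loc) : Set ℓ where
      constructor cross
      field uncross : top x * bot y ≈ top y * bot x
    open _≃_ public

    infixl 6 _⊕_
    infixl 7 _⊗_
    infix 8 ⊖_

    -- opaque, so that unification treats them as constructors
    opaque
      _⊕_ _⊗_ : Loc → Loc → Loc
      x ⊕ y = (top x * bot y + top y * bot x) / (bot x * bot y) [ M-* (bot x) (bot y) (bot∈M x) (bot∈M y) ]
      x ⊗ y = (top x * top y) / (bot x * bot y) [ M-* (bot x) (bot y) (bot∈M x) (bot∈M y) ]

      ⊖_ : Loc → Loc
      ⊖ x = (- top x) / bot x [ bot∈M x ]

    ι : Carrier → Loc
    ι r = r / 1# [ M-1 ]

    private
      -- Transitivity of cross-multiplication rests on `M-cancel`: the middle denominator is a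
      -- common factor of both sides and is cancelled at the end.
      ≃-trans : ∀ {x y z} → x ≃ y → y ≃ z → x ≃ z
      ≃-trans {x} {y} {z} (cross h) (cross k) = cross (M-cancel (bot y) (bot∈M y) _ _ (begin
        bot y * (top x * bot z)   ≈⟨ solve 3 (λ b a c → b :* (a :* c) := (a :* b) :* c) ≡.refl (bot y) (top x) (bot z) ⟩
        (top x * bot y) * bot z   ≈⟨ *-congʳ h ⟩
        (top y * bot x) * bot z   ≈⟨ solve 3 (λ b a c → b :* a :* c := (b :* c) :* a) ≡.refl (top y) (bot x) (bot z) ⟩
        (top y * bot z) * bot x   ≈⟨ *-congʳ k ⟩
        (top z * bot y) * bot x   ≈⟨ solve 3 (λ b a c → b :* a :* c := a :* (b :* c)) ≡.refl (top z) (bot y) (bot x) ⟩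
        bot y * (top z * bot x)   ∎))

      opaque
        unfolding _⊕_ _⊗_ ⊖_

        ⊕-cong : ∀ {x x′ y y′} → x ≃ x′ → y ≃ y′ → x ⊕ y ≃ x′ ⊕ y′
        ⊕-cong {x} {x′} {y} {y′} (cross h) (cross k) = cross (begin
          (top x * bot y + top y * bot x) * (bot x′ * bot y′)
            ≈⟨ solve 6 (λ a b c d b′ d′ → (a :* d :+ c :* b) :* (b′ :* d′) := (a :* b′) :* (d :* d′) :+ (c :* d′) :* (b :* b′)) ≡.refl (top x) (bot x) (top y) (bot y) (bot x′) (bot y′) ⟩
          (top x * bot x′) * (bot y * bot y′) + (top y * bot y′) * (bot x * bot x′)
            ≈⟨ +-cong (*-congʳ h) (*-congʳ k) ⟩
          (top x′ * bot x) * (bot y * bot y′) + (top y′ * bot y) * (bot x * bot x′)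
            ≈⟨ solve 6 (λ a b c d b′ d′ → (a :* b) :* (d :* d′) :+ (c :* d) :* (b :* b′) := (a :* d′ :+ c :* b′) :* (b :* d)) ≡.refl (top x′) (bot x) (top y′) (bot y) (bot x′) (bot y′) ⟩
          (top x′ * bot y′ + top y′ * bot x′) * (bot x * bot y) ∎)

        ⊗-cong : ∀ {x x′ y y′} → x ≃ x′ → y ≃ y′ → x ⊗ y ≃ x′ ⊗ y′
        ⊗-cong {x} {x′} {y} {y′} (cross h) (cross k) = cross (begin
          (top x * top y) * (bot x′ * bot y′)   ≈⟨ shuffle (top x) (top y) (bot x′) (bot y′) ⟩
          (top x * bot x′) * (top y * bot y′)   ≈⟨ *-cong h k ⟩
          (top x′ * bot x) * (top y′ * bot y)   ≈⟨ shuffle (top x′) (bot x) (top y′) (bot y) ⟩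
          (top x′ * top y′) * (bot x * bot y)   ∎)
          where
          shuffle : ∀ a b c d → (a * b) * (c * d) ≈ (a * c) * (b * d)
          shuffle = solve 4 (λ a b c d → (a :* b) :* (c :* d) := (a :* c) :* (b :* d)) ≡.refl

        ⊖-cong : ∀ {x y} → x ≃ y → ⊖ x ≃ ⊖ y
        ⊖-cong {x} {y} (cross h) = cross (begin
          - top x * bot y     ≈⟨ solve 2 (λ a b → :- a :* b := :- (a :* b)) ≡.refl (top x) (bot y) ⟩
          - (top x * bot y)   ≈⟨ -‿cong h ⟩
          - (top y * bot x)   ≈⟨ solve 2 (λ a b → :- (a :* b) := :- a :* b) ≡.refl (top y) (bot x) ⟩
          - top y * bot x     ∎)

        ⊕-identityˡ : ∀ x → ι 0# ⊕ x ≃ x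
        ⊕-identityˡ (a / b [ _ ]) = cross (solve 2 (λ a b → (:0 :* b :+ a :* :1) :* b := a :* (:1 :* b)) ≡.refl a b)
        ⊕-comm : ∀ x y → x ⊕ y ≃ y ⊕ x
        ⊕-comm (a / b [ _ ]) (c / d [ _ ]) = cross (solve 4 (λ a b c d → (a :* d :+ c :* b) :* (d :* b) := (c :* b :+ a :* d) :* (b :* d)) ≡.refl a b c d)
        ⊕-inverseˡ : ∀ x → (⊖ x) ⊕ x ≃ ι 0#
        ⊕-inverseˡ (a / b [ _ ]) = cross (solve 2 (λ a b → (:- a :* b :+ a :* b) :* :1 := :0 :* (b :* b)) ≡.refl a b)
        ⊗-comm : ∀ x y → x ⊗ y ≃ y ⊗ x
        ⊗-comm (a / b [ _ ]) (c / d [ _ ]) = cross (solve 4 (λ a b c d → (a :* c) :* (d :* b) := (c :* a) :* (b :* d)) ≡.refl a b c d)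
        ⊗-identityˡ : ∀ x → ι 1# ⊗ x ≃ x
        ⊗-identityˡ (a / b [ _ ]) = cross (solve 2 (λ a b → (:1 :* a) :* b := a :* (:1 :* b)) ≡.refl a b)
        ⊗-distribˡ : ∀ x y z → x ⊗ (y ⊕ z) ≃ x ⊗ y ⊕ x ⊗ z
        ⊗-distribˡ (a / b [ _ ]) (c / d [ _ ]) (e / f [ _ ]) = cross (solve 6 (λ a b c d e f →
          (a :* (c :* f :+ e :* d)) :* ((b :* d) :* (b :* f)) := ((a :* c) :* (b :* f) :+ (a :* e) :* (b :* d)) :* (b :* (d :* f))) ≡.refl a b c d e f)

        ⊕-assoc : ∀ x y z → (x ⊕ y) ⊕ z ≃ x ⊕ (y ⊕ z)
        ⊕-assoc (a / b [ _ ]) (c / d [ _ ]) (e / f [ _ ]) = cross (solve 6 (λ a b c d e f →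
          ((a :* d :+ c :* b) :* f :+ e :* (b :* d)) :* (b :* (d :* f)) := (a :* (d :* f) :+ (c :* f :+ e :* d) :* b) :* ((b :* d) :* f)) ≡.refl a b c d e f)
        ⊗-assoc : ∀ x y z → (x ⊗ y) ⊗ z ≃ x ⊗ (y ⊗ z)
        ⊗-assoc (a / b [ _ ]) (c / d [ _ ]) (e / f [ _ ]) = cross (solve 6 (λ a b c d e f →
          ((a :* c) :* e) :* (b :* (d :* f)) := (a :* (c :* e)) :* ((b :* d) :* f)) ≡.refl a b c d e f)

    localRing : CommutativeRing (c ⊔ m) ℓ
    localRing = record
      { Carrier = Loc ; _≈_ = _≃_ ; _+_ = _⊕_ ; _*_ = _⊗_ ; -_ = ⊖_ ; 0# = ι 0# ; 1# = ι 1#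
      ; isCommutativeRing = record
        { isRing = record
          { +-isAbelianGroup = record
            { isGroup = record
              { isMonoid = record
                { isSemigroup = record
                  { isMagma = record
                    { isEquivalence = record { refl = cross refl ; sym = λ (cross h) → cross (sym h) ; trans = ≃-trans }
                    ; ∙-cong = ⊕-cong }
                  ; assoc = ⊕-assoc }
                ; identity = ⊕-identityˡ , λ x → ≃-trans (⊕-comm x (ι 0#)) (⊕-identityˡ x) }
              ; inverse = ⊕-inverseˡ , λ x → ≃-trans (⊕-comm x (⊖ x)) (⊕-inverseˡ x)
              ; ⁻¹-cong = ⊖-cong }
            ; comm = ⊕-comm }
          ; *-cong = ⊗-cong
          ; *-assoc = ⊗-assoc
          ; *-identity = ⊗-identityˡ , λ x → ≃-trans (⊗-comm x (ι 1#)) (⊗-identityˡ x)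
          ; distrib = ⊗-distribˡ , λ x y z → ≃-trans (⊗-comm (y ⊕ z) x)
              (≃-trans (⊗-distribˡ x y z) (⊕-cong (⊗-comm x y) (⊗-comm x z))) }
        ; *-comm = ⊗-comm } }

    ι-cong : ∀ {r s} → r ≈ s → ι r ≃ ι s
    ι-cong h = cross (*-congʳ h)

    inverse : ∀ r → M r → Loc
    inverse r r∈M = 1# / r [ r∈M ]

    opaque
      unfolding _⊕_ _⊗_ ⊖_

      ⊕-fraction : ∀ {a b c d b∈M d∈M bd∈M} → (a / b [ b∈M ]) ⊕ (c / d [ d∈M ]) ≃ (a * d + c * b) / (b * d) [ bd∈M ]
      ⊕-fraction = cross refl

      ⊗-fraction : ∀ {a b c d b∈M d∈M bd∈M} → (a / b [ b∈M ]) ⊗ (c / d [ d∈M ]) ≃ (a * c) / (b * d) [ bd∈M ]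
      ⊗-fraction = cross refl

      ⊖-fraction : ∀ {a b b∈M} → ⊖ (a / b [ b∈M ]) ≃ (- a) / b [ b∈M ]
      ⊖-fraction = cross refl

      ι-+ : ∀ r s → ι (r + s) ≃ ι r ⊕ ι s
      ι-+ r s = cross (solve 2 (λ r s → (r :+ s) :* (:1 :* :1) := (r :* :1 :+ s :* :1) :* :1) ≡.refl r s)

      ι-* : ∀ r s → ι (r * s) ≃ ι r ⊗ ι s
      ι-* r s = cross (solve 2 (λ r s → (r :* s) :* (:1 :* :1) := (r :* s) :* :1) ≡.refl r s)

      inverseˡ : ∀ r (r∈M : M r) → inverse r r∈M ⊗ ι r ≃ ι 1#
      inverseˡ r r∈M = cross (solve 1 (λ r → (:1 :* r) :* :1 := :1 :* (r :* :1)) ≡.refl r)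

-- Linear combinations of equations, powers and finite sums

module RingLemmas {c ℓ} (K : CommutativeRing c ℓ) where
  open CommutativeRing K
  open IntegerSolver K
  open import Algebra.Properties.Group +-group using (x∙y⁻¹≈ε⇒x≈y; x≈y⇒x∙y⁻¹≈ε)
  open import Relation.Binary.Reasoning.Setoid setoid

  -- An equation follows from others if the difference of its sides is a combination of
  -- the differences of theirs; linear, _·∅_ and _⊞_ build such combinations.
  linear : ∀ {x y d} → x - y ≈ d → d ≈ 0# → x ≈ y
  linear {x} {y} h z = x∙y⁻¹≈ε⇒x≈y x y (trans h z)

  infix 5 _·∅_
  infixl 4 _⊞_
  _·∅_ : ∀ c {x y} → x ≈ y → c * (x - y) ≈ 0#
  c ·∅ h = trans (*-congˡ (x≈y⇒x∙y⁻¹≈ε h)) (zeroʳ c)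

  _⊞_ : ∀ {x y} → x ≈ 0# → y ≈ 0# → x + y ≈ 0#
  h ⊞ k = trans (+-cong h k) (+-identityˡ 0#)

  Invertible : Carrier → Set _
  Invertible u = ∃[ v ] u * v ≈ 1#

  invertible-* : ∀ {u v} → Invertible u → Invertible v → Invertible (u * v)
  invertible-* {u} {v} (u′ , h) (v′ , k) = u′ * v′ ,
    linear (solve 4 (λ u v u′ v′ → u :* v :* (u′ :* v′) :- :1 := (v :* v′) :* (u :* u′ :- :1) :+ :1 :* (v :* v′ :- :1)) ≡.refl u v u′ v′)
           (v * v′ ·∅ h ⊞ 1# ·∅ k)

  invertible-≈ : ∀ {u v} → u ≈ v → Invertible u → Invertible v
  invertible-≈ h (w , k) = w , trans (*-congʳ (sym h)) k

  cancelˡ : ∀ {u x y} → Invertible u → u * x ≈ u * y → x ≈ y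
  cancelˡ {u} {x} {y} (v , h) k =
    linear (solve 4 (λ u v x y → x :- y := v :* (u :* x :- u :* y) :+ (y :- x) :* (u :* v :- :1)) ≡.refl u v x y)
           (v ·∅ k ⊞ (y - x) ·∅ h)

  pow : Carrier → ℕ → Carrier
  pow x zero    = 1#
  pow x (suc n) = x * pow x n

  pow-+ : ∀ x m n → pow x (m ℕ.+ n) ≈ pow x m * pow x n
  pow-+ x zero    n = sym (*-identityˡ _)
  pow-+ x (suc m) n = trans (*-congˡ (pow-+ x m n)) (sym (*-assoc x _ _))

  pow-* : ∀ x y n → pow (x * y) n ≈ pow x n * pow y n
  pow-* x y zero    = sym (*-identityˡ 1#)
  pow-* x y (suc n) = trans (*-congˡ (pow-* x y n))
    (solve 4 (λ x y a b → x :* y :* (a :* b) := x :* a :* (y :* b)) ≡.refl x y (pow x n) (pow y n))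

  pow-1 : ∀ {x y} → x * y ≈ 1# → ∀ n → pow x n * pow y n ≈ 1#
  pow-1 h zero            = *-identityˡ 1#
  pow-1 {x} {y} h (suc n) =
    linear (solve 4 (λ x y a b → x :* a :* (y :* b) :- :1 := (a :* b) :* (x :* y :- :1) :+ :1 :* (a :* b :- :1)) ≡.refl x y (pow x n) (pow y n))
           ((pow x n * pow y n) ·∅ h ⊞ 1# ·∅ pow-1 h n)

  -- The upper bound is excluded, so a sum over 0 ≤ k ≤ m is `sum (suc m)`.
  sum : ℕ → (ℕ → Carrier) → Carrier
  sum zero    f = 0#
  sum (suc n) f = sum n f + f n

  sum-cong : ∀ {f g : ℕ → Carrier} → (∀ j → f j ≈ g j) → ∀ n → sum n f ≈ sum n g
  sum-cong {f} {g} h zero    = refl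
  sum-cong {f} {g} h (suc n) = +-cong (sum-cong {f} {g} h n) (h n)

  sum-*ˡ : ∀ x (f : ℕ → Carrier) n → sum n (λ j → x * f j) ≈ x * sum n f
  sum-*ˡ x f zero    = sym (zeroʳ x)
  sum-*ˡ x f (suc n) = trans (+-congʳ (sum-*ˡ x f n)) (sym (distribˡ x _ _))

  sum-+ : ∀ (f g : ℕ → Carrier) n → sum n (λ j → f j + g j) ≈ sum n f + sum n g
  sum-+ f g zero    = sym (+-identityˡ 0#)
  sum-+ f g (suc n) = trans (+-congʳ (sum-+ f g n))
    (solve 4 (λ a b x y → a :+ b :+ (x :+ y) := a :+ x :+ (b :+ y)) ≡.refl (sum n f) (sum n g) (f n) (g n))

  sum-linear : ∀ u α β (f g : ℕ → Carrier) n →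
               sum n (λ j → u * (α * f j - β * g j)) ≈ u * (α * sum n f - β * sum n g)
  sum-linear u α β f g zero    = solve 3 (λ u α β → :0 := u :* (α :* :0 :- β :* :0)) ≡.refl u α β
  sum-linear u α β f g (suc n) = trans (+-congʳ (sum-linear u α β f g n))
    (solve 7 (λ u α β a b x y → u :* (α :* a :- β :* b) :+ u :* (α :* x :- β :* y) := u :* (α :* (a :+ x) :- β :* (b :+ y))) ≡.refl
      u α β (sum n f) (sum n g) (f n) (g n))

  telescope : ∀ (g : ℕ → Carrier) n → sum n (λ j → g (suc j) - g j) ≈ g n - g 0
  telescope g zero    = sym (-‿inverseʳ (g 0))
  telescope g (suc n) = trans (+-congʳ {g (suc n) - g n} (telescope g n))
    (solve 3 (λ a b c → b :- c :+ (a :- b) := a :- c) ≡.refl (g (suc n)) (g n) (g 0))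

  -- Shifted factorials in base q²

  module QSeries (q q⁻¹ : Carrier) (q⁻¹-inv : q * q⁻¹ ≈ 1#)
    (inv : ℕ → Carrier) (inv-spec : ∀ n → (1# - pow q (suc n)) * inv n ≈ 1#) where

    p p⁻¹ : Carrier
    p   = q * q
    p⁻¹ = q⁻¹ * q⁻¹

    p⁻¹-inv : p * p⁻¹ ≈ 1#
    p⁻¹-inv = linear (solve 2 (λ q r → q :* q :* (r :* r) :- :1 := (q :* r :+ :1) :* (q :* r :- :1)) ≡.refl q q⁻¹)
                     ((q * q⁻¹ + 1#) ·∅ q⁻¹-inv)

    pow-p : ∀ n → pow p n ≈ pow q n * pow q n
    pow-p n = pow-* q q n

    pow-double : ∀ n → pow p n ≈ pow q (n ℕ.+ n)
    pow-double n = trans (pow-p n) (sym (pow-+ q n n))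

    1-q^ : ∀ n → Invertible (1# - pow q (suc n))
    1-q^ n = inv n , inv-spec n

    1-qp^ : ∀ m → Invertible (1# - q * pow p m)
    1-qp^ m = invertible-≈ (+-congˡ (-‿cong (*-congˡ (sym (pow-double m))))) (1-q^ (m ℕ.+ m))

    1-p^ : ∀ m → Invertible (1# - pow p (suc m))
    1-p^ m = invertible-≈ (+-congˡ (-‿cong (sym (pow-double (suc m))))) (1-q^ (m ℕ.+ suc m))

    -- With W = q²ᵐ⁺² one has 1 - W⁻¹ = -W⁻¹(1 - W), a product of two invertible elements.
    1-p⁻^ : ∀ m → Invertible (1# - pow p⁻¹ (suc m))
    1-p⁻^ m = invertible-≈ (linear
        (solve 2 (λ W z → :- z :* (:1 :- W) :- (:1 :- z) := :1 :* (W :* z :- :1)) ≡.refl (pow p (suc m)) (pow p⁻¹ (suc m)))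
        (1# ·∅ pow-1 p⁻¹-inv (suc m)))
      (invertible-* (- pow p (suc m) , linear
          (solve 2 (λ W z → :- z :* :- W :- :1 := :1 :* (W :* z :- :1)) ≡.refl (pow p (suc m)) (pow p⁻¹ (suc m)))
          (1# ·∅ pow-1 p⁻¹-inv (suc m)))
        (1-p^ m))

    -- (x ; q²)ₖ
    poch : Carrier → ℕ → Carrier
    poch x zero    = 1#
    poch x (suc k) = poch x k * (1# - x * pow p k)

    poch-cong : ∀ {x y} → x ≈ y → ∀ k → poch x k ≈ poch y k
    poch-cong h zero    = refl
    poch-cong h (suc k) = *-cong (poch-cong h k) (+-congˡ (-‿cong (*-congʳ h)))

    -- Both sides are (x; q²)ₖ₊₁: the left one splits off the first factor, the right one the last.
    poch-shift : ∀ x k → (1# - x) * poch (x * p) k ≈ poch x k * (1# - x * pow p k)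
    poch-shift x zero    = solve 1 (λ x → (:1 :- x) :* :1 := :1 :* (:1 :- x :* :1)) ≡.refl x
    poch-shift x (suc k) =
      linear (solve 5 (λ x p J P P′ → (:1 :- x) :* (P′ :* (:1 :- x :* p :* J)) :- P :* (:1 :- x :* J) :* (:1 :- x :* (p :* J))
                                   := (:1 :- x :* p :* J) :* ((:1 :- x) :* P′ :- P :* (:1 :- x :* J))) ≡.refl
                      x p (pow p k) (poch x k) (poch (x * p) k))
             ((1# - x * p * pow p k) ·∅ poch-shift x k)

    poch-vanish : ∀ x k → x * pow p k ≈ 1# → poch x (suc k) ≈ 0#
    poch-vanish x k h = linear (solve 2 (λ P y → P :* (:1 :- y) :- :0 := :- P :* (y :- :1)) ≡.refl (poch x k) (x * pow p k))
                               ((- poch x k) ·∅ h)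

    p-inv : ℕ → Carrier
    p-inv k = proj₁ (1-p^ k)

    p-inv-spec : ∀ k → (1# - pow p (suc k)) * p-inv k ≈ 1#
    p-inv-spec k = proj₂ (1-p^ k)

    p-inv-half : ∀ k → (1# - pow q (suc k)) * p-inv k * (1# + pow q (suc k)) ≈ 1#
    p-inv-half k = linear (solve 3 (λ Q W v → (:1 :- Q) :* v :* (:1 :+ Q) :- :1 := :1 :* ((:1 :- W) :* v :- :1) :+ v :* (W :- Q :* Q)) ≡.refl
                             (pow q (suc k)) (pow p (suc k)) (p-inv k))
                          (1# ·∅ p-inv-spec k ⊞ p-inv k ·∅ pow-p (suc k))

    -- 1 / (q² ; q²)ₖ
    ib : ℕ → Carrier
    ib zero    = 1#
    ib (suc k) = ib k * p-inv k

    ib-suc : ∀ k → ib (suc k) * (1# - pow p (suc k)) ≈ ib k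
    ib-suc k = linear (solve 3 (λ i v w → i :* v :* w :- i := i :* (w :* v :- :1)) ≡.refl (ib k) (p-inv k) (1# - pow p (suc k)))
                      (ib k ·∅ p-inv-spec k)

    ib-inv : ∀ k → poch p k * ib k ≈ 1#
    ib-inv zero    = *-identityˡ 1#
    ib-inv (suc k) = linear (solve 4 (λ P w i v → P :* w :* (i :* v) :- :1 := (P :* i) :* (w :* v :- :1) :+ :1 :* (P :* i :- :1)) ≡.refl
                                     (poch p k) (1# - pow p (suc k)) (ib k) (p-inv k))
                            ((poch p k * ib k) ·∅ p-inv-spec k ⊞ 1# ·∅ ib-inv k)

    -- A q-Saalschütz sum by the WZ method

    module Saalschütz where

      -- The terms of the 3φ2 in base q² with upper parameters q³, q²ᵐ⁺¹, q⁻²ᵐ⁻² and lower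
      -- parameters q² (the other `ib j` being the usual one), at argument q². It is balanced, since
      -- q³ · q²ᵐ⁺¹ · q⁻²ᵐ⁻² · q² = q² · q², and it ends at j = m + 1.
      h : ℕ → ℕ → Carrier
      h m j = poch (q * p) j * poch (q * pow p m) j * poch (pow p⁻¹ (suc m)) j * (ib j * ib j * ib j) * pow p j

      private
        -- the WZ certificate for the recurrence in m of Σ h m
        cert : ℕ → ℕ → Carrier
        cert m j = poch (q * p) j * poch (q * pow p m) j * poch (pow p⁻¹ (suc (suc m))) j
                   * (ib j * ib j * ib j) * ((1# - pow p j) * (1# - pow p j) * (1# - pow p j))

        p-shift : ∀ m → q * pow p (suc m) ≈ q * pow p m * p
        p-shift m = solve 3 (λ q p M → q :* (p :* M) := q :* M :* p) ≡.refl q p (pow p m)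

        p⁻¹-shift : ∀ m → pow p⁻¹ (suc m) * p ≈ pow p⁻¹ m
        p⁻¹-shift m = linear (solve 3 (λ r p M → r :* M :* p :- M := M :* (p :* r :- :1)) ≡.refl p⁻¹ p (pow p⁻¹ m))
                             (pow p⁻¹ m ·∅ p⁻¹-inv)

      module _ (m : ℕ) where
        x z : Carrier
        x = q * pow p m
        z = pow p⁻¹ (suc (suc m))

        core : ℕ → Carrier
        core j = poch (q * p) j * poch x j * poch z j * (ib j * ib j * ib j)

        h′-core : ∀ j → (1# - x) * h (suc m) j ≈ core j * pow p j * (1# - x * pow p j)
        h′-core j = trans (*-congˡ (*-congʳ (*-congʳ (*-congʳ (*-congˡ (poch-cong (p-shift m) j))))))
          (linear (solve 7 (λ A X′ X Z i J x → (:1 :- x) :* (A :* X′ :* Z :* i :* J) :- A :* X :* Z :* i :* J :* (:1 :- x :* J)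
                                 := (A :* Z :* i :* J) :* ((:1 :- x) :* X′ :- X :* (:1 :- x :* J))) ≡.refl
                     (poch (q * p) j) (poch (x * p) j) (poch x j) (poch z j) (ib j * ib j * ib j) (pow p j) x)
                  ((poch (q * p) j * poch z j * (ib j * ib j * ib j) * pow p j) ·∅ poch-shift x j))

        h-core : ∀ j → (1# - z) * h m j ≈ core j * pow p j * (1# - z * pow p j)
        h-core j = trans (*-congˡ (*-congʳ (*-congʳ (*-congˡ (poch-cong (sym (p⁻¹-shift (suc m))) j)))))
          (linear (solve 7 (λ A X Z′ Z i J z → (:1 :- z) :* (A :* X :* Z′ :* i :* J) :- A :* X :* Z :* i :* J :* (:1 :- z :* J)
                                 := (A :* X :* i :* J) :* ((:1 :- z) :* Z′ :- Z :* (:1 :- z :* J))) ≡.refl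
                     (poch (q * p) j) (poch x j) (poch (z * p) j) (poch z j) (ib j * ib j * ib j) (pow p j) z)
                  ((poch (q * p) j * poch x j * (ib j * ib j * ib j) * pow p j) ·∅ poch-shift z j))

        cert-suc : ∀ j → cert m (suc j) ≈ core j * ((1# - q * p * pow p j) * (1# - x * pow p j) * (1# - z * pow p j))
        cert-suc j = begin
          cert m (suc j)
            ≈⟨ solve 8 (λ A X Z a x z i w → A :* a :* (X :* x) :* (Z :* z) :* (i :* i :* i) :* (w :* w :* w)
                        := A :* X :* Z :* (a :* x :* z) :* ((i :* w) :* (i :* w) :* (i :* w))) ≡.refl
                 (poch (q * p) j) (poch x j) (poch z j) (1# - q * p * pow p j) (1# - x * pow p j) (1# - z * pow p j)
                 (ib (suc j)) (1# - pow p (suc j)) ⟩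
          poch (q * p) j * poch x j * poch z j * ((1# - q * p * pow p j) * (1# - x * pow p j) * (1# - z * pow p j))
            * ((ib (suc j) * (1# - pow p (suc j))) * (ib (suc j) * (1# - pow p (suc j))) * (ib (suc j) * (1# - pow p (suc j))))
            ≈⟨ *-congˡ (*-cong (*-cong (ib-suc j) (ib-suc j)) (ib-suc j)) ⟩
          poch (q * p) j * poch x j * poch z j * ((1# - q * p * pow p j) * (1# - x * pow p j) * (1# - z * pow p j))
            * (ib j * ib j * ib j)
            ≈⟨ solve 3 (λ a b c → a :* b :* c := a :* c :* b) ≡.refl
                 (poch (q * p) j * poch x j * poch z j) ((1# - q * p * pow p j) * (1# - x * pow p j) * (1# - z * pow p j)) (ib j * ib j * ib j) ⟩
          core j * ((1# - q * p * pow p j) * (1# - x * pow p j) * (1# - z * pow p j)) ∎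

        -- The balancing condition in the parameters of the certificate; it is the only relation
        -- between x, z and q³ that the certificate identity uses.
        xz : x * z * (q * p) ≈ 1#
        xz = linear (solve 4 (λ q M r W → q :* M :* (r :* (r :* W)) :* (q :* (q :* q)) :- :1
                                := (M :* W :* (q :* q :* r :+ :1)) :* (q :* q :* r :- :1) :+ :1 :* (M :* W :- :1)) ≡.refl
                       q (pow p m) p⁻¹ (pow p⁻¹ m))
                    ((pow p m * pow p⁻¹ m * (p * p⁻¹ + 1#)) ·∅ p⁻¹-inv ⊞ 1# ·∅ pow-1 p⁻¹-inv m)

        -- After multiplication by 1 - x or 1 - z both summands become multiples of `core j`, and so
        -- do both values of the certificate. What remains is a polynomial identity in J = q²ʲ,
        -- valid modulo x z q³ = 1.
        wz : ∀ j → (1# - x) * (1# - z) * (x * ((1# - z) * (1# - z)) * h (suc m) j - z * ((1# - x) * (1# - x)) * h m j)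
                 ≈ - (x * z * (x - z)) * (cert m (suc j) - cert m j)
        wz j = linear (solve 8 (λ C J x z t H′ H D′ →
              (:1 :- x) :* (:1 :- z) :* (x :* ((:1 :- z) :* (:1 :- z)) :* H′ :- z :* ((:1 :- x) :* (:1 :- x)) :* H)
                :- (:- (x :* z :* (x :- z)) :* (D′ :- C :* ((:1 :- J) :* (:1 :- J) :* (:1 :- J))))
              := (x :* (:1 :- z) :* (:1 :- z) :* (:1 :- z)) :* ((:1 :- x) :* H′ :- C :* J :* (:1 :- x :* J))
              :+ (:- (z :* (:1 :- x) :* (:1 :- x) :* (:1 :- x))) :* ((:1 :- z) :* H :- C :* J :* (:1 :- z :* J))
              :+ (x :* z :* (x :- z)) :* (D′ :- C :* ((:1 :- t :* J) :* (:1 :- x :* J) :* (:1 :- z :* J)))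
              :+ (C :* J :* (z :- x) :* (:1 :- (x :+ z) :* J :+ x :* z :* (J :* J))) :* (x :* z :* t :- :1)) ≡.refl
            (core j) (pow p j) x z (q * p) (h (suc m) j) (h m j) (cert m (suc j)))
          ((x * (1# - z) * (1# - z) * (1# - z)) ·∅ h′-core j
            ⊞ (- (z * (1# - x) * (1# - x) * (1# - x))) ·∅ h-core j
            ⊞ (x * z * (x - z)) ·∅ cert-suc j
            ⊞ (core j * pow p j * (z - x) * (1# - (x + z) * pow p j + x * z * (pow p j * pow p j))) ·∅ xz)

        cert-0 : cert m 0 ≈ 0#
        cert-0 = solve 1 (λ i → :1 :* :1 :* :1 :* i :* ((:1 :- :1) :* (:1 :- :1) :* (:1 :- :1)) := :0) ≡.refl (ib 0 * ib 0 * ib 0)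

        cert-end : cert m (3 ℕ.+ m) ≈ 0#
        cert-end = linear (solve 5 (λ A X Z i w → A :* X :* Z :* i :* w :- :0 := (A :* X :* i :* w) :* (Z :- :0)) ≡.refl
                     (poch (q * p) (3 ℕ.+ m)) (poch x (3 ℕ.+ m)) (poch z (3 ℕ.+ m)) (ib (3 ℕ.+ m) * ib (3 ℕ.+ m) * ib (3 ℕ.+ m))
                     ((1# - pow p (3 ℕ.+ m)) * (1# - pow p (3 ℕ.+ m)) * (1# - pow p (3 ℕ.+ m))))
          (_ ·∅ poch-vanish z (2 ℕ.+ m) (trans (*-comm z _) (pow-1 p⁻¹-inv (2 ℕ.+ m))))

        h-end : h m (2 ℕ.+ m) ≈ 0#
        h-end = linear (solve 5 (λ A X Z i w → A :* X :* Z :* i :* w :- :0 := (A :* X :* i :* w) :* (Z :- :0)) ≡.refl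
                     (poch (q * p) (2 ℕ.+ m)) (poch x (2 ℕ.+ m)) (poch (pow p⁻¹ (suc m)) (2 ℕ.+ m)) (ib (2 ℕ.+ m) * ib (2 ℕ.+ m) * ib (2 ℕ.+ m))
                     (pow p (2 ℕ.+ m)))
          (_ ·∅ poch-vanish (pow p⁻¹ (suc m)) (suc m) (trans (*-comm (pow p⁻¹ (suc m)) _) (pow-1 p⁻¹-inv (suc m))))

        -- The certificate telescopes to zero, as it vanishes at j = 0 and at j = m + 3. The series
        -- for m is summed one term too far to match the one for m + 1; that extra term is zero by
        -- `h-end`.
        total-step : x * ((1# - z) * (1# - z)) * sum (3 ℕ.+ m) (h (suc m)) ≈ z * ((1# - x) * (1# - x)) * sum (2 ℕ.+ m) (h m)
        total-step = cancelˡ (invertible-* (1-qp^ m) (1-p⁻^ (suc m))) (linear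
            (solve 6 (λ u α s β t t₀ → u :* (α :* s) :- u :* (β :* t) := :1 :* (u :* (α :* s :- β :* (t :+ t₀)) :- :0) :+ (u :* β) :* (t₀ :- :0)) ≡.refl
               ((1# - x) * (1# - z)) (x * ((1# - z) * (1# - z))) (sum (3 ℕ.+ m) (h (suc m))) (z * ((1# - x) * (1# - x))) (sum (2 ℕ.+ m) (h m)) (h m (2 ℕ.+ m)))
            (1# ·∅ total ⊞ _ ·∅ h-end))
          where
          γ : Carrier
          γ = - (x * z * (x - z))
          total : (1# - x) * (1# - z) * (x * ((1# - z) * (1# - z)) * sum (3 ℕ.+ m) (h (suc m)) - z * ((1# - x) * (1# - x)) * sum (3 ℕ.+ m) (h m)) ≈ 0#
          total = begin
            (1# - x) * (1# - z) * (x * ((1# - z) * (1# - z)) * sum (3 ℕ.+ m) (h (suc m)) - z * ((1# - x) * (1# - x)) * sum (3 ℕ.+ m) (h m))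
              ≈⟨ sum-linear ((1# - x) * (1# - z)) (x * ((1# - z) * (1# - z))) (z * ((1# - x) * (1# - x))) (h (suc m)) (h m) (3 ℕ.+ m) ⟨
            sum (3 ℕ.+ m) (λ j → (1# - x) * (1# - z) * (x * ((1# - z) * (1# - z)) * h (suc m) j - z * ((1# - x) * (1# - x)) * h m j))
              ≈⟨ sum-cong wz (3 ℕ.+ m) ⟩
            sum (3 ℕ.+ m) (λ j → γ * (cert m (suc j) - cert m j))    ≈⟨ sum-*ˡ γ (λ j → cert m (suc j) - cert m j) (3 ℕ.+ m) ⟩
            γ * sum (3 ℕ.+ m) (λ j → cert m (suc j) - cert m j)      ≈⟨ *-congˡ (telescope (cert m) (3 ℕ.+ m)) ⟩
            γ * (cert m (3 ℕ.+ m) - cert m 0)                        ≈⟨ *-congˡ (+-cong cert-end (-‿cong cert-0)) ⟩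
            γ * (0# - 0#)                                            ≈⟨ solve 1 (λ g → g :* (:0 :- :0) := :0) ≡.refl γ ⟩
            0# ∎

        -- The Saalschütz product (q⁻¹, q¹⁻²ᵐ; q²)ₘ₊₁ / (q², q⁻²ᵐ⁻²; q²)ₘ₊₁, with the products of
        -- negative powers reversed.
        value : Carrier
        value = (1# - q) * (1# - q) * q * (pow q m * pow q m * pow q m) * ((poch q m * ib (suc m)) * (poch q m * ib (suc m)))

      value-step : ∀ m → x m * ((1# - z m) * (1# - z m)) * value (suc m) ≈ z m * ((1# - x m) * (1# - x m)) * value m
      value-step m = linear (solve 7 (λ q T a i x z w →
            x :* ((:1 :- z) :* (:1 :- z)) :* ((:1 :- q) :* (:1 :- q) :* q :* (q :* T :* (q :* T) :* (q :* T)) :* (a :* (:1 :- x) :* (i :* w) :* (a :* (:1 :- x) :* (i :* w))))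
              :- z :* ((:1 :- x) :* (:1 :- x)) :* ((:1 :- q) :* (:1 :- q) :* q :* (T :* T :* T) :* (a :* i :* (a :* i)))
            := ((:1 :- x) :* (:1 :- x) :* ((:1 :- q) :* (:1 :- q) :* q :* (T :* T :* T) :* (a :* i :* (a :* i))) :* x :* (q :* (q :* q)) :* ((:1 :- z) :* w :- z))
                 :* ((:1 :- z) :* w :- :- z)
            :+ ((:1 :- x) :* (:1 :- x) :* ((:1 :- q) :* (:1 :- q) :* q :* (T :* T :* T) :* (a :* i :* (a :* i))) :* z) :* (x :* z :* (q :* (q :* q)) :- :1)) ≡.refl
          q (pow q m) (poch q m) (ib (suc m)) (x m) (z m) (p-inv (suc m)))
        (_ ·∅ zw ⊞ _ ·∅ xz m)
        where
        W w : Carrier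
        W = pow p (suc (suc m))
        w = p-inv (suc m)
        zw : (1# - z m) * w ≈ - z m
        zw = linear (solve 3 (λ z W w → (:1 :- z) :* w :- :- z := (:- w) :* (W :* z :- :1) :+ (:- z) :* ((:1 :- W) :* w :- :1)) ≡.refl (z m) W w)
                    (_ ·∅ pow-1 p⁻¹-inv (suc (suc m)) ⊞ _ ·∅ p-inv-spec (suc m))

      saalschütz : ∀ m → sum (2 ℕ.+ m) (h m) ≈ value m
      saalschütz zero = linear (solve 3 (λ q r β →
            :0 :+ :1 :* :1 :* :1 :* (:1 :* :1 :* :1) :* :1
               :+ (:1 :* (:1 :- q :* (q :* q) :* :1)) :* (:1 :* (:1 :- q :* :1 :* :1)) :* (:1 :* (:1 :- r :* :1 :* :1)) :* (:1 :* β :* (:1 :* β) :* (:1 :* β)) :* (q :* q :* :1)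
               :- (:1 :- q) :* (:1 :- q) :* q :* (:1 :* :1 :* :1) :* (:1 :* (:1 :* β) :* (:1 :* (:1 :* β)))
            := ((:- (:1 :- q :* (q :* q)) :* (:1 :- q) :* (β :* β :* β))) :* (q :* q :* r :- :1)
               :+ (:- (:1 :- q :* (q :* q)) :* (:1 :- q) :* (β :* β) :+ (:- :1) :* ((:1 :- q :* q :* :1) :* β :+ :1)) :* ((:1 :- q :* q :* :1) :* β :- :1)) ≡.refl
          q p⁻¹ (p-inv 0))
        (_ ·∅ p⁻¹-inv ⊞ _ ·∅ p-inv-spec 0)
      saalschütz (suc m) = cancelˡ (invertible-* (invertible-* (q⁻¹ , q⁻¹-inv) (pow p⁻¹ m , pow-1 p⁻¹-inv m))
                                                 (invertible-* (1-p⁻^ (suc m)) (1-p⁻^ (suc m)))) (begin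
        _ ≈⟨ total-step m ⟩
        _ ≈⟨ *-congˡ (saalschütz m) ⟩
        _ ≈⟨ value-step m ⟨
        _ ∎)

    -- Watson's transformation for the truncated sum

    module Transformation where
      open Saalschütz using (h; value; saalschütz)

      I₀ : Carrier
      I₀ = inv 0

      a/b : ℕ → Carrier
      a/b m = poch q m * ib m

      -- The terms of the balanced 4φ3 on the other side of Watson's transformation: upper
      -- parameters q³, q⁻¹, q²ᵐ⁺¹, q⁻²ᵐ, lower parameters q, q², q². The quotient (q³; q²)ⱼ / (q;
      -- q²)ⱼ has collapsed to (1 - q²ʲ⁺¹) / (1 - q).
      t : ℕ → ℕ → Carrier
      t m j = (1# - q * pow p j) * I₀ * poch q⁻¹ j * poch (q * pow p m) j * poch (pow p⁻¹ m) j * (ib j * ib j * ib j) * pow p j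

      -- Watson's transformation turns the truncated very-well-poised series Σ term into Σ F m.
      F : ℕ → ℕ → Carrier
      F m j = - (q⁻¹ * pow q m * (a/b m * a/b m)) * t m j

      term : ℕ → Carrier
      term k = (1# - pow p k * pow p k * q⁻¹) * I₀ * (poch q⁻¹ k * poch q⁻¹ k * poch q⁻¹ k * poch q⁻¹ k)
              * (ib k * ib k * ib k * ib k) * (pow p k * pow p k)

      q⁻¹-shift : q⁻¹ * p ≈ q
      q⁻¹-shift = linear (solve 2 (λ q r → r :* (q :* q) :- q := q :* (q :* r :- :1)) ≡.refl q q⁻¹) (q ·∅ q⁻¹-inv)

      poch-q⁻¹ : ∀ k → (1# - q⁻¹) * poch q k ≈ poch q⁻¹ (suc k)
      poch-q⁻¹ k = trans (*-congˡ (poch-cong (sym q⁻¹-shift) k)) (poch-shift q⁻¹ k)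

      private
        -- Both (q - q²ʲ)(q⁻¹; q²)ⱼ = (q - 1)(q; q²)ⱼ and (1 - q²ʲ⁺¹)(q; q²)ⱼ = (1 - q)(q³; q²)ⱼ
        -- only move factors at the ends of products.
        qp-part : ∀ j → (q - pow p j) * (1# - q * pow p j) * I₀ * poch q⁻¹ j ≈ (q - 1#) * poch (q * p) j
        qp-part j = linear (solve 7 (λ q r J I Pm P₀ P₁ →
              (q :- J) :* (:1 :- q :* J) :* I :* Pm :- (q :- :1) :* P₁
            := (:- (:1 :- q :* J) :* I :* q) :* ((:1 :- r) :* P₀ :- Pm :* (:1 :- r :* J))
            :+ ((:1 :- q :* J) :* I :* (J :* Pm :- P₀)) :* (q :* r :- :1)
            :+ (:- I :* (q :- :1)) :* ((:1 :- q) :* P₁ :- P₀ :* (:1 :- q :* J))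
            :+ ((q :- :1) :* P₁) :* ((:1 :- q :* :1) :* I :- :1)) ≡.refl
            q q⁻¹ (pow p j) I₀ (poch q⁻¹ j) (poch q j) (poch (q * p) j))
          (_ ·∅ poch-q⁻¹ j ⊞ _ ·∅ q⁻¹-inv ⊞ _ ·∅ poch-shift q j ⊞ _ ·∅ inv-spec 0)

      module _ (m : ℕ) where
        private
          w W : Carrier
          w = p-inv m
          W = pow p (suc m)

          X-step : ∀ j → (1# - q * pow p m) * poch (q * pow p (suc m)) j ≈ poch (q * pow p m) j * (1# - q * pow p m * pow p j)
          X-step j = trans (*-congˡ (poch-cong (solve 2 (λ q M → q :* (q :* q :* M) := q :* M :* (q :* q)) ≡.refl q (pow p m)) j))
                           (poch-shift (q * pow p m) j)

          Y-step : ∀ j → poch (pow p⁻¹ m) j ≈ - w * (W - pow p j) * poch (pow p⁻¹ (suc m)) j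
          Y-step j = linear (solve 6 (λ w W y J Yo Yn → Yo :- :- w :* (W :- J) :* Yn
              := (:- w :* W) :* ((:1 :- y) :* Yo :- Yn :* (:1 :- y :* J))
              :+ (:- w :* (Yo :- J :* Yn)) :* (W :* y :- :1)
              :+ (:- Yo) :* ((:1 :- W) :* w :- :1)) ≡.refl
              w W (pow p⁻¹ (suc m)) (pow p j) (poch (pow p⁻¹ m) j) (poch (pow p⁻¹ (suc m)) j))
            (_ ·∅ trans (*-congˡ (poch-cong (linear (solve 3 (λ r P M → M :- r :* M :* P := (:- M) :* (P :* r :- :1)) ≡.refl p⁻¹ p (pow p⁻¹ m)) (_ ·∅ p⁻¹-inv)) j))
                        (poch-shift (pow p⁻¹ (suc m)) j)
              ⊞ _ ·∅ pow-1 p⁻¹-inv (suc m) ⊞ _ ·∅ p-inv-spec m)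

        κ : Carrier
        κ = q⁻¹ * pow q m * (1# - q) * (1# - q * q * q * pow p m * pow p m) * (poch q m * ib (suc m) * (poch q m * ib (suc m)))

        -- With x = q²ᵐ⁺¹, W = q²ᵐ⁺², J = q²ʲ, the difference of the two terms contains q(1 - x)(1 -
        -- xJ) + (1 - W)(W - J). This factors as (q - J)(1 - q⁴ᵐ⁺³): the second factor does not
        -- depend on j, and the first is absorbed by `qp-part`. So the increment is again a
        -- hypergeometric term, and a Saalschützian one.
        F-step : ∀ j → F (suc m) j ≈ F m j + κ * h m j
        F-step j = linear (solve 16 (λ r q T M a b w J I Pm X′ X Yo Yn P₁ i →
            let x = q :* M ; W = q :* q :* M ; E = r :* T :* (a :* b :* (a :* b)) :* X :* Yn :* i :* J in
              :- (r :* (q :* T) :* (a :* (:1 :- x) :* (b :* w) :* (a :* (:1 :- x) :* (b :* w)))) :* ((:1 :- q :* J) :* I :* Pm :* X′ :* Yn :* i :* J)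
                :- (:- (r :* T :* (a :* b :* (a :* b))) :* ((:1 :- q :* J) :* I :* Pm :* X :* Yo :* i :* J)
                    :+ r :* T :* (:1 :- q) :* (:1 :- q :* q :* q :* M :* M) :* (a :* (b :* w) :* (a :* (b :* w))) :* (P₁ :* X :* Yn :* i :* J))
            := (:- (r :* q :* T :* (a :* b :* w) :* (a :* b :* w) :* (:1 :- x)) :* ((:1 :- q :* J) :* I :* Pm :* Yn :* i :* J))
                 :* ((:1 :- x) :* X′ :- X :* (:1 :- x :* J))
            :+ (r :* T :* (a :* b :* (a :* b)) :* (:1 :- q :* J) :* I :* Pm :* X :* i :* J) :* (Yo :- :- w :* (W :- J) :* Yn)
            :+ (w :* (W :- J) :* E :* Pm :* (:1 :- q :* J) :* I) :* ((:1 :- W) :* w :- :1)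
            :+ (:- (w :* w :* E :* (:1 :- q :* q :* q :* M :* M))) :* ((q :- J) :* (:1 :- q :* J) :* I :* Pm :- (q :- :1) :* P₁)) ≡.refl
            q⁻¹ q (pow q m) (pow p m) (poch q m) (ib m) w (pow p j) I₀ (poch q⁻¹ j) (poch (q * pow p (suc m)) j) (poch (q * pow p m) j)
            (poch (pow p⁻¹ m) j) (poch (pow p⁻¹ (suc m)) j) (poch (q * p) j) (ib j * ib j * ib j))
          (_ ·∅ X-step j ⊞ _ ·∅ Y-step j ⊞ _ ·∅ p-inv-spec m ⊞ _ ·∅ qp-part j)

        c-suc : κ * value m ≈ term (suc m)
        c-suc = sym (begin
          term (suc m)
            ≈⟨ *-congʳ (*-congʳ (*-cong (*-congʳ (+-congˡ (-‿cong WWr))) (*-cong (*-cong (*-cong Pm Pm) Pm) Pm))) ⟩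
          (1# - q * q * q * pow p m * pow p m) * I₀ * (A * A * A * A) * (ib (suc m) * ib (suc m) * ib (suc m) * ib (suc m)) * (W * W)
            ≈⟨ solve 7 (λ r q M a i I D → D :* I :* ((:1 :- r) :* a :* ((:1 :- r) :* a) :* ((:1 :- r) :* a) :* ((:1 :- r) :* a)) :* (i :* i :* i :* i) :* (q :* q :* M :* (q :* q :* M))
                  := D :* I :* (((:1 :- r) :* q) :* ((:1 :- r) :* q) :* ((:1 :- r) :* q) :* ((:1 :- r) :* q)) :* (a :* i :* (a :* i) :* (a :* i :* (a :* i))) :* (M :* M)) ≡.refl
                  q⁻¹ q (pow p m) (poch q m) (ib (suc m)) I₀ (1# - q * q * q * pow p m * pow p m) ⟩
          (1# - q * q * q * pow p m * pow p m) * I₀ * (B * B * B * B) * (C * C * (C * C)) * (pow p m * pow p m)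
            ≈⟨ *-congʳ (*-congʳ (*-congˡ (*-cong (*-cong (*-cong B≈ B≈) B≈) B≈))) ⟩
          (1# - q * q * q * pow p m * pow p m) * I₀ * ((q - 1#) * (q - 1#) * (q - 1#) * (q - 1#)) * (C * C * (C * C)) * (pow p m * pow p m)
            ≈⟨ linear (solve 7 (λ r q T M I C D →
                 D :* I :* ((q :- :1) :* (q :- :1) :* (q :- :1) :* (q :- :1)) :* (C :* C :* (C :* C)) :* (M :* M)
                   :- r :* T :* (:1 :- q) :* D :* (C :* C) :* ((:1 :- q) :* (:1 :- q) :* q :* (T :* T :* T) :* (C :* C))
                 := (:- D :* (C :* C :* (C :* C)) :* ((:1 :- q) :* (:1 :- q) :* (:1 :- q)) :* (T :* T :* (T :* T))) :* (q :* r :- :1)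
                 :+ (D :* (C :* C :* (C :* C)) :* ((:1 :- q) :* (:1 :- q) :* (:1 :- q)) :* (M :* M)) :* ((:1 :- q :* :1) :* I :- :1)
                 :+ (D :* (C :* C :* (C :* C)) :* ((:1 :- q) :* (:1 :- q) :* (:1 :- q)) :* (M :+ T :* T)) :* (M :- T :* T)) ≡.refl
                 q⁻¹ q (pow q m) (pow p m) I₀ C (1# - q * q * q * pow p m * pow p m))
               (_ ·∅ q⁻¹-inv ⊞ _ ·∅ inv-spec 0 ⊞ _ ·∅ pow-p m) ⟩
          κ * value m ∎)
          where
          A B C : Carrier
          A = (1# - q⁻¹) * poch q m
          B = (1# - q⁻¹) * q
          C = poch q m * ib (suc m)
          Pm : poch q⁻¹ (suc m) ≈ A
          Pm = sym (poch-q⁻¹ m)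
          WWr : W * W * q⁻¹ ≈ q * q * q * pow p m * pow p m
          WWr = linear (solve 3 (λ q r M → q :* q :* M :* (q :* q :* M) :* r :- q :* q :* q :* M :* M := (q :* q :* q :* M :* M) :* (q :* r :- :1)) ≡.refl q q⁻¹ (pow p m))
                       (_ ·∅ q⁻¹-inv)
          B≈ : B ≈ q - 1#
          B≈ = linear (solve 2 (λ q r → (:1 :- r) :* q :- (q :- :1) := (:- :1) :* (q :* r :- :1)) ≡.refl q q⁻¹) (_ ·∅ q⁻¹-inv)

        F-end : F m (suc m) ≈ 0#
        F-end = linear (solve 6 (λ f A X Y i J → f :* (A :* X :* Y :* i :* J) :- :0 := (f :* A :* X :* i :* J) :* (Y :- :0)) ≡.refl
                  (- (q⁻¹ * pow q m * (a/b m * a/b m))) ((1# - q * pow p (suc m)) * I₀ * poch q⁻¹ (suc m))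
                  (poch (q * pow p m) (suc m)) (poch (pow p⁻¹ m) (suc m)) (ib (suc m) * ib (suc m) * ib (suc m)) (pow p (suc m)))
                (_ ·∅ poch-vanish (pow p⁻¹ m) m (trans (*-comm (pow p⁻¹ m) _) (pow-1 p⁻¹-inv m)))

      transformation : ∀ m → sum (suc m) term ≈ sum (suc m) (F m)
      transformation zero = linear (solve 3 (λ q r I →
            :0 :+ (:1 :- :1 :* :1 :* r) :* I :* (:1 :* :1 :* :1 :* :1) :* (:1 :* :1 :* :1 :* :1) :* (:1 :* :1)
              :- (:0 :+ :- (r :* :1 :* (:1 :* :1 :* (:1 :* :1))) :* ((:1 :- q :* :1) :* I :* :1 :* :1 :* :1 :* (:1 :* :1 :* :1) :* :1))
            := (:- I) :* (q :* r :- :1)) ≡.refl q q⁻¹ I₀)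
          (_ ·∅ q⁻¹-inv)
      transformation (suc m) = begin
        sum (suc m) term + term (suc m)                            ≈⟨ +-cong (transformation m) (sym (c-suc m)) ⟩
        -- The added `0#` is the term j = m + 1 of the series for m, which has to be present before
        -- the two series are added termwise.
        sum (suc m) (F m) + κ m * value m                          ≈⟨ +-cong (sym (+-identityʳ _)) (*-congˡ (sym (saalschütz m))) ⟩
        sum (suc m) (F m) + 0# + κ m * sum (2 ℕ.+ m) (h m)         ≈⟨ +-cong (+-congˡ (sym (F-end m))) (sym (sum-*ˡ (κ m) (h m) (2 ℕ.+ m))) ⟩
        sum (2 ℕ.+ m) (F m) + sum (2 ℕ.+ m) (λ j → κ m * h m j)    ≈⟨ sum-+ (F m) (λ j → κ m * h m j) (2 ℕ.+ m) ⟨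
        sum (2 ℕ.+ m) (λ j → F m j + κ m * h m j)                  ≈⟨ sum-cong (F-step m) (2 ℕ.+ m) ⟨
        sum (2 ℕ.+ m) (F (suc m))                                  ∎

    -- Divisibility with quotient in a subring

    record IsSubring {ℓ′} (L : Carrier → Set ℓ′) : Set (c ⊔ ℓ ⊔ ℓ′) where
      field
        L-≈ : ∀ {x y} → x ≈ y → L x → L y
        L-1 : L 1#
        L-+ : ∀ {x y} → L x → L y → L (x + y)
        L-* : ∀ {x y} → L x → L y → L (x * y)
        L-neg : ∀ {x} → L x → L (- x)

      L-0 : L 0#
      L-0 = L-≈ (-‿inverseʳ 1#) (L-+ L-1 (L-neg L-1))

      L-- : ∀ {x y} → L x → L y → L (x - y)
      L-- a b = L-+ a (L-neg b)

      L-pow : ∀ {x} → L x → ∀ k → L (pow x k)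
      L-pow x∈L zero    = L-1
      L-pow x∈L (suc k) = L-* x∈L (L-pow x∈L k)

      L-sum : ∀ {f : ℕ → Carrier} n → (∀ j → j ℕ.< n → L (f j)) → L (sum n f)
      L-sum zero    h = L-0
      L-sum (suc n) h = L-+ (L-sum n (λ j j<n → h j (ℕₚ.m<n⇒m<1+n j<n))) (h n (ℕₚ.n<1+n n))

      infix 4 _∣ₗ_
      -- The membership condition is on the quotient: with `L` the fractions without poles at a
      -- polynomial P, it says that x / d has no pole there.
      _∣ₗ_ : Carrier → Carrier → Set (c ⊔ ℓ ⊔ ℓ′)
      d ∣ₗ x = ∃[ y ] L y × x ≈ d * y

      ∣ₗ-≈ : ∀ {d x y} → x ≈ y → d ∣ₗ x → d ∣ₗ y
      ∣ₗ-≈ h (y , y∈L , e) = y , y∈L , trans (sym h) e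

      ∣ₗ-+ : ∀ {d x y} → d ∣ₗ x → d ∣ₗ y → d ∣ₗ x + y
      ∣ₗ-+ {d} (x , x∈L , e) (y , y∈L , e′) = x + y , L-+ x∈L y∈L , trans (+-cong e e′) (sym (distribˡ d x y))

      ∣ₗ-*ʳ : ∀ {d x y} → d ∣ₗ x → L y → d ∣ₗ x * y
      ∣ₗ-*ʳ {d} {y = y} (x , x∈L , e) y∈L = x * y , L-* x∈L y∈L , trans (*-congʳ e) (*-assoc d x y)

      ∣ₗ-*ˡ : ∀ {d x y} → L x → d ∣ₗ y → d ∣ₗ x * y
      ∣ₗ-*ˡ {d} {x} {y} x∈L h = ∣ₗ-≈ (*-comm y x) (∣ₗ-*ʳ h x∈L)

      ∣ₗ-* : ∀ {d e x y} → d ∣ₗ x → e ∣ₗ y → d * e ∣ₗ x * y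
      ∣ₗ-* {d} {e} (x , x∈L , h) (y , y∈L , k) = x * y , L-* x∈L y∈L , trans (*-cong h k)
        (solve 4 (λ d e x y → d :* x :* (e :* y) := d :* e :* (x :* y)) ≡.refl d e x y)

      ∣ₗ-0 : ∀ {d} → d ∣ₗ 0#
      ∣ₗ-0 {d} = 0# , L-0 , sym (zeroʳ d)

      ∣ₗ-sum : ∀ {d} {f : ℕ → Carrier} n → (∀ j → j ℕ.< n → d ∣ₗ f j) → d ∣ₗ sum n f
      ∣ₗ-sum zero    h = ∣ₗ-0
      ∣ₗ-sum (suc n) h = ∣ₗ-+ (∣ₗ-sum n (λ j j<n → h j (ℕₚ.m<n⇒m<1+n j<n))) (h n (ℕₚ.n<1+n n))

    -- Gaussian binomial coefficients

    module Gaussian (x : Carrier) (ix : ℕ → Carrier) (ix-spec : ∀ k → (1# - pow x (suc k)) * ix k ≈ 1#) where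

      fac ifac : ℕ → Carrier
      fac zero     = 1#
      fac (suc k)  = fac k * (1# - pow x (suc k))
      ifac zero    = 1#
      ifac (suc k) = ifac k * ix k

      fac-inv : ∀ k → fac k * ifac k ≈ 1#
      fac-inv zero    = *-identityˡ 1#
      fac-inv (suc k) = linear (solve 4 (λ f w i v → f :* w :* (i :* v) :- :1 := (f :* i) :* (w :* v :- :1) :+ :1 :* (f :* i :- :1)) ≡.refl
                                        (fac k) (1# - pow x (suc k)) (ifac k) (ix k))
                               (_ ·∅ ix-spec k ⊞ _ ·∅ fac-inv k)

      binom : ℕ → ℕ → Carrier
      binom a b = fac (a ℕ.+ b) * ifac a * ifac b

      pascal : ∀ a b → binom (suc a) (suc b) ≈ binom a (suc b) + pow x (suc a) * binom (suc a) b
      pascal a b = begin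
        fac (a ℕ.+ suc b) * (1# - pow x (suc a ℕ.+ suc b)) * (ifac a * ix a) * (ifac b * ix b)
          ≈⟨ *-congʳ (*-congʳ (*-congˡ (+-congˡ (-‿cong (pow-+ x (suc a) (suc b)))))) ⟩
        fac (a ℕ.+ suc b) * (1# - pow x (suc a) * pow x (suc b)) * (ifac a * ix a) * (ifac b * ix b)
          ≈⟨ linear (solve 7 (λ f A B i v j w →
                 f :* (:1 :- A :* B) :* (i :* v) :* (j :* w) :- (f :* i :* (j :* w) :+ A :* (f :* (i :* v) :* j))
              := (f :* i :* j :* w) :* ((:1 :- A) :* v :- :1) :+ (f :* i :* v :* j :* A) :* ((:1 :- B) :* w :- :1)) ≡.refl
               (fac (a ℕ.+ suc b)) (pow x (suc a)) (pow x (suc b)) (ifac a) (ix a) (ifac b) (ix b))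
               (_ ·∅ ix-spec a ⊞ _ ·∅ ix-spec b) ⟩
        fac (a ℕ.+ suc b) * ifac a * (ifac b * ix b) + pow x (suc a) * (fac (a ℕ.+ suc b) * (ifac a * ix a) * ifac b)
          ≡⟨ ≡.cong (λ n → fac (a ℕ.+ suc b) * ifac a * (ifac b * ix b) + pow x (suc a) * (fac n * (ifac a * ix a) * ifac b)) (ℕₚ.+-suc a b) ⟩
        binom a (suc b) + pow x (suc a) * binom (suc a) b ∎

      module _ {ℓ′} {L : Carrier → Set ℓ′} (sub : IsSubring L) (x∈L : L x) where
        open IsSubring sub

        -- The q-Pascal rule contains no division, so integrality passes from smaller binomials to
        -- larger ones although the factorials are inverted in the ambient ring.
        binom∈L : ∀ a b → L (binom a b)
        binom∈L zero b = L-≈ (linear (solve 2 (λ f i → :1 :- f :* :1 :* i := (:- :1) :* (f :* i :- :1)) ≡.refl (fac b) (ifac b)) (_ ·∅ fac-inv b)) L-1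
        binom∈L (suc a) zero = L-≈ (trans (linear (solve 2 (λ f i → :1 :- f :* i :* :1 := (:- :1) :* (f :* i :- :1)) ≡.refl (fac (suc a)) (ifac (suc a))) (_ ·∅ fac-inv (suc a)))
            (*-congʳ (*-congʳ (reflexive (≡.cong fac (≡.sym (ℕₚ.+-identityʳ (suc a)))))))) L-1
        binom∈L (suc a) (suc b) = L-≈ (sym (pascal a b))
          (L-+ (binom∈L a (suc b)) (L-* (L-pow x∈L (suc a)) (binom∈L (suc a) b)))

    -- Divisibility of the truncated sum by [n]

    -- The element (1 − qᵏ⁺¹) p-inv k is the inverse of 1 + qᵏ⁺¹.
    module Integrality {ℓ′} {L : Carrier → Set ℓ′} (sub : IsSubring L)
      (q∈L : L q) (q⁻¹∈L : L q⁻¹) (1+q^∈L : ∀ k → L ((1# - pow q (suc k)) * p-inv k)) where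

      open IsSubring sub

      open Transformation
      module Gq = Gaussian q inv inv-spec
      module Gp = Gaussian p p-inv p-inv-spec

      p∈L : L p
      p∈L = L-* q∈L q∈L
      p⁻¹∈L : L p⁻¹
      p⁻¹∈L = L-* q⁻¹∈L q⁻¹∈L

      fac-p : ∀ k → Gp.fac k ≈ poch p k
      fac-p zero    = refl
      fac-p (suc k) = *-congʳ (fac-p k)

      ifac-p : ∀ k → Gp.ifac k ≈ ib k
      ifac-p zero    = refl
      ifac-p (suc k) = *-congʳ (ifac-p k)

      fac-double : ∀ k → Gq.fac (k ℕ.+ k) ≈ poch q k * poch p k
      fac-double zero    = sym (*-identityˡ 1#)
      fac-double (suc k) = begin
        Gq.fac (k ℕ.+ suc k) * (1# - pow q (suc k ℕ.+ suc k))
          ≡⟨ ≡.cong (λ n → Gq.fac n * (1# - pow q (suc n))) (ℕₚ.+-suc k k) ⟩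
        Gq.fac (k ℕ.+ k) * (1# - q * pow q (k ℕ.+ k)) * (1# - q * (q * pow q (k ℕ.+ k)))
          ≈⟨ *-cong (*-cong (fac-double k) (+-congˡ (-‿cong (*-congˡ (sym (pow-double k))))))
                    (+-congˡ (-‿cong (*-congˡ (*-congˡ (sym (pow-double k)))))) ⟩
        poch q k * poch p k * (1# - q * pow p k) * (1# - q * (q * pow p k))
          ≈⟨ solve 4 (λ a b q J → a :* b :* (:1 :- q :* J) :* (:1 :- q :* (q :* J)) := a :* (:1 :- q :* J) :* (b :* (:1 :- q :* q :* J))) ≡.refl
               (poch q k) (poch p k) q (pow p k) ⟩
        poch q (suc k) * poch p (suc k) ∎

      -- The quotient (q; q)ₖ / (q²; q²)ₖ is 1 / (-q; q)ₖ, a product of inverses of 1 + qⁱ.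
      fac-ib∈L : ∀ k → L (Gq.fac k * ib k)
      fac-ib∈L zero    = L-≈ (sym (*-identityˡ 1#)) L-1
      fac-ib∈L (suc k) = L-≈ (solve 4 (λ f i w v → f :* i :* (w :* v) := f :* w :* (i :* v)) ≡.refl (Gq.fac k) (ib k) (1# - pow q (suc k)) (p-inv k))
                             (L-* (fac-ib∈L k) (1+q^∈L k))

      -- By `fac-double` the quotient is the central Gaussian binomial of 2k over k, divided by (-q;
      -- q)ₖ².
      a/b∈L : ∀ k → L (a/b k)
      a/b∈L k = L-≈ (begin
          Gq.binom k k * (Gq.fac k * ib k) * (Gq.fac k * ib k)   ≈⟨ *-congʳ (*-congʳ (*-congʳ (*-congʳ (fac-double k)))) ⟩
          poch q k * poch p k * Gq.ifac k * Gq.ifac k * (Gq.fac k * ib k) * (Gq.fac k * ib k)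
            ≈⟨ linear (solve 5 (λ a b f g i → a :* b :* g :* g :* (f :* i) :* (f :* i) :- a :* i
                 := (a :* b :* i :* i :* (f :* g :+ :1)) :* (f :* g :- :1) :+ (a :* i) :* (b :* i :- :1)) ≡.refl
                 (poch q k) (poch p k) (Gq.fac k) (Gq.ifac k) (ib k))
               (_ ·∅ Gq.fac-inv k ⊞ _ ·∅ ib-inv k) ⟩
          a/b k ∎)
        (L-* (L-* (Gq.binom∈L sub q∈L k k) (fac-ib∈L k)) (fac-ib∈L k))

      -- Times 1 - q, this is the q-Catalan number, the central Gaussian binomial over [k + 1], up
      -- to inverses of factors 1 + qⁱ.
      catalan : ℕ → Carrier
      catalan k = poch q k * ib (suc k)

      p-catalan∈L : ∀ k → L ((1# - pow p (suc k)) * catalan k)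
      p-catalan∈L k = L-≈ (sym (linear (solve 4 (λ w a j i → w :* (a :* j) :- a :* i := a :* (j :* w :- i)) ≡.refl
                            (1# - pow p (suc k)) (poch q k) (ib (suc k)) (ib k)) (_ ·∅ ib-suc k))) (a/b∈L k)

      -- (1 − q²ᵏ⁺²) − q (1 − q²ᵏ⁺¹) = 1 − q
      catalan∈L : ∀ k → L ((1# - q) * catalan k)
      catalan∈L k = L-≈ (solve 4 (λ q J a i → (:1 :- q :* q :* J) :* (a :* i) :- q :* (a :* (:1 :- q :* J) :* i) := (:1 :- q) :* (a :* i)) ≡.refl
                          q (pow p k) (poch q k) (ib (suc k)))
                        (L-- (p-catalan∈L k) (L-* q∈L (a/b∈L (suc k))))

      -- The q²-multinomial coefficient of i + 2j over i, j, j is a product of two Gaussian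
      -- binomials in base q².
      multinomial∈L : ∀ i j → L (poch p (i ℕ.+ j ℕ.+ j) * ib i * ib j * ib j)
      multinomial∈L i j = L-≈ (begin
          Gp.binom (i ℕ.+ j) j * Gp.binom i j
            ≈⟨ *-cong (*-cong (*-cong (fac-p (i ℕ.+ j ℕ.+ j)) (ifac-p (i ℕ.+ j))) (ifac-p j)) (*-cong (*-cong (fac-p (i ℕ.+ j)) (ifac-p i)) (ifac-p j)) ⟩
          poch p (i ℕ.+ j ℕ.+ j) * ib (i ℕ.+ j) * ib j * (poch p (i ℕ.+ j) * ib i * ib j)
            ≈⟨ linear (solve 5 (λ B m j b i → B :* m :* j :* (b :* i :* j) :- B :* i :* j :* j := (B :* i :* j :* j) :* (b :* m :- :1)) ≡.refl
                 (poch p (i ℕ.+ j ℕ.+ j)) (ib (i ℕ.+ j)) (ib j) (poch p (i ℕ.+ j)) (ib i)) (_ ·∅ ib-inv (i ℕ.+ j)) ⟩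
          poch p (i ℕ.+ j ℕ.+ j) * ib i * ib j * ib j ∎)
        (L-* (Gp.binom∈L sub p∈L (i ℕ.+ j) j) (Gp.binom∈L sub p∈L i j))

      poch-+ : ∀ x m j → poch x (m ℕ.+ j) ≈ poch x m * poch (x * pow p m) j
      poch-+ x m zero    = trans (reflexive (≡.cong (poch x) (ℕₚ.+-identityʳ m))) (sym (*-identityʳ _))
      poch-+ x m (suc j) = begin
        poch x (m ℕ.+ suc j)   ≡⟨ ≡.cong (poch x) (ℕₚ.+-suc m j) ⟩
        poch x (m ℕ.+ j) * (1# - x * pow p (m ℕ.+ j))   ≈⟨ *-cong (poch-+ x m j) (+-congˡ (-‿cong (*-congˡ (pow-+ p m j)))) ⟩
        poch x m * poch (x * pow p m) j * (1# - x * (pow p m * pow p j))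
          ≈⟨ solve 5 (λ a b x M J → a :* b :* (:1 :- x :* (M :* J)) := a :* (b :* (:1 :- x :* M :* J))) ≡.refl
               (poch x m) (poch (x * pow p m) j) x (pow p m) (pow p j) ⟩
        poch x m * poch (x * pow p m) (suc j) ∎

      -- With m = i + j, pulling the negative power of q out of each factor of (q⁻²ᵐ; q²)ⱼ leaves bₘ
      -- / bᵢ. The element u is a sign times a power of q; only its membership in `L` matters later.
      poch-p⁻ : ∀ i j → ∃[ u ] L u × poch (pow p⁻¹ (i ℕ.+ j)) j ≈ u * (poch p (i ℕ.+ j) * ib i)
      poch-p⁻ i zero = 1# , L-1 , trans (linear (solve 2 (λ b i → :1 :- :1 :* (b :* i) := (:- :1) :* (b :* i :- :1)) ≡.refl (poch p i) (ib i))
          (_ ·∅ ib-inv i)) (*-congˡ (*-congʳ (reflexive (≡.cong (poch p) (≡.sym (ℕₚ.+-identityʳ i))))))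
      poch-p⁻ i (suc j) with poch-p⁻ i j
      ... | u , u∈L , h = - z * u , L-* (L-neg (L-pow p⁻¹∈L (suc (i ℕ.+ j)))) u∈L , (begin
        poch (pow p⁻¹ (i ℕ.+ suc j)) (suc j)   ≡⟨ ≡.cong (λ n → poch (pow p⁻¹ n) (suc j)) (ℕₚ.+-suc i j) ⟩
        poch z (suc j)                         ≈⟨ poch-shift z j ⟨
        (1# - z) * poch (z * p) j              ≈⟨ *-congˡ (trans (poch-cong (linear (solve 3 (λ r P M → r :* M :* P :- M := M :* (P :* r :- :1)) ≡.refl p⁻¹ p (pow p⁻¹ (i ℕ.+ j))) (_ ·∅ p⁻¹-inv)) j) h) ⟩
        (1# - z) * (u * (poch p (i ℕ.+ j) * ib i))
          ≈⟨ linear (solve 5 (λ z u b i W → (:1 :- z) :* (u :* (b :* i)) :- :- z :* u :* (b :* (:1 :- W) :* i) := (:- u :* b :* i) :* (W :* z :- :1)) ≡.refl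
               z u (poch p (i ℕ.+ j)) (ib i) (pow p (suc (i ℕ.+ j)))) (_ ·∅ pow-1 p⁻¹-inv (suc (i ℕ.+ j))) ⟩
        - z * u * (poch p (suc (i ℕ.+ j)) * ib i)  ≡⟨ ≡.cong (λ n → - z * u * (poch p n * ib i)) (ℕₚ.+-suc i j) ⟨
        - z * u * (poch p (i ℕ.+ suc j) * ib i) ∎)
        where
        z : Carrier
        z = pow p⁻¹ (suc (i ℕ.+ j))

      -- For positive index, 1 / (1 - q) cancels against the first factor 1 - q⁻¹ of (q⁻¹; q²). What
      -- is left is a `catalan` term times 1 - qJ with J = q²ʲ⁺², and 1 - qJ = (1 - J) + J(1 - q)
      -- reduces it to the two known multiples of `catalan`.
      front∈L : ∀ j → L ((1# - q * pow p j) * (I₀ * poch q⁻¹ j * ib j))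
      front∈L zero = L-≈ (linear (solve 2 (λ q I → :1 :- (:1 :- q :* :1) :* (I :* :1 :* :1) := (:- :1) :* ((:1 :- q :* :1) :* I :- :1)) ≡.refl q I₀) (_ ·∅ inv-spec 0)) L-1
      front∈L (suc j) = L-≈ (sym (begin
          (1# - q * pow p (suc j)) * (I₀ * poch q⁻¹ (suc j) * ib (suc j))
            ≈⟨ *-congˡ (*-congʳ (*-congˡ (sym (poch-q⁻¹ j)))) ⟩
          (1# - q * pow p (suc j)) * (I₀ * ((1# - q⁻¹) * poch q j) * ib (suc j))
            ≈⟨ linear (solve 6 (λ q r I J a i → (:1 :- q :* J) :* (I :* ((:1 :- r) :* a) :* i) :- :- r :* ((:1 :- J) :* (a :* i) :+ J :* ((:1 :- q) :* (a :* i)))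
                := (:- ((:1 :- q :* J) :* I :* a :* i)) :* (q :* r :- :1) :+ (:- ((:1 :- q :* J) :* r :* (a :* i))) :* ((:1 :- q :* :1) :* I :- :1)) ≡.refl
                q q⁻¹ I₀ (pow p (suc j)) (poch q j) (ib (suc j)))
              (_ ·∅ q⁻¹-inv ⊞ _ ·∅ inv-spec 0) ⟩
          - q⁻¹ * ((1# - pow p (suc j)) * catalan j + pow p (suc j) * ((1# - q) * catalan j)) ∎))
        (L-* (L-neg q⁻¹∈L) (L-+ (p-catalan∈L j) (L-* (L-pow p∈L (suc j)) (catalan∈L j))))

      -- With m = i + j, aₘ absorbs (q²ᵐ⁺¹; q²)ⱼ into aₘ₊ⱼ, and bₘ cancels against the reversed
      -- (q⁻²ᵐ; q²)ⱼ. The denominators bᵢ bⱼ bⱼ then need exactly bₘ₊ⱼ = bᵢ₊₂ⱼ above them to form a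
      -- multinomial coefficient.
      a/b*t∈L : ∀ i j → L (a/b (i ℕ.+ j) * t (i ℕ.+ j) j)
      a/b*t∈L i j with poch-p⁻ i j
      ... | u , u∈L , h = L-≈ (sym (begin
          a/b m * t m j
            ≈⟨ *-congˡ (*-congʳ (*-congʳ (*-congˡ h))) ⟩
          poch q m * ib m * ((1# - q * pow p j) * I₀ * poch q⁻¹ j * poch (q * pow p m) j * (u * (poch p m * ib i)) * (ib j * ib j * ib j) * pow p j)
            -- The variable B stands for `1#`, kept as a separate factor so that the next step can
            -- replace it by bₘ₊ⱼ / bₘ₊ⱼ: the numerator completes the multinomial, the denominator
            -- completes aₘ₊ⱼ / bₘ₊ⱼ.
            ≈⟨ linear (solve 12 (λ a m v I Q X u b i j J B → a :* m :* (v :* I :* Q :* X :* (u :* (b :* i)) :* (j :* j :* j) :* J)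
                   :- (v :* (I :* Q :* j)) :* ((a :* X) :* B :* u :* J :* (i :* j :* j))
                 := (v :* (I :* Q :* j) :* (a :* X :* u :* J :* (i :* j :* j))) :* (b :* m :- B)) ≡.refl
                 (poch q m) (ib m) (1# - q * pow p j) I₀ (poch q⁻¹ j) (poch (q * pow p m) j) u (poch p m) (ib i) (ib j) (pow p j) 1#)
               (_ ·∅ ib-inv m) ⟩
          (1# - q * pow p j) * (I₀ * poch q⁻¹ j * ib j) * ((poch q m * poch (q * pow p m) j) * 1# * u * pow p j * (ib i * ib j * ib j))
            ≈⟨ *-congˡ (*-congʳ (*-congʳ (*-congʳ (*-cong (sym (poch-+ q m j)) (sym (ib-inv (m ℕ.+ j))))))) ⟩
          (1# - q * pow p j) * (I₀ * poch q⁻¹ j * ib j) * (poch q (m ℕ.+ j) * (poch p (m ℕ.+ j) * ib (m ℕ.+ j)) * u * pow p j * (ib i * ib j * ib j))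
            ≈⟨ solve 8 (λ f a B s u J i j → f :* (a :* (B :* s) :* u :* J :* (i :* j :* j)) := f :* (a :* s :* (B :* i :* j :* j) :* u :* J)) ≡.refl
                 ((1# - q * pow p j) * (I₀ * poch q⁻¹ j * ib j)) (poch q (m ℕ.+ j)) (poch p (m ℕ.+ j)) (ib (m ℕ.+ j)) u (pow p j) (ib i) (ib j) ⟩
          (1# - q * pow p j) * (I₀ * poch q⁻¹ j * ib j) * (a/b (m ℕ.+ j) * (poch p (m ℕ.+ j) * ib i * ib j * ib j) * u * pow p j) ∎))
        (L-* (front∈L j) (L-* (L-* (L-* (a/b∈L (m ℕ.+ j)) (multinomial∈L i j)) u∈L) (L-pow p∈L j)))
        where m = i ℕ.+ j

      -- Of the two factors aₘ / bₘ in each term of `F`, one makes the 4φ3 term integral and the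
      -- other survives as the divisor.
      a/b∣sum : ∀ m → a/b m ∣ₗ sum (suc m) term
      a/b∣sum m = ∣ₗ-≈ (sym (transformation m)) (∣ₗ-sum (suc m) λ j j<1+m → a/b∣F j (ℕₚ.m∸n+n≡m (ℕₚ.≤-pred j<1+m)))
        where
        a/b∣F : ∀ j {i} → i ℕ.+ j ≡ m → a/b m ∣ₗ F m j
        a/b∣F j {i} ≡.refl = - (q⁻¹ * pow q m) * (a/b m * t m j) ,
          L-* (L-neg (L-* q⁻¹∈L (L-pow q∈L m))) (a/b*t∈L i j) ,
          solve 4 (λ r T s t → :- (r :* T :* (s :* s)) :* t := s :* (:- (r :* T) :* (s :* t))) ≡.refl q⁻¹ (pow q m) (a/b m) (t m j)

      module _ {ν n} (ν-spec : ν * (1# - q) ≈ 1# - pow q n) where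

        -- The last factor of aᵣ₊₁ is 1 - q²ʳ⁺¹ = 1 - qⁿ = ν(1 - q), and the remaining 1 - q makes
        -- aᵣ / bᵣ₊₁ integral.
        ν∣a/b-half : ∀ r → n ≡ suc (r ℕ.+ r) → ν ∣ₗ a/b (suc r)
        ν∣a/b-half r ≡.refl = (1# - q) * catalan r , catalan∈L r , (begin
          poch q r * (1# - q * pow p r) * ib (suc r)           ≈⟨ *-congʳ (*-congˡ (+-congˡ (-‿cong (*-congˡ (pow-double r))))) ⟩
          poch q r * (1# - pow q (suc (r ℕ.+ r))) * ib (suc r) ≈⟨ *-congʳ (*-congˡ ν-spec) ⟨
          poch q r * (ν * (1# - q)) * ib (suc r)               ≈⟨ solve 4 (λ a ν w i → a :* (ν :* w) :* i := ν :* (w :* (a :* i))) ≡.refl (poch q r) ν (1# - q) (ib (suc r)) ⟩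
          ν * ((1# - q) * catalan r)                           ∎)

        -- Here r = n - 1. Completing bᵣ to bₙ puts 1 - q²ⁿ = (1 - qⁿ)(1 + qⁿ) into the numerator,
        -- and 1 - qⁿ = ν(1 - q) as in the other case.
        ν∣a/b-full : ∀ r → n ≡ suc r → ν ∣ₗ a/b r
        ν∣a/b-full r ≡.refl = (1# - q) * catalan r * (1# + pow q (suc r)) , L-* (catalan∈L r) (L-+ L-1 (L-pow q∈L (suc r))) , (begin
          poch q r * ib r                                      ≈⟨ *-congˡ (ib-suc r) ⟨
          poch q r * (ib (suc r) * (1# - pow p (suc r)))       ≈⟨ *-congˡ (*-congˡ (+-congˡ (-‿cong (pow-p (suc r))))) ⟩
          poch q r * (ib (suc r) * (1# - Q * Q))               ≈⟨ solve 3 (λ a i Q → a :* (i :* (:1 :- Q :* Q)) := (:1 :- Q) :* (a :* i :* (:1 :+ Q))) ≡.refl (poch q r) (ib (suc r)) Q ⟩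
          (1# - Q) * (catalan r * (1# + Q))                    ≈⟨ *-congʳ ν-spec ⟨
          ν * (1# - q) * (catalan r * (1# + Q))                ≈⟨ solve 4 (λ ν w c Q → ν :* w :* (c :* Q) := ν :* (w :* c :* Q)) ≡.refl ν (1# - q) (catalan r) (1# + Q) ⟩
          ν * ((1# - q) * catalan r * (1# + Q))                ∎)
          where
          Q : Carrier
          Q = pow q (suc r)

        ∣ₗ-trans : ∀ {x y z} → x ∣ₗ y → y ∣ₗ z → x ∣ₗ z
        ∣ₗ-trans {x} (y , y∈L , h) (z , z∈L , k) = y * z , L-* y∈L z∈L , trans k (trans (*-congʳ h) (*-assoc x y z))

        ν∣sum-half : ∀ r → n ≡ suc (r ℕ.+ r) → ν ∣ₗ sum (suc (suc r)) term
        ν∣sum-half r e = ∣ₗ-trans (ν∣a/b-half r e) (a/b∣sum (suc r))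

        ν∣sum-full : ∀ r → n ≡ suc r → ν ∣ₗ sum n term
        ν∣sum-full r ≡.refl = ∣ₗ-trans (ν∣a/b-full r ≡.refl) (a/b∣sum r)

    -- Divisibility of the truncated sum by the cube of Φₙ

    module CubeDivisibility {ℓ′} {L : Carrier → Set ℓ′} (sub : IsSubring L)
      (q∈L : L q) (q⁻¹∈L : L q⁻¹) (I₀∈L : L (inv 0)) (r : ℕ) (1≤r : 1 ℕ.≤ r)
      (p-inv∈L : ∀ k → k ℕ.< r ℕ.+ r → L (p-inv k)) {φ} (φ∣1-q^n : IsSubring._∣ₗ_ sub φ (1# - pow q (suc (r ℕ.+ r)))) where

      open IsSubring sub

      open Transformation

      private
        p∈L : L p
        p∈L = L-* q∈L q∈L
        p⁻¹∈L : L p⁻¹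
        p⁻¹∈L = L-* q⁻¹∈L q⁻¹∈L
        J∈L : ∀ j → L (pow p j)
        J∈L = L-pow p∈L

        m : ℕ
        m = suc r

        m≤2r : m ℕ.≤ r ℕ.+ r
        m≤2r = ℕₚ.+-monoˡ-≤ r 1≤r

        φ∣1-qp^r : φ ∣ₗ 1# - q * pow p r
        φ∣1-qp^r = ∣ₗ-≈ (+-congˡ (-‿cong (*-congˡ (sym (pow-double r))))) φ∣1-q^n

        poch∈L : ∀ {x} → L x → ∀ k → L (poch x k)
        poch∈L x∈L zero    = L-1
        poch∈L x∈L (suc k) = L-* (poch∈L x∈L k) (L-- L-1 (L-* x∈L (J∈L k)))

        ib∈L : ∀ k → k ℕ.≤ r ℕ.+ r → L (ib k)
        ib∈L zero    _ = L-1
        ib∈L (suc k) h = L-* (ib∈L k (ℕₚ.≤-trans (ℕₚ.n≤1+n k) h)) (p-inv∈L k h)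

        poch-mod : ∀ {x y} → L x → L y → φ ∣ₗ x - y → ∀ k → φ ∣ₗ poch x k - poch y k
        poch-mod x∈L y∈L h zero = ∣ₗ-≈ (sym (-‿inverseʳ 1#)) ∣ₗ-0
        poch-mod {x} {y} x∈L y∈L h (suc k) = ∣ₗ-≈
          (solve 5 (λ P P′ x y J → (P :- P′) :* (:1 :- x :* J) :+ (x :- y) :* (:- P′ :* J) := P :* (:1 :- x :* J) :- P′ :* (:1 :- y :* J)) ≡.refl
            (poch x k) (poch y k) x y (pow p k))
          (∣ₗ-+ (∣ₗ-*ʳ (poch-mod x∈L y∈L h k) (L-- L-1 (L-* x∈L (J∈L k))))
                (∣ₗ-*ʳ h (L-* (L-neg (poch∈L y∈L k)) (J∈L k))))

        -- t m modulo φ, where q²ᵐ⁺¹ ≡ q² and q⁻²ᵐ ≡ q⁻¹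
        t̄ : ℕ → Carrier
        t̄ j = (1# - q * pow p j) * I₀ * poch q⁻¹ j * poch p j * poch q⁻¹ j * (ib j * ib j * ib j) * pow p j

        φ∣X : φ ∣ₗ q * pow p m - p
        φ∣X = ∣ₗ-≈ (solve 2 (λ q M → (:1 :- q :* M) :* (:- (q :* q)) := q :* (q :* q :* M) :- q :* q) ≡.refl q (pow p r))
                   (∣ₗ-*ʳ φ∣1-qp^r (L-neg p∈L))

        φ∣Y : φ ∣ₗ pow p⁻¹ m - q⁻¹
        φ∣Y = ∣ₗ-≈ (linear (solve 4 (λ q i M W → (:1 :- q :* M) :* (i :* i :* W) :- (i :* i :* W :- i)
                     := (:- i) :* (q :* i :- :1) :+ (:- (q :* i :* i)) :* (M :* W :- :1)) ≡.refl q q⁻¹ (pow p r) (pow p⁻¹ r))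
                     (_ ·∅ q⁻¹-inv ⊞ _ ·∅ pow-1 p⁻¹-inv r))
                   (∣ₗ-*ʳ φ∣1-qp^r (L-pow p⁻¹∈L m))

        t-mod : ∀ j → j ℕ.≤ m → φ ∣ₗ t m j - t̄ j
        t-mod j j≤m = ∣ₗ-≈
          (solve 7 (λ f X X′ Y Y′ i J → ((X :- X′) :* Y :+ X′ :* (Y :- Y′)) :* (f :* i :* J)
                                      := f :* X :* Y :* i :* J :- f :* X′ :* Y′ :* i :* J) ≡.refl
             ((1# - q * pow p j) * I₀ * poch q⁻¹ j) (poch (q * pow p m) j) (poch p j) (poch (pow p⁻¹ m) j) (poch q⁻¹ j) (ib j * ib j * ib j) (pow p j))
          (∣ₗ-*ʳ (∣ₗ-+ (∣ₗ-*ʳ (poch-mod x∈L p∈L φ∣X j) (poch∈L y∈L j))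
                       (∣ₗ-*ˡ (poch∈L p∈L j) (poch-mod y∈L q⁻¹∈L φ∣Y j)))
                 (L-* (L-* (L-* (L-* (L-- L-1 (L-* q∈L (J∈L j))) I₀∈L) (poch∈L q⁻¹∈L j)) (L-* (L-* i∈L i∈L) i∈L)) (J∈L j)))
          where
          x∈L : L (q * pow p m)
          x∈L = L-* q∈L (J∈L m)
          y∈L : L (pow p⁻¹ m)
          y∈L = L-pow p⁻¹∈L m
          i∈L : L (ib j)
          i∈L = ib∈L j (ℕₚ.≤-trans j≤m m≤2r)

        -- the telescoping antidifference of t̄, found by Gosper's algorithm
        U : ℕ → Carrier
        U j = (q * q * (1# + 1# + q) - (1# + q + q) * pow p j) * (poch q⁻¹ j * poch q⁻¹ j)
              * ((ib j * (1# - pow p j)) * (ib j * (1# - pow p j)))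

        -- Trades bⱼ₊₁ for bⱼ in the upper end of the telescoping sum. For n = 3 this matters: there
        -- m + 1 = n, so bₘ₊₁ contains 1 - q²ⁿ and is not invertible modulo φ.
        U-suc : ∀ j → U (suc j) ≈ (q * q * (1# + 1# + q) - (1# + q + q) * pow p (suc j)) * (poch q⁻¹ (suc j) * poch q⁻¹ (suc j)) * (ib j * ib j)
        U-suc j = *-congˡ (*-cong (ib-suc j) (ib-suc j))

        -- In t̄ the factor (q²; q²)ⱼ cancels one bⱼ. Dividing by (q⁻¹; q²)ⱼ² / bⱼ² leaves a
        -- polynomial identity in q²ʲ in which the increment of U is (1 - q)³ times the term; this
        -- accounts for the cube of `I₀`.
        t̄-gosper : ∀ j → t̄ j ≈ I₀ * I₀ * I₀ * (U (suc j) - U j)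
        t̄-gosper j = linear (solve 8 (λ q r J I P B i V →
              (:1 :- q :* J) :* I :* P :* B :* P :* (i :* i :* i) :* J
                :- I :* I :* I :* (V :- (q :* q :* (:1 :+ :1 :+ q) :- (:1 :+ q :+ q) :* J) :* (P :* P) :* ((i :* (:1 :- J)) :* (i :* (:1 :- J))))
            := ((:1 :- q :* J) :* I :* P :* P :* i :* i :* J) :* (B :* i :- :1)
            :+ (:- (I :* I :* I)) :* (V :- (q :* q :* (:1 :+ :1 :+ q) :- (:1 :+ q :+ q) :* (q :* q :* J))
                                            :* ((P :* (:1 :- r :* J)) :* (P :* (:1 :- r :* J))) :* (i :* i))
            :+ (:- ((:1 :- q :* J) :* I :* P :* P :* i :* i :* J) :* ((:1 :- q) :* I :+ :1)) :* ((:1 :- q :* :1) :* I :- :1)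
            :+ (I :* I :* I :* P :* P :* i :* i :* (:1 :+ :1 :+ q :- (:1 :+ q :+ q) :* J) :* J :* (q :- J :+ (q :- J) :- (q :* r :- :1) :* J)) :* (q :* r :- :1)) ≡.refl
            q q⁻¹ (pow p j) I₀ (poch q⁻¹ j) (poch p j) (ib j) (U (suc j)))
          (_ ·∅ ib-inv j ⊞ _ ·∅ U-suc j ⊞ _ ·∅ inv-spec 0 ⊞ _ ·∅ q⁻¹-inv)

        -- Since 2m - 1 = n, the factor of index m in (q⁻¹; q²)ₖ is 1 - qⁿ; it is present as soon as
        -- k > m.
        φ∣last : φ ∣ₗ 1# - q⁻¹ * pow p m
        φ∣last = ∣ₗ-≈ (linear (solve 3 (λ q i M → :1 :- q :* M :- (:1 :- i :* (q :* q :* M)) := (q :* M) :* (q :* i :- :1)) ≡.refl q q⁻¹ (pow p r)) (_ ·∅ q⁻¹-inv))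
                      φ∣1-qp^r

        φ∣poch : ∀ d → φ ∣ₗ poch q⁻¹ (d ℕ.+ suc m)
        φ∣poch zero    = ∣ₗ-*ˡ (poch∈L q⁻¹∈L m) φ∣last
        φ∣poch (suc d) = ∣ₗ-*ʳ (φ∣poch d) (L-- L-1 (L-* q⁻¹∈L (J∈L (d ℕ.+ suc m))))

        φ∣sum-t̄ : φ ∣ₗ sum (suc m) t̄
        φ∣sum-t̄ = ∣ₗ-≈ (sym (begin
            sum (suc m) t̄                                             ≈⟨ sum-cong t̄-gosper (suc m) ⟩
            sum (suc m) (λ j → I₀ * I₀ * I₀ * (U (suc j) - U j))      ≈⟨ sum-*ˡ (I₀ * I₀ * I₀) (λ j → U (suc j) - U j) (suc m) ⟩
            I₀ * I₀ * I₀ * sum (suc m) (λ j → U (suc j) - U j)        ≈⟨ *-congˡ (telescope U (suc m)) ⟩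
            I₀ * I₀ * I₀ * (U (suc m) - U 0)
              ≈⟨ *-congˡ (+-cong (U-suc m) (-‿cong (solve 1 (λ q → (q :* q :* (:1 :+ :1 :+ q) :- (:1 :+ q :+ q) :* :1) :* (:1 :* :1) :* (:1 :* (:1 :- :1) :* (:1 :* (:1 :- :1))) := :0) ≡.refl q))) ⟩
            I₀ * I₀ * I₀ * (u * (poch q⁻¹ (suc m) * poch q⁻¹ (suc m)) * (ib m * ib m) - 0#)
              ≈⟨ solve 4 (λ I u P i → I :* I :* I :* (u :* (P :* P) :* (i :* i) :- :0) := P :* (P :* (I :* I :* I :* u :* (i :* i)))) ≡.refl I₀ u (poch q⁻¹ (suc m)) (ib m) ⟩
            poch q⁻¹ (suc m) * (poch q⁻¹ (suc m) * (I₀ * I₀ * I₀ * u * (ib m * ib m))) ∎))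
          (∣ₗ-*ʳ (φ∣poch 0) (L-* (poch∈L q⁻¹∈L (suc m)) (L-* (L-* (L-* (L-* I₀∈L I₀∈L) I₀∈L) u∈L) (L-* (ib∈L m m≤2r) (ib∈L m m≤2r)))))
          where
          u : Carrier
          u = q * q * (1# + 1# + q) - (1# + q + q) * pow p (suc m)
          u∈L : L u
          u∈L = L-- (L-* p∈L (L-+ (L-+ L-1 L-1) q∈L)) (L-* (L-+ (L-+ L-1 q∈L) q∈L) (J∈L (suc m)))

        φ∣sum-t : φ ∣ₗ sum (suc m) (t m)
        φ∣sum-t = ∣ₗ-≈ (begin
            sum (suc m) (λ j → t m j - t̄ j) + sum (suc m) t̄      ≈⟨ sum-+ (λ j → t m j - t̄ j) t̄ (suc m) ⟨
            sum (suc m) (λ j → t m j - t̄ j + t̄ j)                ≈⟨ sum-cong (λ j → solve 2 (λ x y → x :- y :+ y := x) ≡.refl (t m j) (t̄ j)) (suc m) ⟩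
            sum (suc m) (t m)                                     ∎)
          (∣ₗ-+ (∣ₗ-sum (suc m) (λ j j<1+m → t-mod j (ℕₚ.≤-pred j<1+m))) φ∣sum-t̄)

        φ∣a/b : φ ∣ₗ a/b m
        φ∣a/b = ∣ₗ-*ʳ (∣ₗ-*ˡ (poch∈L q∈L r) φ∣1-qp^r) (ib∈L m m≤2r)

      φ³∣sum-half : φ * φ * φ ∣ₗ sum (suc (suc r)) term
      φ³∣sum-half = ∣ₗ-≈ (begin
          a/b m * a/b m * sum (suc m) (t m) * - (q⁻¹ * pow q m)
            ≈⟨ solve 4 (λ a s r T → a :* a :* s :* (:- (r :* T)) := :- (r :* T :* (a :* a)) :* s) ≡.refl (a/b m) (sum (suc m) (t m)) q⁻¹ (pow q m) ⟩
          - (q⁻¹ * pow q m * (a/b m * a/b m)) * sum (suc m) (t m)   ≈⟨ sum-*ˡ (- (q⁻¹ * pow q m * (a/b m * a/b m))) (t m) (suc m) ⟨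
          sum (suc m) (F m)                                         ≈⟨ transformation m ⟨
          sum (suc m) term                                          ∎)
        (∣ₗ-*ʳ (∣ₗ-* (∣ₗ-* φ∣a/b φ∣a/b) φ∣sum-t) (L-neg (L-* q⁻¹∈L (L-pow q∈L m))))

      private
        φ³∣term : ∀ d → d ℕ.+ suc m ℕ.≤ r ℕ.+ r → φ * φ * φ ∣ₗ term (d ℕ.+ suc m)
        φ³∣term d k≤2r = ∣ₗ-≈
          (solve 4 (λ f P i J → P :* P :* P :* (P :* f :* i :* J) := f :* (P :* P :* P :* P) :* i :* J) ≡.refl
            ((1# - pow p k * pow p k * q⁻¹) * I₀) (poch q⁻¹ k) (ib k * ib k * ib k * ib k) (pow p k * pow p k))
          (∣ₗ-*ʳ (∣ₗ-* (∣ₗ-* (φ∣poch d) (φ∣poch d)) (φ∣poch d))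
            (L-* (L-* (L-* (poch∈L q⁻¹∈L k) (L-* (L-- L-1 (L-* (L-* (J∈L k) (J∈L k)) q⁻¹∈L)) I₀∈L))
                      (L-* (L-* (L-* i∈L i∈L) i∈L) i∈L))
                 (L-* (J∈L k) (J∈L k))))
          where
          k : ℕ
          k = d ℕ.+ suc m
          i∈L : L (ib k)
          i∈L = ib∈L k k≤2r

        φ³∣sum-from-half : ∀ d → d ℕ.+ m ℕ.≤ r ℕ.+ r → φ * φ * φ ∣ₗ sum (suc (d ℕ.+ m)) term
        φ³∣sum-from-half zero    h = φ³∣sum-half
        φ³∣sum-from-half (suc d) h = ∣ₗ-+ (φ³∣sum-from-half d (ℕₚ.≤-trans (ℕₚ.n≤1+n _) h))
          (≡.subst (λ k → φ * φ * φ ∣ₗ term k) (ℕₚ.+-suc d m)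
            (φ³∣term d (≡.subst (ℕ._≤ r ℕ.+ r) (≡.sym (ℕₚ.+-suc d m)) h)))

      φ³∣sum-full : φ * φ * φ ∣ₗ sum (suc (r ℕ.+ r)) term
      φ³∣sum-full = ≡.subst (λ k → φ * φ * φ ∣ₗ sum (suc k) term) k≡ (φ³∣sum-from-half (r ℕ.+ r ℕ.∸ m) (ℕₚ.≤-reflexive k≡))
        where
        k≡ : r ℕ.+ r ℕ.∸ m ℕ.+ m ≡ r ℕ.+ r
        k≡ = ℕₚ.m∸n+n≡m m≤2r

open import Defs hiding (q)

-- The commutative ring ℤ[q] on coefficient lists

module PolynomialRing where
  open ≡ using (refl; sym; trans; cong; cong₂)

  open IntegerSolver ℤₚ.+-*-commutativeRing using ()
    renaming (solve to solveℤ; _:=_ to _:=′_; _:+_ to _:+′_; _:*_ to _:*′_)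

  coeff : Poly → ℕ → ℤ
  coeff []      _       = 0ℤ
  coeff (a ∷ p) zero    = a
  coeff (a ∷ p) (suc i) = coeff p i

  infix 4 _≐_
  -- Lists that differ by trailing zeros denote the same polynomial; comparing all coefficients
  -- ignores lengths and reduces the ring laws to integer arithmetic.
  record _≐_ (p q : Poly) : Set where
    constructor ⟨_⟩
    field at : ∀ i → coeff p i ≡ coeff q i
  open _≐_ public

  coeff-+ : ∀ p q i → coeff (p +P q) i ≡ coeff p i ℤ.+ coeff q i
  coeff-+ []      q       i       = sym (ℤₚ.+-identityˡ _)
  coeff-+ (a ∷ p) []      i       = sym (ℤₚ.+-identityʳ _)
  coeff-+ (a ∷ p) (b ∷ q) zero    = refl
  coeff-+ (a ∷ p) (b ∷ q) (suc i) = coeff-+ p q i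

  coeff-neg : ∀ p i → coeff (negP p) i ≡ ℤ.- coeff p i
  coeff-neg []      i       = refl
  coeff-neg (a ∷ p) zero    = refl
  coeff-neg (a ∷ p) (suc i) = coeff-neg p i

  scale : ℤ → Poly → Poly
  scale a = map (a ℤ.*_)

  coeff-scale : ∀ a p i → coeff (scale a p) i ≡ a ℤ.* coeff p i
  coeff-scale a []      i       = sym (ℤₚ.*-zeroʳ a)
  coeff-scale a (b ∷ p) zero    = refl
  coeff-scale a (b ∷ p) (suc i) = coeff-scale a p i

  zero⇒coeff : ∀ {p} → IsZeroP p → ∀ i → coeff p i ≡ 0ℤ
  zero⇒coeff []       i       = refl
  zero⇒coeff (e ∷ z)  zero    = e
  zero⇒coeff (e ∷ z)  (suc i) = zero⇒coeff z i

  coeff⇒zero : ∀ {p} → (∀ i → coeff p i ≡ 0ℤ) → IsZeroP p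
  coeff⇒zero {[]}    h = []
  coeff⇒zero {a ∷ p} h = h zero ∷ coeff⇒zero (λ i → h (suc i))

  coeff-- : ∀ p q i → coeff (p -P q) i ≡ coeff p i ℤ.- coeff q i
  coeff-- p q i = trans (coeff-+ p (negP q) i) (cong (ℤ._+_ (coeff p i)) (coeff-neg q i))

  ≈P⇒≐ : ∀ {p q} → p ≈P q → p ≐ q
  ≈P⇒≐ {p} {q} h = ⟨ (λ i → ℤₚ.i-j≡0⇒i≡j _ _ (trans (sym (coeff-- p q i)) (zero⇒coeff h i))) ⟩

  ≐⇒≈P : ∀ {p q} → p ≐ q → p ≈P q
  ≐⇒≈P {p} {q} h = coeff⇒zero (λ i → trans (coeff-- p q i) (ℤₚ.i≡j⇒i-j≡0 (at h i)))

  IsZeroP⇒≐ : ∀ {p} → IsZeroP p → p ≐ []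
  IsZeroP⇒≐ z = ⟨ zero⇒coeff z ⟩

  ≐-refl : ∀ {p} → p ≐ p
  ≐-refl = ⟨ (λ _ → refl) ⟩

  ≐-sym : ∀ {p q} → p ≐ q → q ≐ p
  ≐-sym h = ⟨ (λ i → sym (at h i)) ⟩

  ≐-trans : ∀ {p q r} → p ≐ q → q ≐ r → p ≐ r
  ≐-trans h k = ⟨ (λ i → trans (at h i) (at k i)) ⟩

  ∷-cong : ∀ {a b p q} → a ≡ b → p ≐ q → (a ∷ p) ≐ (b ∷ q)
  ∷-cong e h = ⟨ (λ { zero → e ; (suc i) → at h i }) ⟩

  +P-cong : ∀ {p p′ q q′} → p ≐ p′ → q ≐ q′ → (p +P q) ≐ (p′ +P q′)
  +P-cong {p} {p′} {q} {q′} h k = ⟨ (λ i → trans (coeff-+ p q i)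
    (trans (cong₂ ℤ._+_ (at h i) (at k i)) (sym (coeff-+ p′ q′ i)))) ⟩

  +P-assoc : ∀ p q r → ((p +P q) +P r) ≐ (p +P (q +P r))
  +P-assoc p q r = ⟨ (λ i → trans (trans (coeff-+ (p +P q) r i) (cong (ℤ._+ coeff r i) (coeff-+ p q i)))
    (trans (ℤₚ.+-assoc (coeff p i) _ _)
      (sym (trans (coeff-+ p (q +P r) i) (cong (ℤ._+_ (coeff p i)) (coeff-+ q r i)))))) ⟩

  +P-comm : ∀ p q → (p +P q) ≐ (q +P p)
  +P-comm p q = ⟨ (λ i → trans (coeff-+ p q i) (trans (ℤₚ.+-comm (coeff p i) _) (sym (coeff-+ q p i)))) ⟩

  +P-identityʳ : ∀ p → (p +P []) ≐ p
  +P-identityʳ p = +P-comm p []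

  negP-cong : ∀ {p q} → p ≐ q → negP p ≐ negP q
  negP-cong {p} {q} h = ⟨ (λ i → trans (coeff-neg p i) (trans (cong ℤ.-_ (at h i)) (sym (coeff-neg q i)))) ⟩

  +P-inverseʳ : ∀ p → (p +P negP p) ≐ []
  +P-inverseʳ p = ⟨ (λ i → trans (coeff-- p p i) (ℤₚ.+-inverseʳ (coeff p i))) ⟩

  coeff-*0 : ∀ a p q → coeff ((a ∷ p) *P q) 0 ≡ a ℤ.* coeff q 0
  coeff-*0 a p q = trans (coeff-+ (scale a q) _ 0) (trans (ℤₚ.+-identityʳ _) (coeff-scale a q 0))

  coeff-*s : ∀ a p q i → coeff ((a ∷ p) *P q) (suc i) ≡ a ℤ.* coeff q (suc i) ℤ.+ coeff (p *P q) i
  coeff-*s a p q i = trans (coeff-+ (scale a q) _ (suc i)) (cong (ℤ._+ coeff (p *P q) i) (coeff-scale a q (suc i)))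

  *P-zeroʳ : ∀ p → (p *P []) ≐ []
  *P-zeroʳ []      = ≐-refl
  *P-zeroʳ (a ∷ p) = ⟨ (λ { zero → refl ; (suc i) → at (*P-zeroʳ p) i }) ⟩

  *P-congˡ : ∀ p {q q′} → q ≐ q′ → (p *P q) ≐ (p *P q′)
  *P-congˡ []      h = ≐-refl
  *P-congˡ (a ∷ p) {q} {q′} h = ⟨ (λ
    { zero    → trans (coeff-*0 a p q) (trans (cong (a ℤ.*_) (at h 0)) (sym (coeff-*0 a p q′)))
    ; (suc i) → trans (coeff-*s a p q i) (trans
        (cong₂ (λ x y → a ℤ.* x ℤ.+ y) (at h (suc i)) (at (*P-congˡ p h) i))
        (sym (coeff-*s a p q′ i))) }) ⟩

  -- The product recurses on its left factor; this is the matching recursion on the right one, and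
  -- commutativity follows from the two together.
  *P-consʳ : ∀ p b q → (p *P (b ∷ q)) ≐ (scale b p +P (0ℤ ∷ (p *P q)))
  *P-consʳ []      b q = ⟨ (λ { zero → refl ; (suc i) → refl }) ⟩
  *P-consʳ (a ∷ p) b q = ⟨ (λ
    { zero    → trans (ℤₚ.+-identityʳ _) (trans (ℤₚ.*-comm a b) (sym (ℤₚ.+-identityʳ _)))
    ; (suc i) → trans (coeff-+ (scale a q) (p *P (b ∷ q)) i) (trans
        (cong₂ ℤ._+_ (coeff-scale a q i) (trans (at (*P-consʳ p b q) i)
          (trans (coeff-+ (scale b p) _ i) (cong (ℤ._+ coeff (0ℤ ∷ (p *P q)) i) (coeff-scale b p i)))))
        (trans (swap (a ℤ.* coeff q i) (b ℤ.* coeff p i) (coeff (0ℤ ∷ (p *P q)) i))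
        (sym (trans (coeff-+ (scale b p) _ i)
          (cong₂ ℤ._+_ (coeff-scale b p i)
            (trans (coeff-+ (scale a q) _ i) (cong (ℤ._+ coeff (0ℤ ∷ (p *P q)) i) (coeff-scale a q i)))))))) }) ⟩
    where
    swap : ∀ x y z → x ℤ.+ (y ℤ.+ z) ≡ y ℤ.+ (x ℤ.+ z)
    swap = solveℤ 3 (λ x y z → x :+′ (y :+′ z) :=′ y :+′ (x :+′ z)) refl

  *P-comm : ∀ p q → (p *P q) ≐ (q *P p)
  *P-comm []      q = ≐-sym (*P-zeroʳ q)
  *P-comm (a ∷ p) q = ≐-trans (+P-cong (≐-refl {scale a q}) (∷-cong refl (*P-comm p q))) (≐-sym (*P-consʳ q a p))

  *P-congʳ : ∀ q {p p′} → p ≐ p′ → (p *P q) ≐ (p′ *P q)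
  *P-congʳ q {p} {p′} h = ≐-trans (*P-comm p q) (≐-trans (*P-congˡ q h) (*P-comm q p′))

  *P-cong : ∀ {p p′ q q′} → p ≐ p′ → q ≐ q′ → (p *P q) ≐ (p′ *P q′)
  *P-cong {p} {p′} {q} h k = ≐-trans (*P-congʳ q h) (*P-congˡ p′ k)

  *P-distribˡ : ∀ p q r → (p *P (q +P r)) ≐ ((p *P q) +P (p *P r))
  *P-distribˡ []      q r = ≐-refl
  *P-distribˡ (a ∷ p) q r = ⟨ (λ
    { zero    → trans (coeff-*0 a p (q +P r)) (trans (cong (a ℤ.*_) (coeff-+ q r 0))
        (trans (ℤₚ.*-distribˡ-+ a (coeff q 0) (coeff r 0))
        (sym (trans (coeff-+ ((a ∷ p) *P q) ((a ∷ p) *P r) 0) (cong₂ ℤ._+_ (coeff-*0 a p q) (coeff-*0 a p r))))))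
    ; (suc i) → trans (coeff-*s a p (q +P r) i) (trans
        (cong₂ ℤ._+_ (cong (a ℤ.*_) (coeff-+ q r (suc i)))
                     (trans (at (*P-distribˡ p q r) i) (coeff-+ (p *P q) (p *P r) i)))
        (trans (rearr a (coeff q (suc i)) (coeff r (suc i)) (coeff (p *P q) i) (coeff (p *P r) i))
        (sym (trans (coeff-+ ((a ∷ p) *P q) ((a ∷ p) *P r) (suc i))
          (cong₂ ℤ._+_ (coeff-*s a p q i) (coeff-*s a p r i)))))) }) ⟩
    where
    rearr : ∀ a x y z w → a ℤ.* (x ℤ.+ y) ℤ.+ (z ℤ.+ w) ≡ (a ℤ.* x ℤ.+ z) ℤ.+ (a ℤ.* y ℤ.+ w)
    rearr = solveℤ 5 (λ a x y z w → a :*′ (x :+′ y) :+′ (z :+′ w) :=′ (a :*′ x :+′ z) :+′ (a :*′ y :+′ w)) refl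

  *P-distribʳ : ∀ p q r → ((q +P r) *P p) ≐ ((q *P p) +P (r *P p))
  *P-distribʳ p q r = ≐-trans (*P-comm (q +P r) p)
    (≐-trans (*P-distribˡ p q r) (+P-cong (*P-comm p q) (*P-comm p r)))

  scale-* : ∀ a p q → (scale a p *P q) ≐ scale a (p *P q)
  scale-* a []      q = ≐-refl
  scale-* a (b ∷ p) q = ⟨ (λ
    { zero    → trans (coeff-*0 (a ℤ.* b) (scale a p) q) (trans (ℤₚ.*-assoc a b _)
        (sym (trans (coeff-scale a ((b ∷ p) *P q) 0) (cong (a ℤ.*_) (coeff-*0 b p q)))))
    ; (suc i) → trans (coeff-*s (a ℤ.* b) (scale a p) q i) (trans
        (cong₂ ℤ._+_ (ℤₚ.*-assoc a b (coeff q (suc i))) (trans (at (scale-* a p q) i) (coeff-scale a (p *P q) i)))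
        (trans (sym (ℤₚ.*-distribˡ-+ a (b ℤ.* coeff q (suc i)) (coeff (p *P q) i)))
        (sym (trans (coeff-scale a ((b ∷ p) *P q) (suc i)) (cong (a ℤ.*_) (coeff-*s b p q i)))))) }) ⟩

  shift-* : ∀ p q → ((0ℤ ∷ p) *P q) ≐ (0ℤ ∷ (p *P q))
  shift-* p q = ⟨ (λ
    { zero    → trans (coeff-*0 0ℤ p q) (ℤₚ.*-zeroˡ (coeff q 0))
    ; (suc i) → trans (coeff-*s 0ℤ p q i) (ℤₚ.+-identityˡ _) }) ⟩

  *P-assoc : ∀ p q r → ((p *P q) *P r) ≐ (p *P (q *P r))
  *P-assoc []      q r = ≐-refl
  *P-assoc (a ∷ p) q r = ≐-trans (*P-distribʳ r (scale a q) (0ℤ ∷ (p *P q)))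
    (+P-cong (scale-* a q r) (≐-trans (shift-* (p *P q) r) (∷-cong refl (*P-assoc p q r))))

  scale-1 : ∀ p → scale 1ℤ p ≐ p
  scale-1 p = ⟨ (λ i → trans (coeff-scale 1ℤ p i) (ℤₚ.*-identityˡ _)) ⟩

  *P-identityˡ : ∀ p → (oneP *P p) ≐ p
  *P-identityˡ p = ≐-trans (+P-cong (scale-1 p) (≐-trans {q = []} ⟨ (λ { zero → refl ; (suc i) → refl }) ⟩ ≐-refl))
    (+P-identityʳ p)

  polyRing : CommutativeRing 0ℓ 0ℓ
  polyRing = record
    { Carrier = Poly ; _≈_ = _≐_ ; _+_ = _+P_ ; _*_ = _*P_ ; -_ = negP ; 0# = [] ; 1# = oneP
    ; isCommutativeRing = record
      { isRing = record
        { +-isAbelianGroup = record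
          { isGroup = record
            { isMonoid = record
              { isSemigroup = record
                { isMagma = record
                  { isEquivalence = record { refl = ≐-refl ; sym = ≐-sym ; trans = ≐-trans }
                  ; ∙-cong = +P-cong }
                ; assoc = +P-assoc }
              ; identity = (λ _ → ≐-refl) , +P-identityʳ }
            ; inverse = (λ p → ≐-trans (+P-comm (negP p) p) (+P-inverseʳ p)) , +P-inverseʳ
            ; ⁻¹-cong = negP-cong }
          ; comm = +P-comm }
        ; *-cong = *P-cong
        ; *-assoc = *P-assoc
        ; *-identity = *P-identityˡ , (λ p → ≐-trans (*P-comm p oneP) (*P-identityˡ p))
        ; distrib = *P-distribˡ , *P-distribʳ }
      ; *-comm = *P-comm } }

-- Gauss's lemma and primitive polynomials

module GaussLemma where
  open PolynomialRing
  open ≡ using (refl; sym; trans; cong; subst)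

  open CommutativeRing polyRing using (setoid; *-comm; *-assoc; -‿cong; *-congʳ)
  open IntegerSolver polyRing using (solve; _:=_; _:+_; _:*_; _:-_; :-_)
  open import Relation.Binary.Reasoning.Setoid setoid

  opaque
    const : ℤ → Poly
    const e = e ∷ []

    const-∷ : ∀ e → const e ≐ (e ∷ [])
    const-∷ e = ≐-refl

  const-0 : const 0ℤ ≐ []
  const-0 = ≐-trans (const-∷ 0ℤ) ⟨ (λ { zero → refl ; (suc i) → refl }) ⟩

  const-1 : const 1ℤ ≐ oneP
  const-1 = const-∷ 1ℤ

  const-scale : ∀ e p → (const e *P p) ≐ scale e p
  const-scale e p = ≐-trans (*P-congʳ p (const-∷ e))
    (≐-trans (+P-cong (≐-refl {scale e p}) (≐-trans (≐-sym (const-∷ 0ℤ)) const-0)) (+P-identityʳ (scale e p)))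

  coeff-const : ∀ e p i → coeff (const e *P p) i ≡ e ℤ.* coeff p i
  coeff-const e p i = trans (at (const-scale e p) i) (coeff-scale e p i)

  const-* : ∀ e f → const (e ℤ.* f) ≐ (const e *P const f)
  const-* e f = ≐-trans (const-∷ (e ℤ.* f)) (≐-sym (≐-trans (*P-congˡ (const e) (const-∷ f)) (const-scale e (f ∷ []))))

  const-neg : ∀ e → const (ℤ.- e) ≐ negP (const e)
  const-neg e = ≐-trans (const-∷ (ℤ.- e)) (negP-cong (≐-sym (const-∷ e)))

  const-cong : ∀ {e f} → e ≡ f → const e ≐ const f
  const-cong refl = ≐-refl

  1-* : ∀ p → (const 1ℤ *P p) ≐ p
  1-* p = ≐-trans (*P-congʳ p const-1) (*P-identityˡ p)

  const-≡ : ∀ {e f p} → e ≡ f → (const e *P p) ≐ (const f *P p)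
  const-≡ refl = ≐-refl

  *-nonzero : ∀ {e f} → ¬ e ≡ 0ℤ → ¬ f ≡ 0ℤ → ¬ e ℤ.* f ≡ 0ℤ
  *-nonzero {e} e≢0 f≢0 h = [ e≢0 , f≢0 ]′ (ℤₚ.i*j≡0⇒i≡0∨j≡0 e h)

  -- Gauss's lemma, for an arbitrary prime ideal of coefficients: it is used both
  -- for (k) with k prime and for (0), where it says that ℤ[q] is a domain.
  module Gauss (I : ℤ → Set) (I? : ∀ a → Dec (I a)) (I-0 : I 0ℤ)
               (I-+ : ∀ {a b} → I a → I b → I (a ℤ.+ b))
               (I-* : ∀ a {b} → I b → I (a ℤ.* b))
               (I-prime : ∀ a {b} → I (a ℤ.* b) → I a ⊎ I b) where

    AllI : Poly → Set
    AllI p = ∀ i → I (coeff p i)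

    private
      I-cancel : ∀ {a b} → I a → I (a ℤ.+ b) → I b
      I-cancel {a} {b} x y = subst I
        (trans (cong (ℤ._+ (a ℤ.+ b)) (ℤₚ.-1*i≡-i a)) (trans (sym (ℤₚ.+-assoc (ℤ.- a) a b))
          (trans (cong (ℤ._+ b) (ℤₚ.+-inverseˡ a)) (ℤₚ.+-identityˡ b))))
        (I-+ (I-* (ℤ.- 1ℤ) x) y)

    -- If the lowest coefficient a of p lies in I, then a · r contributes only elements of I and p
    -- can be shortened. If it does not, primality forces the coefficients of r into I one after the
    -- other, from the lowest upwards.
    gauss : ∀ p r → AllI (p *P r) → AllI p ⊎ AllI r
    gauss []      r h = inj₁ (λ _ → I-0)
    gauss (a ∷ p) r h with I? a
    ... | yes Ia = ⊎-map (λ { x zero → Ia ; x (suc i) → x i }) (λ x → x)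
          (gauss p r (λ i → I-cancel {a ℤ.* coeff r (suc i)}
             (subst I (ℤₚ.*-comm (coeff r (suc i)) a) (I-* (coeff r (suc i)) Ia))
             (subst I (coeff-*s a p r i) (h (suc i)))))
    ... | no ¬Ia = inj₂ (low r h)
      where
      low : ∀ r → AllI ((a ∷ p) *P r) → AllI r
      low []      h i = I-0
      low (b ∷ r) h = λ { zero → Ib ; (suc i) → low r rest i }
        where
        Ib : I b
        Ib with I-prime a (subst I (coeff-*0 a p (b ∷ r)) (h 0))
        ... | inj₁ Ia = ⊥-elim (¬Ia Ia)
        ... | inj₂ Ib = Ib
        rest : AllI ((a ∷ p) *P r)
        rest i = I-cancel {b ℤ.* coeff p i}
          (subst I (ℤₚ.*-comm (coeff p i) b) (I-* (coeff p i) Ib))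
          (subst I (trans (at (*P-consʳ (a ∷ p) b r) (suc i))
            (trans (coeff-+ (scale b p) _ i) (cong (ℤ._+ coeff ((a ∷ p) *P r) i) (coeff-scale b p i)))) (h (suc i)))

    AllI-* : ∀ p r → AllI r → AllI (p *P r)
    AllI-* []      r h i       = I-0
    AllI-* (a ∷ p) r h zero    = subst I (sym (coeff-*0 a p r)) (I-* a (h 0))
    AllI-* (a ∷ p) r h (suc i) = subst I (sym (coeff-*s a p r i)) (I-+ (I-* a (h (suc i))) (AllI-* p r h i))

  private
    0-closed-+ : ∀ {a b} → a ≡ 0ℤ → b ≡ 0ℤ → a ℤ.+ b ≡ 0ℤ
    0-closed-+ refl refl = refl

    0-closed-* : ∀ a {b} → b ≡ 0ℤ → a ℤ.* b ≡ 0ℤ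
    0-closed-* a refl = ℤₚ.*-zeroʳ a

  module Zero = Gauss (_≡ 0ℤ) (ℤ._≟ 0ℤ) refl 0-closed-+ 0-closed-* ℤₚ.i*j≡0⇒i≡0∨j≡0

  domain : ∀ p r → (p *P r) ≐ [] → p ≐ [] ⊎ r ≐ []
  domain p r h = ⊎-map ⟨_⟩ ⟨_⟩ (Zero.gauss p r (at h))

  *P-cancelˡ : ∀ p r s → ¬ p ≐ [] → (p *P r) ≐ (p *P s) → r ≐ s
  *P-cancelˡ p r s p≢0 h with domain p (r -P s) (begin
      p *P (r -P s)               ≈⟨ solve 3 (λ p r s → p :* (r :- s) := p :* r :- p :* s) refl p r s ⟩
      p *P r -P p *P s            ≈⟨ +P-cong h ≐-refl ⟩
      p *P s -P p *P s            ≈⟨ +P-inverseʳ (p *P s) ⟩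
      []                          ∎)
  ... | inj₁ z = ⊥-elim (p≢0 z)
  ... | inj₂ z = begin
      r              ≈⟨ solve 2 (λ r s → r := (r :- s) :+ s) refl r s ⟩
      (r -P s) +P s  ≈⟨ +P-cong z ≐-refl ⟩
      s              ∎

  module _ {k} (k-prime : Prime k) where
    private
      prime-∣ : ∀ a {b} → + k ∣ℤ a ℤ.* b → + k ∣ℤ a ⊎ + k ∣ℤ b
      prime-∣ a {b} h = ⊎-map Div.∣ᵤ⇒∣ Div.∣ᵤ⇒∣
        (euclidsLemma ∣ a ∣ ∣ b ∣ k-prime (subst (k ∣ℕ.∣_) (ℤₚ.abs-* a b) (Div.∣⇒∣ᵤ h)))

    module Prime-∣ = Gauss (+ k ∣ℤ_) (+ k ∣ℤ?_) (divides 0ℤ refl) Div.∣m∣n⇒∣m+n Div.∣n⇒∣m*n prime-∣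

  _∣coeffs_ : ℕ → Poly → Set
  k ∣coeffs p = ∀ i → + k ∣ℤ coeff p i

  divideCoeffs : ∀ k p → k ∣coeffs p → ∃[ r ] p ≐ (const (+ k) *P r)
  divideCoeffs k p h = proj₁ (quotients p h) , ⟨ (λ i →
      trans (proj₂ (quotients p h) i) (sym (coeff-const (+ k) (proj₁ (quotients p h)) i))) ⟩
    where
    quotients : ∀ p → k ∣coeffs p → ∃[ r ] (∀ i → coeff p i ≡ + k ℤ.* coeff r i)
    quotients []      h = [] , λ i → sym (ℤₚ.*-zeroʳ (+ k))
    quotients (a ∷ p) h with h 0 | quotients p (λ i → h (suc i))
    ... | divides b e | r , es = b ∷ r , λ { zero → trans e (ℤₚ.*-comm b (+ k)) ; (suc i) → es i }

  ∣coeffs-const : ∀ k p {r} → r ≐ (const (+ k) *P p) → k ∣coeffs r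
  ∣coeffs-const k p h i = divides (coeff p i) (trans (at h i) (trans (coeff-const (+ k) p i) (ℤₚ.*-comm (+ k) (coeff p i))))

  -- Content 1, expressed through primes so that Gauss's lemma for the ideals (k) applies directly;
  -- the zero polynomial is excluded as well.
  Primitive : Poly → Set
  Primitive p = ∀ {k} → Prime k → ¬ k ∣coeffs p

  primitive-≐ : ∀ {p r} → p ≐ r → Primitive p → Primitive r
  primitive-≐ h P kp d = P kp (λ i → subst (_ ∣ℤ_) (sym (at h i)) (d i))

  primitive-* : ∀ p r → Primitive p → Primitive r → Primitive (p *P r)
  primitive-* p r P R kp d = [ P kp , R kp ]′ (Prime-∣.gauss kp p r d)

  primitive-divʳ : ∀ p r → Primitive (p *P r) → Primitive r
  primitive-divʳ p r PR kp d = PR kp (Prime-∣.AllI-* kp p r d)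

  primitive-divˡ : ∀ p r → Primitive (p *P r) → Primitive p
  primitive-divˡ p r PR = primitive-divʳ r p (primitive-≐ (*-comm p r) PR)

  prime∤1 : ∀ {k} → Prime k → ¬ + k ∣ℤ 1ℤ
  prime∤1 {k} kp d with ∣ℕ.∣1⇒≡1 (Div.∣⇒∣ᵤ d) | prime⇒nonTrivial kp
  ... | refl | ()

  primitive-coeff : ∀ p i → coeff p i ℤ.* coeff p i ≡ 1ℤ → Primitive p
  primitive-coeff p i e {k} kp d = prime∤1 kp (subst (+ k ∣ℤ_) e (Div.∣n⇒∣m*n (coeff p i) (d i)))

  primitive⇒≢0 : ∀ {p} → Primitive p → ¬ p ≐ []
  primitive⇒≢0 P z = P prime[2] (λ i → divides 0ℤ (at z i))

  const≢0 : ∀ {e} → ¬ e ≡ 0ℤ → ¬ const e ≐ []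
  const≢0 {e} e≢0 h = e≢0 (at (≐-trans (≐-sym (const-∷ e)) h) 0)

  infix 4 _∣̂_
  _∣̂_ : Poly → Poly → Set
  c ∣̂ p = ∃[ r ] p ≐ (c *P r)

  primes≢0 : ∀ {k} → Prime k → ¬ const (+ k) ≐ []
  primes≢0 {k} kp h with at (≐-trans (≐-sym (const-∷ (+ k))) h) 0 | prime⇒nonTrivial kp
  ... | refl | ()

  abs-factors : ∀ e → ¬ e ≡ 0ℤ → ∃[ ks ] All Prime ks × ∣ e ∣ ≡ product ks
  abs-factors e e≢0 = factors , factorsPrime , isFactorisation
    where
    instance _ = ℕ.≢-nonZero {∣ e ∣} (λ h → e≢0 (ℤₚ.∣i∣≡0⇒i≡0 h))
    open PrimeFactorisation (factorise ∣ e ∣)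

  data SignedAbs (e : ℤ) : Set where
    pos : e ≡ + ∣ e ∣ → SignedAbs e
    neg : e ≡ ℤ.- (+ ∣ e ∣) → SignedAbs e

  signedAbs : ∀ e → SignedAbs e
  signedAbs (+ n)    = pos refl
  signedAbs -[1+ n ] = neg refl

  neg-scale : ∀ {e n} p → e ≡ ℤ.- n → (const n *P p) ≐ negP (const e *P p)
  neg-scale {_} {n} p refl = begin
    const n *P p                     ≈⟨ solve 2 (λ k p → k :* p := :- (:- k :* p)) refl (const n) p ⟩
    negP (negP (const n) *P p)       ≈⟨ -‿cong (*P-congʳ p (const-neg n)) ⟨
    negP (const (ℤ.- n) *P p)        ∎

  const-const : ∀ e f {p r s} → p ≐ (const e *P r) → r ≐ (const f *P s) → p ≐ (const (e ℤ.* f) *P s)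
  const-const e f {p} {r} {s} h h′ = begin
    p                            ≈⟨ h ⟩
    const e *P r                 ≈⟨ *P-congˡ (const e) h′ ⟩
    const e *P (const f *P s)    ≈⟨ *P-assoc (const e) (const f) s ⟨
    const e *P const f *P s      ≈⟨ *P-congʳ s (const-* e f) ⟨
    const (e ℤ.* f) *P s         ∎

  const-product : ∀ k n p → (const (+ (k ℕ.* n)) *P p) ≐ (const (+ k) *P (const (+ n) *P p))
  const-product k n p = ≐-trans (const-≡ (ℤₚ.pos-* k n)) (≐-sym (const-const (+ k) (+ n) ≐-refl ≐-refl))

  -- For primitive P, divisibility over ℚ is divisibility over ℤ: each prime factor of the constant
  -- divides P Y, hence Y by Gauss's lemma, and cancels.
  primitive-∣-product : ∀ {ks} → All Prime ks → ∀ P Y N → Primitive P →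
                        (const (+ product ks) *P N) ≐ (P *P Y) → P ∣̂ N
  primitive-∣-product [] P Y N pr h = Y , ≐-trans (≐-sym (1-* N)) h
  primitive-∣-product {k ∷ ks} (kp ∷ kps) P Y N pr h
    with Prime-∣.gauss kp P Y (∣coeffs-const k (const (+ product ks) *P N)
           (≐-trans (≐-sym h) (const-product k (product ks) N)))
  ... | inj₁ d = ⊥-elim (pr kp d)
  ... | inj₂ d with divideCoeffs k Y d
  ...   | Y′ , e = primitive-∣-product kps P Y′ N pr (*P-cancelˡ (const (+ k)) _ _ (primes≢0 kp) (begin
      const (+ k) *P (const (+ product ks) *P N)  ≈⟨ const-product k (product ks) N ⟨
      const (+ product (k ∷ ks)) *P N             ≈⟨ h ⟩
      P *P Y                                      ≈⟨ *P-congˡ P e ⟩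
      P *P (const (+ k) *P Y′)                    ≈⟨ solve 3 (λ P k Y → P :* (k :* Y) := k :* (P :* Y)) refl P (const (+ k)) Y′ ⟩
      const (+ k) *P (P *P Y′)                    ∎))

  primitive-∣-const : ∀ e → ¬ e ≡ 0ℤ → ∀ P Y N → Primitive P → (const e *P N) ≐ (P *P Y) → P ∣̂ N
  primitive-∣-const e e≢0 P Y N pr h with abs-factors e e≢0 | signedAbs e
  ... | ks , kps , f | pos s = primitive-∣-product kps P Y N pr
        (≐-trans (const-≡ (sym (trans s (cong +_ f)))) h)
  ... | ks , kps , f | neg s = primitive-∣-product kps P (negP Y) N pr (begin
      const (+ product ks) *P N       ≈⟨ neg-scale N (trans s (cong (λ n → ℤ.- (+ n)) f)) ⟩
      negP (const e *P N)             ≈⟨ -‿cong h ⟩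
      negP (P *P Y)                   ≈⟨ solve 2 (λ P Y → :- (P :* Y) := P :* :- Y) refl P Y ⟩
      P *P negP Y                     ∎)

  -- An equation a B = G D over ℤ freed of its constant a: each prime factor of a divides G or D and
  -- is removed there, so that `g` and `d` collect these factors.
  record Split (B G D : Poly) : Set where
    field
      {G′ D′}  : Poly
      {g d}    : ℤ
      g≢0      : ¬ g ≡ 0ℤ
      G≐       : G ≐ (const g *P G′)
      D≐       : D ≐ (const d *P D′)
      B≐       : B ≐ (G′ *P D′)

  split-product : ∀ {ks} → All Prime ks → ∀ B G D → (const (+ product ks) *P B) ≐ (G *P D) → Split B G D
  split-product [] B G D h = record
    { g = 1ℤ ; d = 1ℤ ; g≢0 = λ () ; G≐ = ≐-sym (1-* G) ; D≐ = ≐-sym (1-* D)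
    ; B≐ = ≐-trans (≐-sym (1-* B)) h }
  split-product {k ∷ ks} (kp ∷ kps) B G D h
    with Prime-∣.gauss kp G D (∣coeffs-const k (const (+ product ks) *P B)
           (≐-trans (≐-sym h) (const-product k (product ks) B)))
  ... | inj₁ x = record
      { g = + k ℤ.* g ; d = d ; g≢0 = *-nonzero {+ k} (λ z → primes≢0 kp (≐-trans (const-cong z) const-0)) g≢0
      ; G≐ = const-const (+ k) g G₁≐ G≐
      ; D≐ = D≐ ; B≐ = B≐ }
    where
    G₁  = proj₁ (divideCoeffs k G x)
    G₁≐ = proj₂ (divideCoeffs k G x)
    open Split (split-product kps B G₁ D (*P-cancelˡ (const (+ k)) _ _ (primes≢0 kp) (begin
      const (+ k) *P (const (+ product ks) *P B)  ≈⟨ const-product k (product ks) B ⟨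
      const (+ product (k ∷ ks)) *P B             ≈⟨ h ⟩
      G *P D                                      ≈⟨ *-congʳ G₁≐ ⟩
      const (+ k) *P G₁ *P D                      ≈⟨ *-assoc (const (+ k)) G₁ D ⟩
      const (+ k) *P (G₁ *P D)                    ∎)))
  ... | inj₂ x = record
      { g = g ; d = + k ℤ.* d ; g≢0 = g≢0
      ; D≐ = const-const (+ k) d D₁≐ D≐
      ; G≐ = G≐ ; B≐ = B≐ }
    where
    D₁  = proj₁ (divideCoeffs k D x)
    D₁≐ = proj₂ (divideCoeffs k D x)
    open Split (split-product kps B G D₁ (*P-cancelˡ (const (+ k)) _ _ (primes≢0 kp) (begin
      const (+ k) *P (const (+ product ks) *P B)  ≈⟨ const-product k (product ks) B ⟨
      const (+ product (k ∷ ks)) *P B             ≈⟨ h ⟩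
      G *P D                                      ≈⟨ *P-congˡ G D₁≐ ⟩
      G *P (const (+ k) *P D₁)                    ≈⟨ solve 3 (λ G k D → G :* (k :* D) := k :* (G :* D)) refl G (const (+ k)) D₁ ⟩
      const (+ k) *P (G *P D₁)                    ∎)))

  split : ∀ a → ¬ a ≡ 0ℤ → ∀ B G D → (const a *P B) ≐ (G *P D) → Split B G D
  split a a≢0 B G D h with abs-factors a a≢0 | signedAbs a
  ... | ks , kps , f | pos s = split-product kps B G D
        (≐-trans (const-≡ (sym (trans s (cong +_ f)))) h)
  ... | ks , kps , f | neg s = record
      { g = ℤ.- g ; g≢0 = λ z → g≢0 (trans (sym (ℤₚ.neg-involutive g)) (cong ℤ.-_ z)) ; D≐ = D≐ ; B≐ = B≐
      ; G≐ = begin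
          G                          ≈⟨ solve 1 (λ G → G := :- (:- G)) refl G ⟩
          negP (negP G)              ≈⟨ -‿cong G≐ ⟩
          negP (const g *P G′)       ≈⟨ solve 2 (λ g G → :- (g :* G) := :- g :* G) refl (const g) G′ ⟩
          negP (const g) *P G′       ≈⟨ *P-congʳ G′ (const-neg g) ⟨
          const (ℤ.- g) *P G′        ∎ }
    where
    open Split (split-product kps B (negP G) D (begin
      const (+ product ks) *P B       ≈⟨ neg-scale B (trans s (cong (λ n → ℤ.- (+ n)) f)) ⟩
      negP (const a *P B)             ≈⟨ -‿cong h ⟩
      negP (G *P D)                   ≈⟨ solve 2 (λ P Y → :- (P :* Y) := :- P :* Y) refl G D ⟩
      negP G *P D                     ∎))

-- Coprimality over ℚ and reduced fractions over ℤ[q]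

module ReducedForms where
  open PolynomialRing
  open GaussLemma
  open ≡ using (refl; sym; trans; cong; cong₂; subst)

  open CommutativeRing polyRing using (setoid)
  open IntegerSolver polyRing using (solve; _:=_; _:+_; _:*_; _:-_; :-_)
  open import Relation.Binary.Reasoning.Setoid setoid

  -- coprimality over ℚ, with cleared denominators
  record Cop (A B : Poly) : Set where
    constructor cop
    field
      {u v}  : Poly
      {e}    : ℤ
      e≢0    : ¬ e ≡ 0ℤ
      bézout : (u *P A +P v *P B) ≐ const e

  Cop-sym : ∀ {A B} → Cop A B → Cop B A
  Cop-sym (cop {u} {v} e≢0 h) = cop {u = v} {v = u} e≢0 (≐-trans (+P-comm (v *P _) (u *P _)) h)

  Cop-resp : ∀ {A A′ B B′} → A ≐ A′ → B ≐ B′ → Cop A B → Cop A′ B′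
  Cop-resp h k (cop {u} {v} e≢0 b) =
    cop {u = u} {v = v} e≢0 (≐-trans (+P-cong (*P-congˡ u (≐-sym h)) (*P-congˡ v (≐-sym k))) b)

  Cop-*ʳ : ∀ {A B C} → Cop A B → Cop A C → Cop A (B *P C)
  Cop-*ʳ {A} {B} {C} (cop {u} {v} {e} e≢0 h) (cop {u′} {v′} {e′} e′≢0 h′) = cop {u = u *P u′ *P A +P u *P v′ *P C +P v *P u′ *P B} {v = v *P v′} (*-nonzero e≢0 e′≢0) (begin
    (u *P u′ *P A +P u *P v′ *P C +P v *P u′ *P B) *P A +P v *P v′ *P (B *P C)
      ≈⟨ solve 7 (λ A B C u v u′ v′ → (u :* u′ :* A :+ u :* v′ :* C :+ v :* u′ :* B) :* A :+ v :* v′ :* (B :* C)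
                                    := (u :* A :+ v :* B) :* (u′ :* A :+ v′ :* C)) refl A B C u v u′ v′ ⟩
    (u *P A +P v *P B) *P (u′ *P A +P v′ *P C)  ≈⟨ *P-cong h h′ ⟩
    const e *P const e′                         ≈⟨ const-* e e′ ⟨
    const (e ℤ.* e′)                            ∎)

  Cop-*ˡ : ∀ {A B C} → Cop A C → Cop B C → Cop (A *P B) C
  Cop-*ˡ h k = Cop-sym (Cop-*ʳ (Cop-sym h) (Cop-sym k))

  Cop-divʳ : ∀ {A B} C → Cop A (C *P B) → Cop A B
  Cop-divʳ {A} {B} C (cop {u} {v} e≢0 h) =
    cop {u = u} {v = v *P C} e≢0 (≐-trans (solve 5 (λ A B C u v → u :* A :+ v :* C :* B := u :* A :+ v :* (C :* B)) refl A B C u v) h)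

  Cop-+ˡ : ∀ {A B} C → Cop A B → Cop (A +P C *P B) B
  Cop-+ˡ {A} {B} C (cop {u} {v} e≢0 h) = cop {u = u} {v = v -P u *P C} e≢0
    (≐-trans (solve 5 (λ A B C u v → u :* (A :+ C :* B) :+ (v :- u :* C) :* B := u :* A :+ v :* B) refl A B C u v) h)

  Cop-unit : ∀ {A} u {e} → ¬ e ≡ 0ℤ → (u *P A) ≐ const e → ∀ {B} → Cop A B
  Cop-unit {A} u e≢0 h {B} = cop {u = u} {v = []} e≢0 (≐-trans (+P-identityʳ (u *P A)) h)

  Cop-const : ∀ {e} → ¬ e ≡ 0ℤ → ∀ {B} → Cop (const e) B
  Cop-const e≢0 = Cop-unit oneP e≢0 (*P-identityˡ _)

  X : Poly
  X = 0ℤ ∷ 1ℤ ∷ []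

  X-* : ∀ p → (X *P p) ≐ (0ℤ ∷ p)
  X-* p = ≐-trans (shift-* oneP p) (∷-cong refl (*P-identityˡ p))

  ∷-split : ∀ a p → (a ∷ p) ≐ (const a +P X *P p)
  ∷-split a p = ≐-sym (≐-trans (+P-cong (const-∷ a) (X-* p)) (∷-cong (ℤₚ.+-identityʳ a) ≐-refl))

  Cop-X : ∀ A → ¬ coeff A 0 ≡ 0ℤ → Cop X A
  Cop-X []      a≢0 = ⊥-elim (a≢0 refl)
  Cop-X (a ∷ p) a≢0 = cop {u = negP p} {v = oneP} {e = a} a≢0 (begin
    negP p *P X +P oneP *P (a ∷ p)            ≈⟨ +P-cong ≐-refl (≐-trans (*P-identityˡ (a ∷ p)) (∷-split a p)) ⟩
    negP p *P X +P (const a +P X *P p)        ≈⟨ solve 3 (λ p x a → :- p :* x :+ (a :+ x :* p) := a) refl p X (const a) ⟩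
    const a                                   ∎)

  coeff-*₀ : ∀ p r → coeff (p *P r) 0 ≡ coeff p 0 ℤ.* coeff r 0
  coeff-*₀ []      r = refl
  coeff-*₀ (a ∷ p) r = coeff-*0 a p r

  -- Here G is a greatest common divisor over ℚ; the integer a clears the denominators of the
  -- cofactors.
  record Reduction (A B : Poly) : Set where
    field
      {G N D} : Poly
      {a}     : ℤ
      a≢0     : ¬ a ≡ 0ℤ
      A≐      : (const a *P A) ≐ (G *P N)
      B≐      : (const a *P B) ≐ (G *P D)
      coprime : Cop N D

  Reduction-sym : ∀ {A B} → Reduction A B → Reduction B A
  Reduction-sym r = record { G = G ; N = D ; D = N ; a = a ; a≢0 = a≢0 ; A≐ = B≐ ; B≐ = A≐ ; coprime = Cop-sym coprime }
    where open Reduction r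

  -- The elimination runs from the constant terms upwards, which needs no degrees:
  -- if b ≠ 0 is the constant term of B then b A − a B is divisible by X, and X is prime to B.
  eliminate : ∀ {A B C} a → ¬ coeff B 0 ≡ 0ℤ →
              (X *P C) ≐ (const (coeff B 0) *P A -P const a *P B) → Reduction C B → Reduction A B
  eliminate {A} {B} {C} a b≢0 h r = record
    { G = G ; N = X *P N +P const a *P D ; D = const b *P D ; a = α ℤ.* b
    ; a≢0 = *-nonzero a≢0 b≢0
    ; A≐ = begin
        const (α ℤ.* b) *P A                          ≈⟨ *P-congʳ A (const-* α b) ⟩
        const α *P const b *P A                       ≈⟨ solve 5 (λ α a b A B → α :* b :* A := α :* (b :* A :- a :* B) :+ a :* (α :* B)) refl (const α) (const a) (const b) A B ⟩
        const α *P (const b *P A -P const a *P B) +P const a *P (const α *P B)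
                                                      ≈⟨ +P-cong (*P-congˡ (const α) (≐-sym h)) (*P-congˡ (const a) B≐) ⟩
        const α *P (X *P C) +P const a *P (G *P D)    ≈⟨ solve 6 (λ α a x C G D → α :* (x :* C) :+ a :* (G :* D) := x :* (α :* C) :+ a :* (G :* D)) refl (const α) (const a) X C G D ⟩
        X *P (const α *P C) +P const a *P (G *P D)    ≈⟨ +P-cong (*P-congˡ X A≐) ≐-refl ⟩
        X *P (G *P N) +P const a *P (G *P D)          ≈⟨ solve 5 (λ x G N a D → x :* (G :* N) :+ a :* (G :* D) := G :* (x :* N :+ a :* D)) refl X G N (const a) D ⟩
        G *P (X *P N +P const a *P D)                 ∎
    ; B≐ = begin
        const (α ℤ.* b) *P B         ≈⟨ *P-congʳ B (const-* α b) ⟩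
        const α *P const b *P B      ≈⟨ solve 3 (λ α b B → α :* b :* B := b :* (α :* B)) refl (const α) (const b) B ⟩
        const b *P (const α *P B)    ≈⟨ *P-congˡ (const b) B≐ ⟩
        const b *P (G *P D)          ≈⟨ solve 3 (λ b G D → b :* (G :* D) := G :* (b :* D)) refl (const b) G D ⟩
        G *P (const b *P D)          ∎
    -- Adding a multiple of D to X N preserves coprimality to D, and X is prime to D because the
    -- constant term of D is nonzero: multiplied by that of G it gives α b.
    ; coprime = Cop-*ʳ (Cop-sym (Cop-const b≢0)) (Cop-+ˡ (const a) (Cop-*ˡ (Cop-X D D₀≢0) coprime))
    }
    where
    open Reduction r renaming (a to α)
    b = coeff B 0
    D₀≢0 : ¬ coeff D 0 ≡ 0ℤ
    D₀≢0 z = *-nonzero a≢0 b≢0 (trans (sym (coeff-const α B 0)) (trans (at B≐ 0)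
      (trans (coeff-*₀ G D) (trans (cong (coeff G 0 ℤ.*_) z) (ℤₚ.*-zeroʳ (coeff G 0))))))

  tailDiff : ∀ a A b B → (X *P (scale b A -P scale a B)) ≐ (const b *P (a ∷ A) -P const a *P (b ∷ B))
  tailDiff a A b B = begin
    X *P (scale b A -P scale a B)                     ≈⟨ *P-congˡ X (+P-cong (≐-sym (const-scale b A)) (negP-cong (≐-sym (const-scale a B)))) ⟩
    X *P (const b *P A -P const a *P B)               ≈⟨ solve 5 (λ x a b A B → x :* (b :* A :- a :* B) := b :* (a :+ x :* A) :- a :* (b :+ x :* B)) refl X (const a) (const b) A B ⟩
    const b *P (const a +P X *P A) -P const a *P (const b +P X *P B)
      ≈⟨ +P-cong (*P-congˡ (const b) (≐-sym (∷-split a A))) (negP-cong (*P-congˡ (const a) (≐-sym (∷-split b B)))) ⟩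
    const b *P (a ∷ A) -P const a *P (b ∷ B)          ∎

  length-+P : ∀ p r → length (p +P r) ≡ length p ℕ.⊔ length r
  length-+P []      r       = refl
  length-+P (a ∷ p) []      = refl
  length-+P (a ∷ p) (b ∷ r) = cong suc (length-+P p r)

  length-tailDiff : ∀ a A b B → length B ℕ.≤ length A → length (scale b A -P scale a B) ≡ length A
  length-tailDiff a A b B le = trans (length-+P (scale b A) (negP (scale a B)))
    (trans (cong₂ ℕ._⊔_ (length-map _ A) (trans (length-map _ (scale a B)) (length-map _ B))) (ℕₚ.m≥n⇒m⊔n≡m le))
    where open import Data.List.Properties using (length-map)

  -- The measure is the sum of the list lengths, which survives trailing zeros. Killing a constant
  -- term and dividing by X shortens one list by one, provided that with two nonzero constant terms
  -- the longer list is the one replaced. If both constant terms vanish, X goes into the common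
  -- divisor.
  reduction : ∀ n A B → length A ℕ.+ length B ℕ.≤ n → Reduction A B
  reduction n [] B le = record
    { G = B ; N = [] ; D = oneP ; a = 1ℤ ; a≢0 = λ () ; A≐ = ≐-trans (*P-zeroʳ (const 1ℤ)) (≐-sym (*P-zeroʳ B))
    ; B≐ = ≐-trans (1-* B) (≐-trans (≐-sym (*P-identityˡ B)) (*P-comm oneP B))
    ; coprime = Cop-sym (Cop-resp const-1 ≐-refl (Cop-const (λ ()))) }
  reduction n (a ∷ A) [] le = record
    { G = a ∷ A ; N = oneP ; D = [] ; a = 1ℤ ; a≢0 = λ () ; B≐ = ≐-trans (*P-zeroʳ (const 1ℤ)) (≐-sym (*P-zeroʳ (a ∷ A)))
    ; A≐ = ≐-trans (1-* (a ∷ A)) (≐-trans (≐-sym (*P-identityˡ (a ∷ A))) (*P-comm oneP (a ∷ A)))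
    ; coprime = Cop-resp const-1 ≐-refl (Cop-const (λ ())) }
  reduction (suc n) (a ∷ A) (b ∷ B) (ℕ.s≤s le) with b ℤ.≟ 0ℤ | a ℤ.≟ 0ℤ | ℕₚ.≤-total (length B) (length A)
  ... | yes refl | yes refl | _ = record
    { G = X *P G ; N = N ; D = D ; a = α ; a≢0 = a≢0 ; A≐ = times-X A N A≐ ; B≐ = times-X B D B≐ ; coprime = coprime }
    where
    open Reduction (reduction n A B (ℕₚ.≤-trans (ℕₚ.+-monoʳ-≤ (length A) (ℕₚ.n≤1+n (length B))) le)) renaming (a to α)
    times-X : ∀ C M → (const α *P C) ≐ (G *P M) → (const α *P (0ℤ ∷ C)) ≐ (X *P G *P M)
    times-X C M h = begin
      const α *P (0ℤ ∷ C)        ≈⟨ *P-congˡ (const α) (≐-sym (X-* C)) ⟩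
      const α *P (X *P C)        ≈⟨ solve 3 (λ α x C → α :* (x :* C) := x :* (α :* C)) refl (const α) X C ⟩
      X *P (const α *P C)        ≈⟨ *P-congˡ X h ⟩
      X *P (G *P M)              ≈⟨ *P-assoc X G M ⟨
      X *P G *P M                ∎
  ... | no b≢0 | yes refl | _ = eliminate {A = 0ℤ ∷ A} {b ∷ B} {scale b A} 0ℤ b≢0
      (begin
        X *P scale b A                      ≈⟨ *P-congˡ X (≐-sym (const-scale b A)) ⟩
        X *P (const b *P A)                 ≈⟨ solve 3 (λ x b A → x :* (b :* A) := b :* (x :* A)) refl X (const b) A ⟩
        const b *P (X *P A)                 ≈⟨ *P-congˡ (const b) (X-* A) ⟩
        const b *P (0ℤ ∷ A)                 ≈⟨ +P-identityʳ _ ⟨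
        const b *P (0ℤ ∷ A) +P []           ≈⟨ +P-cong ≐-refl (negP-cong (*P-congʳ (b ∷ B) const-0)) ⟨
        const b *P (0ℤ ∷ A) -P const 0ℤ *P (b ∷ B)  ∎)
      (reduction n (scale b A) (b ∷ B) (ℕₚ.≤-trans (ℕₚ.≤-reflexive (cong (ℕ._+ suc (length B)) (length-map _ A))) le))
    where open import Data.List.Properties using (length-map)
  ... | yes refl | no a≢0 | _ = Reduction-sym (eliminate {A = 0ℤ ∷ B} {a ∷ A} {scale a B} 0ℤ a≢0
      (begin
        X *P scale a B                      ≈⟨ *P-congˡ X (≐-sym (const-scale a B)) ⟩
        X *P (const a *P B)                 ≈⟨ solve 3 (λ x b A → x :* (b :* A) := b :* (x :* A)) refl X (const a) B ⟩
        const a *P (X *P B)                 ≈⟨ *P-congˡ (const a) (X-* B) ⟩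
        const a *P (0ℤ ∷ B)                 ≈⟨ +P-identityʳ _ ⟨
        const a *P (0ℤ ∷ B) +P []           ≈⟨ +P-cong ≐-refl (negP-cong (*P-congʳ (a ∷ A) const-0)) ⟨
        const a *P (0ℤ ∷ B) -P const 0ℤ *P (a ∷ A)  ∎)
      (reduction n (scale a B) (a ∷ A) (ℕₚ.≤-trans (ℕₚ.≤-reflexive (trans (cong (ℕ._+ suc (length A)) (length-map _ B)) (trans (ℕₚ.+-suc (length B) (length A)) (trans (cong suc (ℕₚ.+-comm (length B) (length A))) (sym (ℕₚ.+-suc (length A) (length B))))))) le)))
    where open import Data.List.Properties using (length-map)
  ... | no b≢0 | no a≢0 | inj₁ B≤A = eliminate {A = a ∷ A} {b ∷ B} {scale b A -P scale a B} a b≢0 (tailDiff a A b B)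
      (reduction n _ (b ∷ B) (ℕₚ.≤-trans (ℕₚ.≤-reflexive (cong (ℕ._+ suc (length B)) (length-tailDiff a A b B B≤A))) le))
  ... | no b≢0 | no a≢0 | inj₂ A≤B = Reduction-sym (eliminate {A = b ∷ B} {a ∷ A} {scale a B -P scale b A} b a≢0 (tailDiff b B a A)
      (reduction n _ (a ∷ A) (ℕₚ.≤-trans (ℕₚ.≤-reflexive (trans (cong (ℕ._+ suc (length A)) (length-tailDiff b B a A A≤B)) (trans (ℕₚ.+-suc (length B) (length A)) (trans (cong suc (ℕₚ.+-comm (length B) (length A))) (sym (ℕₚ.+-suc (length A) (length B))))))) le)))

  -- Exposes the leading coefficient, which a list with trailing zeros hides.
  trimmed : ∀ p → p ≐ [] ⊎ (∃[ s ] ∃[ a ] ¬ a ≡ 0ℤ × p ≐ (s ++ a ∷ []))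
  trimmed []      = inj₁ ≐-refl
  trimmed (a ∷ p) with trimmed p | a ℤ.≟ 0ℤ
  ... | inj₂ (s , b , b≢0 , h) | _        = inj₂ (a ∷ s , b , b≢0 , ∷-cong refl h)
  ... | inj₁ z                 | yes refl = inj₁ (≐-trans (∷-cong refl z) (≐-trans (≐-sym (const-∷ 0ℤ)) const-0))
  ... | inj₁ z                 | no a≢0   = inj₂ ([] , a , a≢0 , ∷-cong refl z)

  coeff-beyond : ∀ s a i → coeff (s ++ a ∷ []) (suc (length s ℕ.+ i)) ≡ 0ℤ
  coeff-beyond []      a i = refl
  coeff-beyond (x ∷ s) a i = coeff-beyond s a i

  coeff-last : ∀ s a → coeff (s ++ a ∷ []) (length s) ≡ a
  coeff-last []      a = refl
  coeff-last (x ∷ s) a = coeff-last s a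

  coeff-lead : ∀ s a t b → coeff ((s ++ a ∷ []) *P (t ++ b ∷ [])) (length s ℕ.+ length t) ≡ a ℤ.* b
  coeff-lead []      a t b = trans (at (≐-trans (*P-congʳ (t ++ b ∷ []) (≐-sym (const-∷ a))) (const-scale a (t ++ b ∷ []))) (length t))
    (trans (coeff-scale a (t ++ b ∷ []) (length t)) (cong (a ℤ.*_) (coeff-last t b)))
  coeff-lead (x ∷ s) a t b = trans (coeff-*s x (s ++ a ∷ []) (t ++ b ∷ []) (length s ℕ.+ length t))
    (trans (cong₂ ℤ._+_ (trans (cong (x ℤ.*_) (trans (cong (λ i → coeff (t ++ b ∷ []) (suc i)) (ℕₚ.+-comm (length s) (length t))) (coeff-beyond t b (length s)))) (ℤₚ.*-zeroʳ x)) (coeff-lead s a t b))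
      (ℤₚ.+-identityˡ _))

  -- If c had positive degree, the product of the two leading coefficients would be a nonzero
  -- coefficient of the constant at a positive index.
  const-divisor : ∀ c r {e} → ¬ e ≡ 0ℤ → (c *P r) ≐ const e → ∃[ k ] c ≐ const k
  const-divisor c r {e} e≢0 h with trimmed c | trimmed r
  ... | inj₁ z | _ = ⊥-elim (const≢0 e≢0 (≐-trans (≐-sym h) (*P-congʳ r z)))
  ... | inj₂ _ | inj₁ z = ⊥-elim (const≢0 e≢0 (≐-trans (≐-sym h) (≐-trans (*P-congˡ c z) (*P-zeroʳ c))))
  ... | inj₂ ([] , a , a≢0 , hc) | inj₂ _ = a , ≐-trans hc (≐-sym (const-∷ a))
  ... | inj₂ (x ∷ s , a , a≢0 , hc) | inj₂ (t , b , b≢0 , hr) = ⊥-elim (*-nonzero a≢0 b≢0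
    (trans (sym (coeff-lead (x ∷ s) a t b))
      (at (≐-trans (*P-cong (≐-sym hc) (≐-sym hr)) (≐-trans h (const-∷ e))) (suc (length s ℕ.+ length t)))))

  primitive-const⇒unit : ∀ k → Primitive (const k) → ∣ k ∣ ≡ 1
  primitive-const⇒unit k pr with abs-factors k (λ z → primitive⇒≢0 pr (≐-trans (const-cong z) const-0))
  ... | []     , []        , e = e
  ... | p ∷ ps , pp ∷ _    , e = ⊥-elim (pr pp λ i → Div.∣ᵤ⇒∣ (go i))
    where
    open import Data.Nat.Divisibility using (_∣_; m∣m*n; _∣0)
    go : ∀ i → p ∣ ∣ coeff (const k) i ∣
    go zero    = subst (p ∣_) (trans (sym e) (cong ∣_∣ (sym (at (const-∷ k) 0)))) (m∣m*n (product ps))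
    go (suc i) = subst (p ∣_) (cong ∣_∣ (sym (at (const-∷ k) (suc i)))) (p ∣0)

  const-unit : ∀ {c} k → ∣ k ∣ ≡ 1 → c ≐ const k → IsUnitP c
  const-unit (+ .1)      refl h = inj₁ (≐⇒≈P (≐-trans h const-1))
  const-unit -[1+ .0 ]   refl h = inj₂ (≐⇒≈P (≐-trans h (const-∷ -[1+ 0 ])))

  record ReducedForm (A B : Poly) : Set where
    field
      {N D}   : Poly
      D≢0     : ¬ D ≐ []
      ratio   : (A *P D) ≐ (N *P B)
      coprime : CoprimeP N D

  private
    module Reduce {A B} (B-prim : Primitive B) (red : Reduction A B)
                  (sp : Split B (Reduction.G red) (Reduction.D red)) where
      open Reduction red
      open Split sp renaming (B≐ to B≐G′D′)
      G′-prim : Primitive G′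
      G′-prim = primitive-divˡ G′ D′ (primitive-≐ B≐G′D′ B-prim)
      D′-prim : Primitive D′
      D′-prim = primitive-divʳ G′ D′ (primitive-≐ B≐G′D′ B-prim)
      aA≐ : (const a *P A) ≐ (G′ *P (const g *P N))
      aA≐ = begin
        const a *P A              ≈⟨ A≐ ⟩
        G *P N                    ≈⟨ *P-congʳ N G≐ ⟩
        const g *P G′ *P N        ≈⟨ solve 3 (λ g G N → g :* G :* N := G :* (g :* N)) refl (const g) G′ N ⟩
        G′ *P (const g *P N)      ∎
      module _ {Q} (A≐Q : A ≐ (G′ *P Q)) where
        aQ≐gN : (const a *P Q) ≐ (const g *P N)
        aQ≐gN = *P-cancelˡ G′ _ _ (primitive⇒≢0 G′-prim) (begin
          G′ *P (const a *P Q)     ≈⟨ solve 3 (λ G a Q → G :* (a :* Q) := a :* (G :* Q)) refl G′ (const a) Q ⟩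
          const a *P (G′ *P Q)     ≈⟨ *P-congˡ (const a) A≐Q ⟨
          const a *P A             ≈⟨ aA≐ ⟩
          G′ *P (const g *P N)     ∎)
        aD′≐gD : (const a *P D′) ≐ (const g *P D)
        aD′≐gD = *P-cancelˡ G′ _ _ (primitive⇒≢0 G′-prim) (begin
          G′ *P (const a *P D′)    ≈⟨ solve 3 (λ G a D → G :* (a :* D) := a :* (G :* D)) refl G′ (const a) D′ ⟩
          const a *P (G′ *P D′)    ≈⟨ *P-congˡ (const a) B≐G′D′ ⟨
          const a *P B             ≈⟨ B≐ ⟩
          G *P D                   ≈⟨ *P-congʳ D G≐ ⟩
          const g *P G′ *P D       ≈⟨ solve 3 (λ g G N → g :* G :* N := G :* (g :* N)) refl (const g) G′ D ⟩
          G′ *P (const g *P D)     ∎)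
        open Cop coprime using (u; v; e≢0; bézout) renaming (e to e₀)
        common : ∀ c r s → Q ≐ (c *P r) → D′ ≐ (c *P s) →
                 (c *P (const a *P (u *P r +P v *P s))) ≐ const (g ℤ.* e₀)
        common c r s hQ hD = begin
          c *P (const a *P (u *P r +P v *P s))          ≈⟨ solve 6 (λ c a u v r s → c :* (a :* (u :* r :+ v :* s)) := u :* (a :* (c :* r)) :+ v :* (a :* (c :* s))) refl c (const a) u v r s ⟩
          u *P (const a *P (c *P r)) +P v *P (const a *P (c *P s))
            ≈⟨ +P-cong (*P-congˡ u (≐-trans (*P-congˡ (const a) (≐-sym hQ)) aQ≐gN)) (*P-congˡ v (≐-trans (*P-congˡ (const a) (≐-sym hD)) aD′≐gD)) ⟩
          u *P (const g *P N) +P v *P (const g *P D)    ≈⟨ solve 5 (λ g u v N D → u :* (g :* N) :+ v :* (g :* D) := g :* (u :* N :+ v :* D)) refl (const g) u v N D ⟩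
          const g *P (u *P N +P v *P D)                 ≈⟨ *P-congˡ (const g) bézout ⟩
          const g *P const e₀                            ≈⟨ const-* g e₀ ⟨
          const (g ℤ.* e₀)                               ∎
        coprime′ : CoprimeP Q D′
        coprime′ c (r , hQ) (s , hD) = const-unit k (primitive-const⇒unit k (primitive-≐ hc c-prim)) hc
          where
          D′≐cs : D′ ≐ (c *P s)
          D′≐cs = ≈P⇒≐ hD
          c-prim : Primitive c
          c-prim = primitive-divˡ c s (primitive-≐ D′≐cs D′-prim)
          constant : ∃[ k ] c ≐ const k
          constant = const-divisor c (const a *P (u *P r +P v *P s)) (*-nonzero g≢0 e≢0) (common c r s (≈P⇒≐ hQ) D′≐cs)
          k = proj₁ constant
          hc : c ≐ const k
          hc = proj₂ constant
        reduced : ReducedForm A B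
        reduced = record
          { N = Q ; D = D′ ; D≢0 = primitive⇒≢0 D′-prim
          ; ratio = begin
              A *P D′             ≈⟨ *P-congʳ D′ A≐Q ⟩
              G′ *P Q *P D′       ≈⟨ solve 3 (λ G Q D → G :* Q :* D := Q :* (G :* D)) refl G′ Q D′ ⟩
              Q *P (G′ *P D′)     ≈⟨ *P-congˡ Q B≐G′D′ ⟨
              Q *P B              ∎
          ; coprime = coprime′ }

  -- The elimination yields N and D coprime over ℚ only, and with an integer a in front of A and B.
  -- Splitting a off gives B = G′ D′ with both factors primitive, and G′ divides A over ℤ because it
  -- does so over ℚ. A common divisor of that quotient and D′ divides a nonzero constant, so it is
  -- constant; dividing the primitive D′, it is a unit.
  reducedForm : ∀ A B → Primitive B → ReducedForm A B
  reducedForm A B B-prim = fromReduction (reduction _ A B ℕₚ.≤-refl)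
    where
    fromReduction : Reduction A B → ReducedForm A B
    fromReduction red = fromSplit (split a a≢0 B G D B≐)
      where
      open Reduction red
      fromSplit : Split B G D → ReducedForm A B
      fromSplit sp = reduced (proj₂ (primitive-∣-const a a≢0 (Split.G′ sp) _ A G′-prim aA≐))
        where open Reduce B-prim red sp

  -- Multiplying u W + v P = e by N shows that P divides e N; primitivity of P removes the integer
  -- e.
  Cop-∣ : ∀ {P W} → Primitive P → Cop W P → ∀ Y N → (N *P W) ≐ (P *P Y) → P ∣̂ N
  Cop-∣ {P} {W} P-prim (cop {u} {v} {e} e≢0 h) Y N hN = primitive-∣-const e e≢0 P (u *P Y +P v *P N) N P-prim (begin
    const e *P N                       ≈⟨ *P-congʳ N h ⟨
    (u *P W +P v *P P) *P N            ≈⟨ solve 5 (λ u v W P N → (u :* W :+ v :* P) :* N := u :* (N :* W) :+ P :* (v :* N)) refl u v W P N ⟩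
    u *P (N *P W) +P P *P (v *P N)     ≈⟨ +P-cong (*P-congˡ u hN) ≐-refl ⟩
    u *P (P *P Y) +P P *P (v *P N)     ≈⟨ solve 5 (λ u v Y P N → u :* (P :* Y) :+ P :* (v :* N) := P :* (u :* Y :+ v :* N)) refl u v Y P N ⟩
    P *P (u *P Y +P v *P N)            ∎)

-- Cyclotomic polynomials and coprimality

module CyclotomicPolynomials where
  open PolynomialRing
  open GaussLemma
  open ReducedForms
  open ≡ using (refl; sym; trans; cong; cong₂; subst)

  open CommutativeRing polyRing using (setoid; -‿cong; reflexive)
  open IntegerSolver polyRing using (solve; _:=_; _:+_; _:*_; _:-_; :-_; :0; :1)
  open RingLemmas polyRing hiding (sum; sum-cong; sum-+; sum-*ˡ; sum-linear; telescope)
  open import Relation.Binary.Reasoning.Setoid setoid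

  Xpow≐pow : ∀ n → Xpow n ≐ pow X n
  Xpow≐pow zero    = ≐-refl
  Xpow≐pow (suc n) = ≐-trans (≐-sym (X-* (Xpow n))) (*P-congˡ X (Xpow≐pow n))

  pow-cong : ∀ {x y} → x ≐ y → ∀ n → pow x n ≐ pow y n
  pow-cong h zero    = ≐-refl
  pow-cong h (suc n) = *P-cong h (pow-cong h n)

  pow-pow : ∀ x m n → pow (pow x m) n ≐ pow x (n ℕ.* m)
  pow-pow x m zero    = ≐-refl
  pow-pow x m (suc n) = ≐-trans (*P-congˡ (pow x m) (pow-pow x m n)) (≐-sym (pow-+ x m (n ℕ.* m)))

  geometric : Poly → ℕ → Poly
  geometric x zero    = []
  geometric x (suc n) = oneP +P x *P geometric x n

  geometric-sum : ∀ x n → ((oneP -P x) *P geometric x n) ≐ (oneP -P pow x n)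
  geometric-sum x zero    = solve 1 (λ x → (:1 :- x) :* :0 := :1 :- :1) refl x
  geometric-sum x (suc n) = linear (solve 3 (λ x g y → (:1 :- x) :* (:1 :+ x :* g) :- (:1 :- x :* y) := x :* ((:1 :- x) :* g :- (:1 :- y))) refl x (geometric x n) (pow x n))
    (x ·∅ geometric-sum x n)

  qintP≐geometric : ∀ n → qintP n ≐ geometric X n
  qintP≐geometric zero    = ≐-refl
  qintP≐geometric (suc n) = begin
    1ℤ ∷ qintP n                ≈⟨ ∷-split 1ℤ (qintP n) ⟩
    const 1ℤ +P X *P qintP n    ≈⟨ +P-cong const-1 (*P-congˡ X (qintP≐geometric n)) ⟩
    oneP +P X *P geometric X n  ∎

  qintP-spec : ∀ n → ((oneP -P X) *P qintP n) ≐ (oneP -P pow X n)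
  qintP-spec n = ≐-trans (*P-congˡ (oneP -P X) (qintP≐geometric n)) (geometric-sum X n)

  pow-neg-odd : ∀ x t → pow (negP x) (suc (t ℕ.+ t)) ≐ negP (pow x (suc (t ℕ.+ t)))
  pow-neg-odd x zero    = solve 1 (λ x → :- x :* :1 := :- (x :* :1)) refl x
  pow-neg-odd x (suc t) = subst (λ k → pow (negP x) (suc (suc k)) ≐ negP (pow x (suc (suc k)))) (sym (ℕₚ.+-suc t t)) (begin
    negP x *P (negP x *P pow (negP x) (suc (t ℕ.+ t)))     ≈⟨ *P-congˡ (negP x) (*P-congˡ (negP x) (pow-neg-odd x t)) ⟩
    negP x *P (negP x *P negP (pow x (suc (t ℕ.+ t))))     ≈⟨ solve 2 (λ x y → :- x :* (:- x :* :- y) := :- (x :* (x :* y))) refl x (pow x (suc (t ℕ.+ t))) ⟩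
    negP (x *P (x *P pow x (suc (t ℕ.+ t))))               ∎)

  -- With y = qⁱ and n odd, 1 + y divides 1 + yⁿ and [n] divides 1 − yⁿ.
  Cop-1+X^ : ∀ i t → Cop (oneP +P pow X i) (qintP (suc (t ℕ.+ t)))
  Cop-1+X^ i t = cop {u = geometric (negP y) n} {v = geometric (pow X n) i *P (oneP -P X)} {e = + 2} (λ ()) (begin
    geometric (negP y) n *P (oneP +P y) +P geometric (pow X n) i *P (oneP -P X) *P qintP n
      ≈⟨ linear (solve 8 (λ g y h x k z y⁻ z′ → g :* (:1 :+ y) :+ h :* (:1 :- x) :* k :- (:1 :+ :1)
            := :1 :* ((:1 :- :- y) :* g :- (:1 :- y⁻)) :+ h :* ((:1 :- x) :* k :- (:1 :- z)) :+ :1 :* ((:1 :- z) :* h :- (:1 :- z′)) :+ (:- :1) :* (y⁻ :- :- z′)) refl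
          (geometric (negP y) n) y (geometric (pow X n) i) X (qintP n) (pow X n) (pow (negP y) n) (pow (pow X n) i))
        (oneP ·∅ geometric-sum (negP y) n ⊞ geometric (pow X n) i ·∅ qintP-spec n ⊞ oneP ·∅ geometric-sum (pow X n) i
          ⊞ negP oneP ·∅ ≐-trans (pow-neg-odd y t) (-‿cong (begin
              pow (pow X i) n      ≈⟨ pow-pow X i n ⟩
              pow X (n ℕ.* i)      ≡⟨ cong (pow X) (ℕₚ.*-comm n i) ⟩
              pow X (i ℕ.* n)      ≈⟨ pow-pow X n i ⟨
              pow (pow X n) i      ∎))) ⟩
    oneP +P oneP       ≈⟨ const-∷ (+ 2) ⟨
    const (+ 2)        ∎)
    where
    n : ℕ
    n = suc (t ℕ.+ t)
    y : Poly
    y = pow X i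

  -- the derivation q d/dq
  θ : Poly → Poly
  θ []      = []
  θ (a ∷ p) = 0ℤ ∷ (p +P θ p)

  coeff-θ : ∀ p i → coeff (θ p) i ≡ + i ℤ.* coeff p i
  coeff-θ []      i       = sym (ℤₚ.*-zeroʳ (+ i))
  coeff-θ (a ∷ p) zero    = sym (ℤₚ.*-zeroˡ a)
  coeff-θ (a ∷ p) (suc i) = trans (coeff-+ p (θ p) i) (trans (cong (ℤ._+_ (coeff p i)) (coeff-θ p i)) (sym (ℤₚ.suc-* (+ i) (coeff p i))))

  θ-cong : ∀ {p r} → p ≐ r → θ p ≐ θ r
  θ-cong {p} {r} h = ⟨ (λ i → trans (coeff-θ p i) (trans (cong (+ i ℤ.*_) (at h i)) (sym (coeff-θ r i)))) ⟩

  θ-+ : ∀ p r → θ (p +P r) ≐ (θ p +P θ r)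
  θ-+ p r = ⟨ (λ i → trans (coeff-θ (p +P r) i) (trans (cong (+ i ℤ.*_) (coeff-+ p r i))
    (trans (ℤₚ.*-distribˡ-+ (+ i) (coeff p i) (coeff r i))
      (sym (trans (coeff-+ (θ p) (θ r) i) (cong₂ ℤ._+_ (coeff-θ p i) (coeff-θ r i))))))) ⟩

  θ-scale : ∀ a p → θ (scale a p) ≐ scale a (θ p)
  θ-scale a []      = ≐-refl
  θ-scale a (b ∷ p) = ∷-cong (sym (ℤₚ.*-zeroʳ a)) (≐-trans (+P-cong (≐-refl {scale a p}) (θ-scale a p)) ⟨ (λ i →
    trans (coeff-+ (scale a p) (scale a (θ p)) i) (trans (cong₂ ℤ._+_ (coeff-scale a p i) (coeff-scale a (θ p) i))
      (trans (sym (ℤₚ.*-distribˡ-+ a (coeff p i) (coeff (θ p) i)))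
        (sym (trans (coeff-scale a (p +P θ p) i) (cong (a ℤ.*_) (coeff-+ p (θ p) i))))))) ⟩)

  θ-* : ∀ p r → θ (p *P r) ≐ (θ p *P r +P p *P θ r)
  θ-* []      r = ≐-refl
  θ-* (a ∷ p) r = begin
    θ (scale a r +P (0ℤ ∷ (p *P r)))                   ≈⟨ θ-+ (scale a r) (0ℤ ∷ (p *P r)) ⟩
    θ (scale a r) +P (0ℤ ∷ (p *P r +P θ (p *P r)))     ≈⟨ +P-cong (≐-trans (θ-scale a r) (≐-sym (const-scale a (θ r)))) (≐-sym (X-* _)) ⟩
    const a *P θ r +P X *P (p *P r +P θ (p *P r))      ≈⟨ +P-cong (≐-refl {const a *P θ r}) (*P-congˡ X (+P-cong (≐-refl {p *P r}) (θ-* p r))) ⟩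
    const a *P θ r +P X *P (p *P r +P (θ p *P r +P p *P θ r))
      ≈⟨ solve 6 (λ a x p r θp θr → a :* θr :+ x :* (p :* r :+ (θp :* r :+ p :* θr)) := x :* (p :+ θp) :* r :+ (a :+ x :* p) :* θr) refl
           (const a) X p r (θ p) (θ r) ⟩
    X *P (p +P θ p) *P r +P (const a +P X *P p) *P θ r
      ≈⟨ +P-cong (*P-congʳ r (X-* (p +P θ p))) (*P-congʳ (θ r) (≐-sym (∷-split a p))) ⟩
    (0ℤ ∷ (p +P θ p)) *P r +P (a ∷ p) *P θ r           ∎

  -- Powers of q are eigenvectors of q d/dq, the advantage over d/dq: θ(qⁿ - 1) - n(qⁿ - 1) is the
  -- constant n, which the product rule turns into a Bézout identity for any two complementary
  -- factors.
  θ-Xpow : ∀ n → θ (Xpow n) ≐ (const (+ n) *P Xpow n)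
  θ-Xpow n = ⟨ (λ i → trans (coeff-θ (Xpow n) i) (trans (support n i) (sym (coeff-const (+ n) (Xpow n) i)))) ⟩
    where
    support : ∀ n i → + i ℤ.* coeff (Xpow n) i ≡ + n ℤ.* coeff (Xpow n) i
    support zero    zero    = refl
    support zero    (suc i) = ℤₚ.*-zeroʳ (+ suc i)
    support (suc n) zero    = sym (ℤₚ.*-zeroʳ (+ suc n))
    support (suc n) (suc i) = trans (ℤₚ.suc-* (+ i) c) (trans (cong (ℤ._+_ c) (support n i)) (sym (ℤₚ.suc-* (+ n) c)))
      where c = coeff (Xpow n) i

  -- Complementary factors of qⁿ − 1 are coprime, by differentiation.
  Cop-factors : ∀ {n} → 1 ℕ.≤ n → ∀ F G → (Xpow n -P oneP) ≐ (F *P G) → Cop F G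
  Cop-factors {n} 1≤n F G h = cop {u = θ G} {v = θ F -P const (+ n) *P F} {e = + n}
    (λ e → ℕₚ.m<n⇒n≢0 1≤n (ℤₚ.+-injective e)) (linear
      (solve 7 (λ F G θF θG c x t → θG :* F :+ (θF :- c :* F) :* G :- c
         := (:- :1) :* (t :- (θF :* G :+ F :* θG)) :+ :1 :* (t :- c :* x) :+ c :* (x :- :1 :- F :* G)) refl
         F G (θ F) (θ G) (const (+ n)) (Xpow n) (θ (Xpow n -P oneP)))
      (negP oneP ·∅ ≐-trans (θ-cong h) (θ-* F G)
        ⊞ oneP ·∅ ≐-trans (θ-+ (Xpow n) (negP oneP)) (≐-trans (+P-cong (θ-Xpow n) (∷-zero)) (+P-identityʳ _))
        ⊞ const (+ n) ·∅ h))
    where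
    ∷-zero : θ (negP oneP) ≐ []
    ∷-zero = ⟨ (λ { zero → refl ; (suc i) → refl }) ⟩

  module Cyclotomic (Φ : ℕ → Poly) (cyc : IsCyclotomic Φ) where

    -- The product over divisors is cut off at a bound N, so that the products for two numbers can
    -- be compared by induction on N.
    divisorProduct : ℕ → ℕ → Poly
    divisorProduct k N = prodP (map Φ (filter (_∣? k) (upTo N)))

    Φ-if : ℕ → ∀ {a} {A : Set a} → Dec A → Poly
    Φ-if N (yes _) = Φ N
    Φ-if N (no _)  = oneP

    prodP-∷ʳ : ∀ ps r → prodP (ps ++ r ∷ []) ≐ (prodP ps *P r)
    prodP-∷ʳ []       r = ≐-trans (*P-comm r oneP) ≐-refl
    prodP-∷ʳ (p ∷ ps) r = ≐-trans (*P-congˡ p (prodP-∷ʳ ps r)) (≐-sym (*P-assoc p (prodP ps) r))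

    divisorProduct-suc : ∀ k N → divisorProduct k (suc N) ≐ (divisorProduct k N *P Φ-if N (N ∣? k))
    divisorProduct-suc k N = begin
      prodP (map Φ (filter (_∣? k) (upTo (suc N))))
        ≡⟨ cong (λ ds → prodP (map Φ (filter (_∣? k) ds))) (Listₚ.upTo-∷ʳ N) ⟨
      prodP (map Φ (filter (_∣? k) (upTo N ++ N ∷ [])))
        ≡⟨ cong (λ ds → prodP (map Φ ds)) (Listₚ.filter-++ (_∣? k) (upTo N) (N ∷ [])) ⟩
      prodP (map Φ (filter (_∣? k) (upTo N) ++ filter (_∣? k) (N ∷ [])))
        ≈⟨ last (filter (_∣? k) (upTo N)) ⟩
      divisorProduct k N *P Φ-if N (N ∣? k) ∎
      where
      last : ∀ ds → prodP (map Φ (ds ++ filter (_∣? k) (N ∷ []))) ≐ (prodP (map Φ ds) *P Φ-if N (N ∣? k))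
      last ds with N ∣? k
      ... | yes _ = ≐-trans (reflexive (cong prodP (Listₚ.map-++ Φ ds (N ∷ [])))) (prodP-∷ʳ (map Φ ds) (Φ N))
      ... | no _  = ≐-trans (reflexive (cong (λ xs → prodP (map Φ xs)) (Listₚ.++-identityʳ ds)))
                            (≐-trans (≐-sym (*P-identityˡ _)) (*P-comm oneP _))

    divisorProduct-∣ : ∀ {g n} → g ∣ℕ n → ∀ N → divisorProduct g N ∣̂ divisorProduct n N
    divisorProduct-∣ g∣n zero = oneP , ≐-sym (*P-identityˡ oneP)
    divisorProduct-∣ {g} {n} g∣n (suc N) with divisorProduct-∣ g∣n N | N ∣? g | N ∣? n | divisorProduct-suc g N | divisorProduct-suc n N
    ... | R , h | yes d | no ¬d | _ | _ = ⊥-elim (¬d (∣ℕ.∣-trans d g∣n))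
    ... | R , h | yes _ | yes _ | e | e′ = R , (begin
      divisorProduct n (suc N)                 ≈⟨ e′ ⟩
      divisorProduct n N *P Φ N                ≈⟨ *P-congʳ (Φ N) h ⟩
      divisorProduct g N *P R *P Φ N           ≈⟨ solve 3 (λ a r f → a :* r :* f := a :* f :* r) refl (divisorProduct g N) R (Φ N) ⟩
      divisorProduct g N *P Φ N *P R           ≈⟨ *P-congʳ R e ⟨
      divisorProduct g (suc N) *P R            ∎)
    ... | R , h | no _ | e₀ | e | e′ = R *P Φ-if N e₀ , (begin
      divisorProduct n (suc N)                     ≈⟨ e′ ⟩
      divisorProduct n N *P Φ-if N e₀              ≈⟨ *P-congʳ (Φ-if N e₀) h ⟩
      divisorProduct g N *P R *P Φ-if N e₀         ≈⟨ solve 3 (λ a r f → a :* r :* f := a :* :1 :* (r :* f)) refl (divisorProduct g N) R (Φ-if N e₀) ⟩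
      divisorProduct g N *P oneP *P (R *P Φ-if N e₀)   ≈⟨ *P-congʳ (R *P Φ-if N e₀) e ⟨
      divisorProduct g (suc N) *P (R *P Φ-if N e₀) ∎)

    divisorProduct-beyond : ∀ g → 1 ℕ.≤ g → ∀ d → divisorProduct g (d ℕ.+ suc g) ≐ divisorProduct g (suc g)
    divisorProduct-beyond g 1≤g zero = ≐-refl
    divisorProduct-beyond g 1≤g (suc d) with (d ℕ.+ suc g) ∣? g | divisorProduct-suc g (d ℕ.+ suc g)
    ... | yes D | _ = ⊥-elim (ℕₚ.<⇒≱ (ℕₚ.m≤n+m (suc g) d) (∣ℕ.∣⇒≤ ⦃ ℕ.>-nonZero 1≤g ⦄ D))
    ... | no _  | e = ≐-trans e (≐-trans (*P-comm _ oneP) (≐-trans (*P-identityˡ _) (divisorProduct-beyond g 1≤g d)))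

    X^-1≐ : ∀ n → 1 ℕ.≤ n → (Xpow n -P oneP) ≐ divisorProduct n (suc n)
    X^-1≐ n 1≤n = ≈P⇒≐ (cyc n 1≤n)

    -- All divisors of g are below n, so their product already divides the product for n cut off
    -- before Φₙ. This places Φₙ and qᵍ - 1 in complementary factors of qⁿ - 1, as `Cop-factors`
    -- requires.
    properDivisor-∣ : ∀ {g n} → 1 ℕ.≤ g → g ∣ℕ n → g ℕ.< n →
                      ∃[ R ] (Xpow n -P oneP) ≐ (Φ n *P (R *P (Xpow g -P oneP)))
    properDivisor-∣ {g} {n} 1≤g g∣n g<n with divisorProduct-∣ g∣n n | n ∣? n | divisorProduct-suc n n
    ... | R , h | no ¬d | _ = ⊥-elim (¬d ∣ℕ.∣-refl)
    ... | R , h | yes _ | e = R , (begin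
      Xpow n -P oneP                               ≈⟨ X^-1≐ n (ℕₚ.≤-trans 1≤g (ℕₚ.<⇒≤ g<n)) ⟩
      divisorProduct n (suc n)                     ≈⟨ e ⟩
      divisorProduct n n *P Φ n                    ≈⟨ *P-congʳ (Φ n) h ⟩
      divisorProduct g n *P R *P Φ n               ≈⟨ solve 3 (λ a r f → a :* r :* f := f :* (r :* a)) refl (divisorProduct g n) R (Φ n) ⟩
      Φ n *P (R *P divisorProduct g n)             ≡⟨ cong (λ k → Φ n *P (R *P divisorProduct g k)) (sym (ℕₚ.m∸n+n≡m g<n)) ⟩
      Φ n *P (R *P divisorProduct g (n ℕ.∸ suc g ℕ.+ suc g))  ≈⟨ *P-congˡ (Φ n) (*P-congˡ R (divisorProduct-beyond g 1≤g (n ℕ.∸ suc g))) ⟩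
      Φ n *P (R *P divisorProduct g (suc g))       ≈⟨ *P-congˡ (Φ n) (*P-congˡ R (X^-1≐ g 1≤g)) ⟨
      Φ n *P (R *P (Xpow g -P oneP))               ∎)

    module _ (n : ℕ) (1<n : 1 ℕ.< n) where
      private
        1≤n : 1 ℕ.≤ n
        1≤n = ℕₚ.<⇒≤ 1<n

        coeff-X^-1 : ∀ n → 1 ℕ.≤ n → coeff (Xpow n -P oneP) 0 ≡ ℤ.- 1ℤ
        coeff-X^-1 (suc n) _ = refl

        X^-1 : ∀ k → (Xpow k -P oneP) ≐ negP (oneP -P pow X k)
        X^-1 k = ≐-trans (+P-cong (Xpow≐pow k) ≐-refl) (solve 1 (λ x → x :- :1 := :- (:1 :- x)) refl (pow X k))

      Ψ : Poly
      Ψ = proj₁ (properDivisor-∣ ℕₚ.≤-refl (∣ℕ.1∣ n) 1<n)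

      Φ-factor : (Xpow n -P oneP) ≐ (Φ n *P (Ψ *P (Xpow 1 -P oneP)))
      Φ-factor = proj₂ (properDivisor-∣ ℕₚ.≤-refl (∣ℕ.1∣ n) 1<n)

      Φ₀≢0 : ¬ coeff (Φ n) 0 ≡ 0ℤ
      Φ₀≢0 z = -1≢0 (trans (sym (coeff-X^-1 n 1≤n)) (trans (at Φ-factor 0)
        (trans (coeff-*₀ (Φ n) (Ψ *P (Xpow 1 -P oneP))) (trans (cong (ℤ._* c) z) (ℤₚ.*-zeroˡ c)))))
        where
        c : ℤ
        c = coeff (Ψ *P (Xpow 1 -P oneP)) 0
        -1≢0 : ¬ ℤ.- 1ℤ ≡ 0ℤ
        -1≢0 ()

      -- Inherited from qⁿ - 1, which is primitive because of its constant term -1.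
      Φ-primitive : Primitive (Φ n)
      Φ-primitive = primitive-divˡ (Φ n) _ (primitive-≐ Φ-factor
        (primitive-coeff (Xpow n -P oneP) 0 (cong (λ a → a ℤ.* a) (coeff-X^-1 n 1≤n))))

      1-X^n : (oneP -P pow X n) ≐ (Φ n *P (Ψ *P (oneP -P X)))
      1-X^n = linear (solve 5 (λ x f g t y → :1 :- y :- f :* (g :* (:1 :- x)) := (:1 :* (t :- :- (:1 :- y))) :+ (:- :1) :* (t :- f :* (g :* (x :- :1)))) refl
          X (Φ n) Ψ (Xpow n -P oneP) (pow X n))
        (oneP ·∅ X^-1 n ⊞ negP oneP ·∅ Φ-factor)

      [n]≐ΦΨ : qintP n ≐ (Φ n *P Ψ)
      [n]≐ΦΨ = *P-cancelˡ (oneP -P X) _ _ (λ z → 1≢0 (at z 0)) (begin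
        (oneP -P X) *P qintP n         ≈⟨ qintP-spec n ⟩
        oneP -P pow X n                ≈⟨ 1-X^n ⟩
        Φ n *P (Ψ *P (oneP -P X))      ≈⟨ solve 3 (λ x f g → f :* (g :* (:1 :- x)) := (:1 :- x) :* (f :* g)) refl X (Φ n) Ψ ⟩
        (oneP -P X) *P (Φ n *P Ψ)      ∎)
        where
        1≢0 : ¬ 1ℤ ≡ 0ℤ
        1≢0 ()

      Cop-ΦΨ : Cop (Φ n) Ψ
      Cop-ΦΨ = Cop-divʳ (Xpow 1 -P oneP) (Cop-resp ≐-refl (*P-comm Ψ (Xpow 1 -P oneP)) (Cop-factors 1≤n _ _ Φ-factor))

      private
        Cop-divisor : ∀ {g} → 1 ℕ.≤ g → g ∣ℕ n → g ℕ.< n → Cop (oneP -P pow X g) (Φ n)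
        Cop-divisor {g} 1≤g g∣n g<n with properDivisor-∣ 1≤g g∣n g<n
        ... | R , h = Cop-sym (Cop-divʳ (negP R) (Cop-resp ≐-refl (begin
          R *P (Xpow g -P oneP)          ≈⟨ *P-congˡ R (X^-1 g) ⟩
          R *P negP (oneP -P pow X g)    ≈⟨ solve 2 (λ R y → R :* (:- y) := :- R :* y) refl R (oneP -P pow X g) ⟩
          negP R *P (oneP -P pow X g)    ∎) (Cop-factors 1≤n _ _ h)))

        -- If g + y n = x i, then 1 - qᵍ = (1 - q^(x i)) - qᵍ(1 - q^(y n)), and geometric sums write
        -- the two differences as multiples of 1 - qⁱ and 1 - qⁿ. For the other sign in Bézout's
        -- identity i and n change places.
        1-X^gcd : ∀ g i → Bézout.Identity g i n → ∃[ a ] ∃[ b ] (oneP -P pow X g) ≐ (a *P (oneP -P pow X i) +P b *P (oneP -P pow X n))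
        1-X^gcd g i (Bézout.+- x y eq) = geometric (pow X i) x , negP (pow X g *P geometric (pow X n) y) ,
          linear (solve 6 (λ G s t k l Y → :1 :- G :- (k :* (:1 :- s) :+ :- (G :* l) :* (:1 :- t))
              := (:- :1) :* ((:1 :- s) :* k :- (:1 :- G :* Y)) :+ G :* ((:1 :- t) :* l :- (:1 :- Y))) refl
            (pow X g) (pow X i) (pow X n) (geometric (pow X i) x) (geometric (pow X n) y) (pow (pow X n) y))
          (negP oneP ·∅ ≐-trans (geometric-sum (pow X i) x) (+P-cong ≐-refl (-‿cong (begin
              pow (pow X i) x                ≈⟨ pow-pow X i x ⟩
              pow X (x ℕ.* i)                ≡⟨ cong (pow X) (sym eq) ⟩
              pow X (g ℕ.+ y ℕ.* n)          ≈⟨ pow-+ X g (y ℕ.* n) ⟩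
              pow X g *P pow X (y ℕ.* n)     ≈⟨ *P-congˡ (pow X g) (≐-sym (pow-pow X n y)) ⟩
              pow X g *P pow (pow X n) y     ∎)))
           ⊞ pow X g ·∅ geometric-sum (pow X n) y)
        1-X^gcd g i (Bézout.-+ x y eq) = negP (pow X g *P geometric (pow X i) x) , geometric (pow X n) y ,
          linear (solve 6 (λ G s t k l Y → :1 :- G :- (:- (G :* k) :* (:1 :- s) :+ l :* (:1 :- t))
              := (:- :1) :* ((:1 :- t) :* l :- (:1 :- G :* Y)) :+ G :* ((:1 :- s) :* k :- (:1 :- Y))) refl
            (pow X g) (pow X i) (pow X n) (geometric (pow X i) x) (geometric (pow X n) y) (pow (pow X i) x))
          (negP oneP ·∅ ≐-trans (geometric-sum (pow X n) y) (+P-cong ≐-refl (-‿cong (begin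
              pow (pow X n) y                ≈⟨ pow-pow X n y ⟩
              pow X (y ℕ.* n)                ≡⟨ cong (pow X) (sym eq) ⟩
              pow X (g ℕ.+ x ℕ.* i)          ≈⟨ pow-+ X g (x ℕ.* i) ⟩
              pow X g *P pow X (x ℕ.* i)     ≈⟨ *P-congˡ (pow X g) (≐-sym (pow-pow X i x)) ⟩
              pow X g *P pow (pow X i) x     ∎)))
           ⊞ pow X g ·∅ geometric-sum (pow X i) x)

      -- The greatest common divisor g of i and n is a proper divisor of n, so Φₙ is prime to 1 -
      -- qᵍ. That is a combination of 1 - qⁱ and 1 - qⁿ, and the latter is a multiple of Φₙ.
      Cop-1-X^ : ∀ i → ¬ n ∣ℕ i → Cop (oneP -P pow X i) (Φ n)
      Cop-1-X^ i n∤i = combine (Cop-divisor 1≤g g∣n g<n) (1-X^gcd g i (Bézout.identity (gcd-GCD i n)))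
        where
        g : ℕ
        g = gcd i n
        g∣n : g ∣ℕ n
        g∣n = gcd[m,n]∣n i n
        1≤g : 1 ℕ.≤ g
        1≤g = ℕₚ.n≢0⇒n>0 (λ z → ℕₚ.m<n⇒n≢0 1≤n (∣ℕ.0∣⇒≡0 (subst (_∣ℕ n) z g∣n)))
        g<n : g ℕ.< n
        g<n = ℕₚ.≤∧≢⇒< (∣ℕ.∣⇒≤ ⦃ ℕ.>-nonZero 1≤n ⦄ g∣n) (λ e → n∤i (subst (_∣ℕ i) e (gcd[m,n]∣m i n)))
        combine : ∀ {G} → Cop G (Φ n) → ∃[ a ] ∃[ b ] G ≐ (a *P (oneP -P pow X i) +P b *P (oneP -P pow X n)) →
                  Cop (oneP -P pow X i) (Φ n)
        combine {G} (cop {u} {v} {e} e≢0 h) (a , b , k) = cop {u = u *P a} {v = u *P b *P (Ψ *P (oneP -P X)) +P v} e≢0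
          (linear (solve 9 (λ u v a b s f w G c → u :* a :* s :+ (u :* b :* w :+ v) :* f :- c
               := :1 :* (u :* G :+ v :* f :- c) :+ (:- u) :* (G :- (a :* s :+ b :* (f :* w)))) refl
             u v a b (oneP -P pow X i) (Φ n) (Ψ *P (oneP -P X)) G (const e))
           (oneP ·∅ h ⊞ negP u ·∅ ≐-trans k (+P-cong ≐-refl (*P-congˡ b 1-X^n))))

-- From divisibility in the localization to reduced numerators

module Congruences where
  open PolynomialRing
  open GaussLemma
  open ReducedForms
  open CyclotomicPolynomials
  open ≡ using (refl; sym; trans; cong; subst)

  private
    primitive-1 : Primitive oneP
    primitive-1 = primitive-coeff oneP 0 refl

    primitive-cancel : ∀ x → Primitive x → ∀ y z → (x *P y) ≐ (x *P z) → y ≐ z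
    primitive-cancel x pr y z = *P-cancelˡ x y z (primitive⇒≢0 pr)

  -- Inverting only the primitive polynomials keeps every denominator primitive, which the reduced form needs.
  open Fractions polyRing using (module Localization)
  open Localization Primitive primitive-1 primitive-* primitive-cancel

  open CommutativeRing localRing using (1#; 0#; -‿inverseʳ) renaming
    (refl to ≃-refl; sym to ≃-sym; trans to ≃-trans; _-_ to _⊝_; *-cong to ⊗-cong; +-cong to ⊕-cong; -‿cong to ⊖-cong;
     *-comm to ⊗-comm; *-assoc to ⊗-assoc; *-identityʳ to ⊗-identityʳ; *-identityˡ to ⊗-identityˡ; +-identityˡ to ⊕-identityˡ; +-identityʳ to ⊕-identityʳ; *-congˡ to ⊗-congˡ; *-congʳ to ⊗-congʳ; reflexive to ≃-reflexive)
  open RingLemmas localRing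

  private
    module PolyPow = RingLemmas polyRing

  X-primitive : Primitive X
  X-primitive = primitive-coeff X 1 refl

  1-X^-primitive : ∀ n → Primitive (oneP -P Xpow (suc n))
  1-X^-primitive n = primitive-coeff (oneP -P Xpow (suc n)) 0 refl

  q q⁻¹ : Loc
  q   = ι X
  q⁻¹ = inverse X X-primitive

  inv : ℕ → Loc
  inv n = inverse (oneP -P Xpow (suc n)) (1-X^-primitive n)

  pow-q : ∀ n → pow q n ≃ ι (Xpow n)
  pow-q zero    = ≃-refl
  pow-q (suc n) = ≃-trans (⊗-congˡ {q} (pow-q n)) (≃-trans (≃-sym (ι-* X (Xpow n))) (ι-cong (X-* (Xpow n))))

  1-pow-q : ∀ n → (1# ⊝ pow q n) ≃ ι (oneP -P Xpow n)
  1-pow-q n = ≃-trans (⊕-cong {1#} ≃-refl (≃-trans (⊖-cong (pow-q n)) ⊖-fraction)) (≃-sym (ι-+ oneP (negP (Xpow n))))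

  inv-spec : ∀ n → ((1# ⊝ pow q (suc n)) ⊗ inv n) ≃ 1#
  inv-spec n = ≃-trans (⊗-congʳ {inv n} (1-pow-q (suc n)))
    (≃-trans (⊗-comm (ι (oneP -P Xpow (suc n))) (inv n)) (inverseˡ (oneP -P Xpow (suc n)) (1-X^-primitive n)))

  q⁻¹-inv : (q ⊗ q⁻¹) ≃ 1#
  q⁻¹-inv = ≃-trans (⊗-comm q q⁻¹) (inverseˡ X X-primitive)

  open QSeries q q⁻¹ q⁻¹-inv inv inv-spec renaming (poch to pochK)
  open Transformation using (term; I₀)

  -- the fractions without poles at P
  record Integral (P : Poly) (x : Loc) : Set where
    constructor integral
    field
      {E W} : Poly
      W-cop : Cop W P
      W-den : (x ⊗ ι W) ≃ ι E
  open Integral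

  module _ (P : Poly) where
    open IntegerSolver localRing using (solve; _:=_; _:+_; _:*_; :-_)

    integral-subring : IsSubring (Integral P)
    integral-subring = record
      { L-≈ = λ h (integral c w) → integral c (≃-trans (⊗-congʳ (≃-sym h)) w)
      ; L-1 = integral {E = oneP} {W = oneP} (Cop-unit oneP {1ℤ} (λ ()) (≐-trans (*P-identityˡ oneP) (≐-sym const-1))) (⊗-identityʳ 1#)
      ; L-+ = λ {x} {y} (integral {E} {W} c w) (integral {E′} {W′} c′ w′) → integral {E = E *P W′ +P E′ *P W} {W = W *P W′} (Cop-*ˡ c c′)
          (≃-trans (⊗-congˡ {x ⊕ y} (ι-* W W′)) (≃-trans
            (solve 4 (λ x y w w′ → (x :+ y) :* (w :* w′) := x :* w :* w′ :+ y :* w′ :* w) refl x y (ι W) (ι W′))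
            (≃-trans (⊕-cong (⊗-congʳ {ι W′} w) (⊗-congʳ {ι W} w′))
              (≃-sym (≃-trans (ι-+ (E *P W′) (E′ *P W)) (⊕-cong (ι-* E W′) (ι-* E′ W)))))))
      ; L-* = λ {x} {y} (integral {E} {W} c w) (integral {E′} {W′} c′ w′) → integral {E = E *P E′} {W = W *P W′} (Cop-*ˡ c c′)
          (≃-trans (⊗-congˡ {x ⊗ y} (ι-* W W′)) (≃-trans
            (solve 4 (λ x y w w′ → x :* y :* (w :* w′) := x :* w :* (y :* w′)) refl x y (ι W) (ι W′))
            (≃-trans (⊗-cong w w′) (≃-sym (ι-* E E′)))))
      ; L-neg = λ {x} (integral {E} {W} c w) → integral {E = negP E} {W = W} c
          (≃-trans (solve 2 (λ x w → :- x :* w := :- (x :* w)) refl x (ι W)) (≃-trans (⊖-cong w) ⊖-fraction))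
      }

    integral-ι : ∀ E → Integral P (ι E)
    integral-ι E = integral {E = E} {W = oneP} (Cop-unit oneP {1ℤ} (λ ()) (≐-trans (*P-identityˡ oneP) (≐-sym const-1))) (⊗-identityʳ (ι E))

    integral-inverse : ∀ {x y W} → Cop W P → y ≃ ι W → (x ⊗ y) ≃ 1# → Integral P x
    integral-inverse {x} {W = W} c h k = integral {E = oneP} {W = W} c (≃-trans (⊗-congˡ {x} (≃-sym h)) k)

    integral-q⁻¹ : ¬ coeff P 0 ≡ 0ℤ → Integral P q⁻¹
    integral-q⁻¹ P₀≢0 = integral-inverse (Cop-X P P₀≢0) (≃-refl {q}) (inverseˡ X X-primitive)

  -- Links the unreduced formal fractions of the statement to elements of the localization;
  -- primitivity of the denominator is part of the link, since `reducedForm` asks for it.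
  record Rep (x : Frac) (κ : Loc) : Set where
    constructor rep
    field
      den-primitive : Primitive (den x)
      value-≃       : (num x / den x [ den-primitive ]) ≃ κ
  open Rep

  rep-≃ : ∀ {x κ μ} → κ ≃ μ → Rep x κ → Rep x μ
  rep-≃ h (rep pr e) = rep pr (≃-trans e h)

  rep-+ : ∀ {x y κ μ} → Rep x κ → Rep y μ → Rep (x +F y) (κ ⊕ μ)
  rep-+ {x} {y} (rep pr e) (rep pr′ e′) = rep (primitive-* (den x) (den y) pr pr′) (≃-trans (≃-sym ⊕-fraction) (⊕-cong e e′))

  rep-* : ∀ {x y κ μ} → Rep x κ → Rep y μ → Rep (x *F y) (κ ⊗ μ)
  rep-* {x} {y} (rep pr e) (rep pr′ e′) = rep (primitive-* (den x) (den y) pr pr′) (≃-trans (≃-sym ⊗-fraction) (⊗-cong e e′))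

  rep-neg : ∀ {x κ} → Rep x κ → Rep (negF x) (⊖ κ)
  rep-neg (rep pr e) = rep pr (≃-trans (≃-sym ⊖-fraction) (⊖-cong e))

  rep-- : ∀ {x y κ μ} → Rep x κ → Rep y μ → Rep (x -F y) (κ ⊝ μ)
  rep-- r s = rep-+ r (rep-neg s)

  -- Division turns the numerator c of the divisor into part of a denominator, so c has to be
  -- primitive. It is, because the inverse ν exhibits c as a factor of the primitive `d *P bot ν`.
  rep-/ : ∀ {x y κ μ ν} → Rep x κ → Rep y μ → (μ ⊗ ν) ≃ 1# → Rep (x /F y) (κ ⊗ ν)
  rep-/ {x} {c // d} {κ} {μ} {ν} (rep pr e) (rep pr′ e′) h =
    rep (primitive-* (den x) c pr c-prim) (≃-trans (≃-sym ⊗-fraction) (⊗-cong e d/c≃ν))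
    where
    open IntegerSolver polyRing using (solve; _:=_; _:*_; :1)
    c/d⊗ν : ((c / d [ pr′ ]) ⊗ ν) ≃ 1#
    c/d⊗ν = ≃-trans (⊗-congʳ {ν} e′) h
    cν≐dν : (c *P top ν) ≐ (d *P bot ν)
    cν≐dν = ≐-trans (solve 1 (λ a → a := a :* :1) refl (c *P top ν)) (≐-trans (uncross (≃-trans (≃-sym (⊗-fraction {bd∈M = primitive-* d (bot ν) pr′ (bot∈M ν)})) c/d⊗ν)) (*P-identityˡ (d *P bot ν)))
    c-prim : Primitive c
    c-prim = primitive-divˡ c (top ν) (primitive-≐ (≐-sym cν≐dν) (primitive-* d (bot ν) pr′ (bot∈M ν)))
    d/c≃ν : (d / c [ c-prim ]) ≃ ν
    d/c≃ν = cross (≐-trans (≐-sym cν≐dν) (*P-comm c (top ν)))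

  rep-ι : ∀ p → Rep (p // oneP) (ι p)
  rep-ι p = rep (primitive-1) ≃-refl

  rep-qpow : ∀ n → Rep (qpowF (+ n)) (pow q n)
  rep-qpow n = rep-≃ (≃-sym (pow-q n)) (rep-ι (Xpow n))

  rep-q⁻¹ : Rep (qpowF -[1+ 0 ]) q⁻¹
  rep-q⁻¹ = rep X-primitive ≃-refl

  rep-pow : ∀ {x κ} → Rep x κ → ∀ n → Rep (powF x n) (pow κ n)
  rep-pow r zero    = rep-ι oneP
  rep-pow r (suc n) = rep-* r (rep-pow r n)

  rep-poch : ∀ {x y κ} → Rep x κ → Rep y p → ∀ k → Rep (poch x y k) (pochK κ k)
  rep-poch r s zero    = rep-ι oneP
  rep-poch r s (suc k) = rep-* (rep-poch r s k) (rep-- (rep-ι oneP) (rep-* r (rep-pow s k)))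

  rep-p : Rep (powF (qpowF (+ 1)) 2) p
  rep-p = rep-≃ (⊗-congˡ {q} (⊗-identityʳ q)) (rep-pow (rep-≃ (⊗-identityʳ q) (rep-qpow 1)) 2)

  pow-4k : ∀ k → pow q (4 ℕ.* k) ≃ (pow p k ⊗ pow p k)
  pow-4k k = ≃-trans (≃-reflexive (cong (pow q) 4k)) (≃-trans (pow-+ q (k ℕ.+ k) (k ℕ.+ k)) (⊗-cong (≃-sym (pow-double k)) (≃-sym (pow-double k))))
    where
    4k : 4 ℕ.* k ≡ (k ℕ.+ k) ℕ.+ (k ℕ.+ k)
    4k = trans (cong (λ j → k ℕ.+ (k ℕ.+ (k ℕ.+ j))) (ℕₚ.+-identityʳ k)) (sym (ℕₚ.+-assoc k k (k ℕ.+ k)))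

  rep-4k-1 : ∀ k → Rep (qpowF ((+ (4 ℕ.* k)) ℤ.- 1ℤ)) (pow p k ⊗ pow p k ⊗ q⁻¹)
  -- At k = 0 the exponent 4k - 1 is negative and `qpowF` takes its other branch.
  rep-4k-1 zero    = rep-≃ (≃-sym (≃-trans (⊗-congʳ {q⁻¹} (⊗-identityˡ 1#)) (⊗-identityˡ q⁻¹))) rep-q⁻¹
  rep-4k-1 (suc k) = rep-≃ (≃-trans (≃-sym (≃-trans (⊗-congʳ {q⁻¹} (⊗-comm q Q)) (≃-trans (⊗-assoc Q q q⁻¹) (≃-trans (⊗-congˡ {Q} q⁻¹-inv) (⊗-identityʳ Q)))))
                                    (⊗-congʳ {q⁻¹} (pow-4k (suc k))))
                           (rep-qpow (k ℕ.+ 3 ℕ.* suc k))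
    where
    Q : Loc
    Q = pow q (k ℕ.+ 3 ℕ.* suc k)

  rep-summand : ∀ k → Rep (summand k) (term k)
  rep-summand k = rep-≃ (solve 5 (λ a i P b J → a :* i :* (P :* (P :* (P :* (P :* :1)))) :* (b :* (b :* (b :* (b :* :1)))) :* J
                                  := a :* i :* (P :* P :* P :* P) :* (b :* b :* b :* b) :* J) refl
                           (1# ⊝ pow p k ⊗ pow p k ⊗ q⁻¹) I₀ (pochK q⁻¹ k) (ib k) (pow p k ⊗ pow p k))
    (rep-* (rep-/ (rep-* (rep-/ (rep-- (rep-ι oneP) (rep-4k-1 k)) (rep-- (rep-ι oneP) (rep-qpow 1)) (inv-spec 0))
                         (rep-pow (rep-poch rep-q⁻¹ rep-p k) 4))
                  (rep-pow (rep-poch rep-p rep-p k) 4) (pow-1 (ib-inv k) 4))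
           (rep-≃ (pow-4k k) (rep-qpow (4 ℕ.* k))))
    where open IntegerSolver localRing using (solve; _:=_; _:*_; :1)

  rep-S : ∀ m → Rep (S m) (sum (suc m) term)
  rep-S zero    = rep-≃ (≃-sym (⊕-identityˡ (term 0))) (rep-summand 0)
  rep-S (suc m) = rep-+ (rep-S m) (rep-summand (suc m))

  -- If the fraction is P E / W, then N W = P E D, and W is prime to P. Poles are tested at Q and
  -- divisibility at P, which differ when Q = φ and P = φ³; `lift` bridges the two.
  numerator-∣ : ∀ {x κ} → Rep x κ → ∀ {N D} → (num x *P D) ≐ (N *P den x) →
                ∀ Q P → Primitive P → (∀ {W} → Cop W Q → Cop W P) →
                ∀ {d} → d ≃ ι P → IsSubring._∣ₗ_ (integral-subring Q) d κ → P ∣̂ N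
  numerator-∣ {x} {κ} (rep pr e) {N} {D} ND Q P P-prim lift {d} d≃P (y , integral {E} {W} c w , h) =
    Cop-∣ P-prim (lift c) (E *P D) N (*P-cancelˡ (den x) _ _ (primitive⇒≢0 pr) (linearP
      (solve 7 (λ A B D E N P W → B :* (N :* W) :- B :* (P :* (E :* D))
          := (:- W) :* (A :* D :- N :* B) :+ D :* (A :* W :* :1 :- P :* E :* (B :* :1))) refl
        (num x) (den x) D E N P W)
      (negP W ·∅P ND ⊞P D ·∅P uncross (≃-trans (≃-sym (⊗-fraction {bd∈M = primitive-* (den x) oneP pr (primitive-1)})) AW≃PE))))
    where
    open IntegerSolver polyRing using (solve; _:=_; _:+_; _:*_; _:-_; :-_; :1)
    open RingLemmas polyRing using () renaming (linear to linearP; _·∅_ to _·∅P_; _⊞_ to _⊞P_)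
    AW≃PE : ((num x / den x [ pr ]) ⊗ ι W) ≃ ι (P *P E)
    AW≃PE = ≃-trans (⊗-congʳ {ι W} (≃-trans e h)) (≃-trans (⊗-assoc d y (ι W))
      (≃-trans (⊗-cong d≃P w) (≃-sym (ι-* P E))))

  1-pow-q≃ : ∀ n → (1# ⊝ pow q n) ≃ ι (oneP -P PolyPow.pow X n)
  1-pow-q≃ n = ≃-trans (1-pow-q n) (ι-cong (+P-cong (≐-refl {oneP}) (negP-cong (Xpow≐pow n))))

  module Congruence (Φ : ℕ → Poly) (cyc : IsCyclotomic Φ) (r : ℕ) (1≤r : 1 ℕ.≤ r) where
    n : ℕ
    n = suc (r ℕ.+ r)

    1<n : 1 ℕ.< n
    1<n = ℕ.s≤s (ℕₚ.≤-trans 1≤r (ℕₚ.m≤m+n r r))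

    open Cyclotomic Φ cyc

    [n] φ : Poly
    [n] = qintP n
    φ   = Φ n

    private
      module Int = IsSubring (integral-subring [n])
      module Cub = IsSubring (integral-subring φ)

    [n]-primitive : Primitive [n]
    [n]-primitive = primitive-coeff [n] 0 refl

    [n]∣sum : ∀ {m} → m ≡ suc r ⊎ m ≡ r ℕ.+ r → ι [n] Int.∣ₗ sum (suc m) term
    [n]∣sum = λ { (inj₁ refl) → ν∣sum-half ν-spec r refl ; (inj₂ refl) → ν∣sum-full ν-spec (r ℕ.+ r) refl }
      where
      [n]₀≢0 : ¬ coeff [n] 0 ≡ 0ℤ
      [n]₀≢0 ()
      1+q^-unit : ∀ k → Integral [n] ((1# ⊝ pow q (suc k)) ⊗ p-inv k)
      1+q^-unit k = integral-inverse [n] (Cop-1+X^ (suc k) r)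
        (≃-trans (⊕-cong {1#} ≃-refl (≃-trans (pow-q (suc k)) (ι-cong (Xpow≐pow (suc k))))) (≃-sym (ι-+ oneP (PolyPow.pow X (suc k)))))
        (p-inv-half k)
      open Integrality (integral-subring [n]) (integral-ι [n] X) (integral-q⁻¹ [n] [n]₀≢0) 1+q^-unit
      ν-spec : (ι [n] ⊗ (1# ⊝ q)) ≃ (1# ⊝ pow q n)
      ν-spec = ≃-trans (⊗-congˡ {ι [n]} (≃-trans (⊕-cong {1#} ≃-refl ⊖-fraction) (≃-sym (ι-+ oneP (negP X)))))
        (≃-trans (≃-sym (ι-* [n] (oneP -P X))) (≃-trans (ι-cong (≐-trans (*P-comm [n] (oneP -P X)) (qintP-spec n))) (≃-sym (1-pow-q≃ n))))

    -- As n is odd, it would have to divide k + 1, which is smaller than n; so each 1 - q²ᵏ⁺² in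
    -- this range is prime to Φₙ.
    n∤double : ∀ {k} → k ℕ.< r ℕ.+ r → ¬ n ∣ℕ suc k ℕ.+ suc k
    n∤double {k} k<2r d = ℕₚ.<⇒≱ (ℕ.s≤s k<2r) (∣ℕ.∣⇒≤ (coprime-divisor n⊥2 (subst (n ∣ℕ_) (cong (suc k ℕ.+_) (sym (ℕₚ.+-identityʳ (suc k)))) d)))
      where
      n⊥2 : Coprime n 2
      n⊥2 {j} (j∣n , j∣2) = ∣ℕ.∣1⇒≡1 (∣ℕ.∣m+n∣m⇒∣n {m = r ℕ.+ r} (subst (j ∣ℕ_) (ℕₚ.+-comm 1 (r ℕ.+ r)) j∣n)
        (∣ℕ.∣-trans j∣2 (∣ℕ.divides r (trans (cong (r ℕ.+_) (sym (ℕₚ.+-identityʳ r))) (ℕₚ.*-comm 2 r)))))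

    φ³∣sum : ∀ {m} → m ≡ suc r ⊎ m ≡ r ℕ.+ r → (ι φ ⊗ ι φ ⊗ ι φ) Cub.∣ₗ sum (suc m) term
    φ³∣sum = λ { (inj₁ refl) → φ³∣sum-half ; (inj₂ refl) → φ³∣sum-full }
      where
      n∤1 : ¬ n ∣ℕ 1
      n∤1 d = ℕₚ.<⇒≱ 1<n (∣ℕ.∣⇒≤ d)
      I₀-integral : Integral φ (inv 0)
      I₀-integral = integral-inverse φ (Cop-1-X^ n 1<n 1 n∤1) (1-pow-q≃ 1) (≃-trans (⊗-comm (inv 0) _) (inv-spec 0))
      p-inv-integral : ∀ k → k ℕ.< r ℕ.+ r → Integral φ (p-inv k)
      p-inv-integral k k<2r = integral-inverse φ (Cop-1-X^ n 1<n (suc k ℕ.+ suc k) (n∤double k<2r))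
        (≃-trans (⊕-cong {1#} ≃-refl (⊖-cong (pow-double (suc k)))) (1-pow-q≃ (suc k ℕ.+ suc k)))
        (≃-trans (⊗-comm (p-inv k) _) (p-inv-spec k))
      φ∣1-q^n : ι φ Cub.∣ₗ (1# ⊝ pow q n)
      φ∣1-q^n = ι (Ψ n 1<n *P (oneP -P X)) , integral-ι φ _ ,
        ≃-trans (1-pow-q≃ n) (≃-trans (ι-cong (1-X^n n 1<n)) (ι-* φ _))
      open CubeDivisibility (integral-subring φ) (integral-ι φ X) (integral-q⁻¹ φ (Φ₀≢0 n 1<n)) I₀-integral
        r 1≤r p-inv-integral φ∣1-q^n

    congruence : ∀ {m} → m ≡ suc r ⊎ m ≡ r ℕ.+ r → CongMod (S m) zeroF ([n] *P φ *P φ)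
    congruence {m} hm =
        (λ z → primitive⇒≢0 (den-primitive (rep-S m)) (IsZeroP⇒≐ z))
      , (λ z → primitive⇒≢0 (primitive-1) (IsZeroP⇒≐ z))
      , N , D , (λ z → D≢0 (IsZeroP⇒≐ z)) , ≐⇒≈P ratio , coprime , [n]φ²∣N
      where
      x : Frac
      x = S m -F zeroF
      x-rep : Rep x (sum (suc m) term)
      x-rep = rep-≃ (≃-trans (⊕-cong {sum (suc m) term} ≃-refl (≃-trans (≃-sym (⊕-identityˡ (⊖ 0#))) (-‿inverseʳ 0#))) (⊕-identityʳ (sum (suc m) term)))
                    (rep-- (rep-S m) (rep-ι []))
      open ReducedForm (reducedForm (num x) (den x) (den-primitive x-rep))
      φ-prim : Primitive φ
      φ-prim = Φ-primitive n 1<n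
      φ²-prim : Primitive (φ *P φ)
      φ²-prim = primitive-* φ φ φ-prim φ-prim
      [n]∣N : [n] ∣̂ N
      [n]∣N = numerator-∣ x-rep ratio [n] [n] [n]-primitive (λ c → c) ≃-refl ([n]∣sum hm)
      φ³∣N : φ *P φ *P φ ∣̂ N
      φ³∣N = numerator-∣ x-rep ratio φ (φ *P φ *P φ) (primitive-* (φ *P φ) φ φ²-prim φ-prim) (λ c → Cop-*ʳ (Cop-*ʳ c c) c)
        (≃-sym (≃-trans (ι-* (φ *P φ) φ) (⊗-congʳ {ι φ} (ι-* φ φ)))) (φ³∣sum hm)
      N′ Y ψ : Poly
      N′ = proj₁ [n]∣N
      Y  = proj₁ φ³∣N
      ψ  = Ψ n 1<n
      open IntegerSolver polyRing using (solve; _:=_; _:+_; _:*_; _:-_; :-_; :1)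
      open RingLemmas polyRing using () renaming (linear to linearP; _·∅_ to _·∅P_; _⊞_ to _⊞P_)
      φ²∣N′ : φ *P φ ∣̂ N′
      -- From N = φ ψ N′ = φ³ Y one factor φ cancels, leaving ψ N′ = φ² Y with ψ prime to φ.
      φ²∣N′ = Cop-∣ φ²-prim (Cop-*ʳ (Cop-sym (Cop-ΦΨ n 1<n)) (Cop-sym (Cop-ΦΨ n 1<n))) Y N′
        (*P-cancelˡ φ _ _ (primitive⇒≢0 φ-prim) (linearP
          (solve 6 (λ f g v N N′ Y → f :* (N′ :* g) :- f :* (f :* f :* Y)
              := (:- :1) :* (N :- v :* N′) :+ :1 :* (N :- f :* f :* f :* Y) :+ (:- N′) :* (v :- f :* g)) refl
            φ ψ [n] N N′ Y)
          (negP oneP ·∅P proj₂ [n]∣N ⊞P oneP ·∅P proj₂ φ³∣N ⊞P negP N′ ·∅P [n]≐ΦΨ n 1<n)))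
      [n]φ²∣N : ([n] *P φ *P φ) ∣P N
      [n]φ²∣N = proj₁ φ²∣N′ , ≐⇒≈P (≐-trans (proj₂ [n]∣N) (≐-trans (*P-congˡ [n] (proj₂ φ²∣N′))
        (solve 3 (λ v f z → v :* (f :* f :* z) := v :* f :* f :* z) refl [n] φ (proj₁ φ²∣N′))))

-- The two values of m in terms of n = 2t + 1

open import Data.Nat using (_<_; _*_; _+_; _∸_)

theorem5p3 : (Φ : ℕ → Poly) → IsCyclotomic Φ →
    (n m : ℕ) → 1 < n → (∃[ t ] n ≡ suc (2 * t)) →
    (m ≡ n ∸ 1 ⊎ 2 * m ≡ n + 1) →
    CongMod (S m) zeroF (qintP n *P Φ n *P Φ n)
theorem5p3 Φ cyc n m 1<n (t , n≡) hm with ≡.trans n≡ (≡.cong (λ k → suc (t + k)) (ℕₚ.+-identityʳ t))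
... | ≡.refl = Congruence.congruence Φ cyc t 1≤t (cases hm)
  where
  open Congruences using (module Congruence)
  1≤t : 1 ℕ.≤ t
  1≤t = ℕₚ.n≢0⇒n>0 λ { ≡.refl → ℕₚ.<-irrefl ≡.refl 1<n }
  cases : m ≡ t + t ⊎ 2 * m ≡ suc (t + t) + 1 → m ≡ suc t ⊎ m ≡ t + t
  cases (inj₁ e) = inj₂ e
  cases (inj₂ e) = inj₁ (ℕₚ.*-cancelˡ-≡ m (suc t) 2 (≡.trans e (≡.trans (ℕₚ.+-comm (suc (t + t)) 1)
    (≡.sym (≡.cong suc (≡.trans (≡.cong (λ k → t + k) (ℕₚ.+-identityʳ (suc t))) (ℕₚ.+-suc t t)))))))
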